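{- Let $p,\ell$ be integers with $p>3$ and $2\le \ell\le p$, and let $F$ be a doubly edge-$p$-critical $2$-graph in class $\ell$. Then for all sufficiently large $n$ (i.e. $1/n\ll p$), $$\mathrm{ar}(n,3,F^{(3)})=t_p(n,3)+\ell.$$
   Context: An $r$-graph is identified with its edge set, a family of $r$-element subsets of a vertex set; $K_n^r=\binom{[n]}{r}$. For an edge-coloring of an $r$-graph, a subgraph is rainbow if no two of its edges have the same color. The anti-Ramsey number $\mathrm{ar}(n,r,H)$ is the minimum number $c$ such that every edge-coloring of $K_n^r$ using at least $c$ colors contains a rainbow subgraph isomorphic to $H$. For a $2$-graph $F$, the expansion $F^{(r)}$ is the $r$-graph on $|V(F)|+(r-2)|F|$ vertices obtained by adding to each edge of $F$ a set of $r-2$ new vertices (distinct new vertices for distinct edges). $\chi$ denotes the chromatic number. A $2$-graph $F$ is doubly edge-$p$-critical if $\chi(F-e)\ge p$ for every edge $e\in F$ and there exist two edges $e_1,e_2\in F$ with $\chi(F-e_1-e_2)=p-1$. For a partition $\mathcal P=V_1\cup\dots\cup V_{p-1}$ of $V(F)$ into $p-1$ parts, the index vector is $\mathbf a_F(\mathcal P)=(e(V_1),\dots,e(V_{p-1}))$, where $e(V_i)$ is the number of edges of $F$ inside $V_i$. Let $\mathbf{\mathcal P}(F)$ be the set of $(p-1)$-partitions $\mathcal P$ of $V(F)$ with $\|\mathbf a_F(\mathcal P)\|_\infty=1$. For $1\le \ell\le p-1$, $F$ is in class $\ell$ if $\min_{\mathcal P\in\mathbf{\mathcal P}(F)}\|\mathbf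 a_F(\mathcal P)\|_1=\ell$; if $\mathbf{\mathcal P}(F)=\emptyset$, $F$ is in class $p$. $T_p(n,r)$ is the $r$-graph on $[n]$ obtained by partitioning $[n]$ into $p-1$ parts whose sizes differ by at most one and taking all $r$-sets meeting each part in at most one vertex; $t_p(n,r)=|T_p(n,r)|$.
   Formalization: How large n must be may depend on F (and ℓ), not only on p as "1/n ≪ p" suggests; with a bound in p alone the claim fails, e.g. for K_{p+1} with more than n isolated vertices added. -}

module Defs where

open import Data.Nat using (ℕ; zero; suc; _+_; _∸_; _≤_; _<_; _≤?_; _≡ᵇ_)
open import Data.Nat.Properties using () renaming (_≟_ to _≟ℕ_)
open import Data.Nat.DivMod using (_%_)
open import Data.Bool using (Bool; true; false)
open import Data.Fin using (Fin; toℕ; _↑ˡ_; _↑ʳ_)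
open import Data.Fin.Properties using (all?) renaming (_≟_ to _≟F_)
open import Data.Fin.Subset using (Subset; ⁅_⁆; _∪_; _∩_; ∣_∣)
open import Data.Vec using (Vec; []; _∷_; tabulate)
open import Data.List using (List; []; _∷_; map; _++_; filter; length; deduplicate; allFin)
open import Data.Nat.ListAction using (sum)
open import Data.Product using (Σ; ∃; ∃-syntax; _×_; _,_; proj₁; proj₂)
open import Data.Sum using (_⊎_)
open import Relation.Nullary using (¬_)
open import Relation.Nullary.Decidable using (_×-dec_)
open import Relation.Binary.PropositionalEquality using (_≡_; _≢_)
open import Function.Definitions using (Injective)

record Graph : Set where
  field
    m    : ℕ
    k    : ℕ
    ends : Fin k → Fin m × Fin m
    ordered : ∀ i → toℕ (proj₁ (ends i)) < toℕ (proj₂ (ends i))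
    distinct : Injective _≡_ _≡_ ends

module _ (F : Graph) where
  open Graph F

  u v : Fin k → Fin m
  u i = proj₁ (ends i)
  v i = proj₂ (ends i)

  -- A spanning subgraph of F is given by a predicate on edge indices.
  -- Proper j-colouring of the subgraph S.
  Colorable : (Fin k → Set) → ℕ → Set
  Colorable S j = Σ (Fin m → Fin j) λ col → ∀ i → S i → col (u i) ≢ col (v i)

  IsChromaticNumber : (Fin k → Set) → ℕ → Set
  IsChromaticNumber S c = Colorable S c × (∀ j → Colorable S j → c ≤ j)

  ChiAtLeast : (Fin k → Set) → ℕ → Set
  ChiAtLeast S p = ∀ j → Colorable S j → p ≤ j

  DoublyEdgeCritical : ℕ → Set
  DoublyEdgeCritical p =
    (∀ (e : Fin k) → ChiAtLeast (λ i → i ≢ e) p) ×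
    (Σ (Fin k) λ e₁ → Σ (Fin k) λ e₂ →
       IsChromaticNumber (λ i → i ≢ e₁ × i ≢ e₂) (p ∸ 1))

  -- (p-1)-partitions of V(F): maps Fin m → Fin (p ∸ 1) (parts V_t = preimage of t)
  -- e(V_t) : number of edges of F with both ends in V_t
  eIn : ∀ {q} → (Fin m → Fin q) → Fin q → ℕ
  eIn π t = length (filter (λ i → (π (u i) ≟F t) ×-dec (π (v i) ≟F t)) (allFin k))

  norm1 : ∀ {q} → (Fin m → Fin q) → ℕ
  norm1 {q} π = sum (map (eIn π) (allFin q))

  InPF : ∀ {q} → (Fin m → Fin q) → Set
  InPF π = (∀ t → eIn π t ≤ 1) × (∃[ t ] eIn π t ≡ 1)

  InClass : ℕ → ℕ → Set
  InClass p ℓ =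
    (1 ≤ ℓ × ℓ ≤ p ∸ 1 ×
      (Σ (Fin m → Fin (p ∸ 1)) λ π → InPF π × norm1 π ≡ ℓ) ×
      (∀ (π : Fin m → Fin (p ∸ 1)) → InPF π → ℓ ≤ norm1 π))
    ⊎ (ℓ ≡ p × (∀ (π : Fin m → Fin (p ∸ 1)) → ¬ InPF π))

record Graph3 : Set where
  field
    nv : ℕ
    ne : ℕ
    edge : Fin ne → Fin nv × Fin nv × Fin nv

expansion3 : Graph → Graph3
expansion3 F = record
  { nv = m + k
  ; ne = k
  ; edge = λ i → (u F i ↑ˡ k) , (v F i ↑ˡ k) , (m ↑ʳ i)
  }
  where open Graph F

allSubsets : (n : ℕ) → List (Subset n)
allSubsets zero = [] ∷ []
allSubsets (suc n) = map (true ∷_) (allSubsets n) ++ map (false ∷_) (allSubsets n)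

triples : (n : ℕ) → List (Subset n)
triples n = filter (λ s → ∣ s ∣ ≟ℕ 3) (allSubsets n)

-- an edge-colouring of K_n^3 (colours are natural numbers;
-- only its values on 3-subsets matter)
Colouring : ℕ → Set
Colouring n = Subset n → ℕ

numColours : ∀ {n} → Colouring n → ℕ
numColours {n} κ = length (deduplicate _≟ℕ_ (map κ (triples n)))

img3 : ∀ {a n} → (Fin a → Fin n) → Fin a × Fin a × Fin a → Subset n
img3 φ (x , y , z) = ⁅ φ x ⁆ ∪ ⁅ φ y ⁆ ∪ ⁅ φ z ⁆

HasRainbowCopy : ∀ {n} → Colouring n → Graph3 → Set
HasRainbowCopy {n} κ H =
  Σ (Fin nv → Fin n) λ φ → Injective _≡_ _≡_ φ ×
    (∀ i j → i ≢ j → κ (img3 φ (edge i)) ≢ κ (img3 φ (edge j)))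
  where open Graph3 H

ForcesRainbow : ℕ → Graph3 → ℕ → Set
ForcesRainbow n H c = ∀ (κ : Colouring n) → c ≤ numColours κ → HasRainbowCopy κ H

IsAntiRamsey3 : ℕ → Graph3 → ℕ → Set
IsAntiRamsey3 n H N = ForcesRainbow n H N × (∀ c → ForcesRainbow n H c → N ≤ c)

-- Turán 3-graph T_p(n,3): parts V_t = {x ∈ [n] : x mod (p-1) = t}, t < p-1
-- (p-1 nearly equal parts); edges are 3-sets meeting each part in at most one vertex.

partSet : ∀ {n} (q : ℕ) → Fin (suc q) → Subset n
partSet q t = tabulate (λ x → (toℕ x % suc q) ≡ᵇ toℕ t)

-- t_p(n,3); defined for p ≥ 2 (p - 1 ≥ 1 parts); value 0 for p < 2 is junk
tp3 : ℕ → ℕ → ℕ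
tp3 (suc (suc q)) n =
  length (filter (λ s → all? (λ t → ∣ s ∩ partSet q t ∣ ≤? 1)) (triples n))
tp3 _ n = 0

{-# OPTIONS --safe #-}

-- Lower bound: colour the crossing triples of a balanced (p - 1)-partition with private colours and a triple with two
-- vertices in part t by min t (ℓ - 2).  A rainbow copy of the expansion would induce a partition of F with at most one
-- edge inside each part, hence with at least ℓ such edges, but only ℓ - 1 colours are available for them.
--
-- Upper bound: deleting a vertex that meets few colours raises the excess of the number of colours over tp3, which is
-- impossible for too many steps, so every vertex may be assumed to meet about as many colours as in the Turán 3-graph.
-- Let J be the graph of the pairs lying in many triples of a family R of representatives of the colours.  Erdős–Stone,
-- applied in J-neighbourhoods and then globally, yields a large complete (p - 1)-partite subgraph of J, around which all
-- vertices are assigned to p - 1 types, each vertex being J-adjacent to almost all vertices of the other types.  Since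
-- F - e₁ - e₂ is (p - 1)-colourable, two triples of different colours with two vertices in one type would give a rainbow
-- copy; so R contains at most one triple of this kind for each type.  At most tp3 triples of R cross the types, hence at
-- least ℓ types carry such a triple.  This is absurd if ℓ = p, and otherwise a partition of F with ℓ edges inside
-- distinct parts embeds with all its colours distinct.

module Submission where

open import Defs
open import Data.Nat hiding (_≟_)
open import Data.Nat.Properties hiding (_≟_)
open import Data.Nat.Properties using () renaming (_≟_ to _≟ℕ_)
open import Data.Nat.DivMod using (_%_; _/_; m≡m%n+[m/n]*n; m%n<n; [m+n]%n≡m%n; m<n⇒m%n≡m; [m+kn]%n≡m%n; m/n*n≤m; /-monoˡ-≤; m*n/n≡m)
open import Data.Nat.Tactic.RingSolver using (solve-∀)
open import Data.Bool using (Bool; true; false; _∧_; not; if_then_else_) renaming (_≟_ to _≟ᴮ_)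
open import Data.Fin as Fin using (Fin; zero; suc; toℕ; _↑ˡ_; _↑ʳ_; splitAt; punchIn; _≟_; fromℕ<)
import Data.Fin.Properties as Finₚ
import Data.Fin.Permutation.Components as PC
open import Data.Fin.Subset using (Subset; ⁅_⁆; _∪_; _∩_; ∣_∣) renaming (⊥ to ⊥ˢ; _∈_ to _∈ˢ_)
import Data.Fin.Subset.Properties as Subₚ
open import Data.Vec as Vec using (Vec; []; _∷_; tabulate; lookup)
import Data.Vec.Properties as Vecₚ
open import Data.List as List using (List; []; _∷_; _++_; map; filter; length; deduplicate; allFin)
import Data.List.Properties as Listₚ
import Data.Nat.ListAction as ListAction
open import Data.List.Relation.Unary.All as All using (All; []; _∷_)
import Data.List.Relation.Unary.All.Properties as Allₚ
open import Data.List.Relation.Unary.Any as Any using (Any; here; there)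
open import Data.List.Relation.Unary.AllPairs using (AllPairs; []; _∷_)
open import Data.List.Relation.Unary.Unique.Propositional using (Unique)
import Data.List.Relation.Unary.Unique.Propositional.Properties as Uniqueₚ
open import Data.List.Membership.Propositional using (_∈_; _∉_)
import Data.List.Membership.Propositional.Properties as ∈ₚ
open import Data.List.Relation.Unary.Unique.DecPropositional.Properties _≟ℕ_ using (deduplicate-!)
open import Data.Maybe using (Maybe; just; nothing; fromMaybe)
open import Data.Maybe.Properties using (just-injective)
open import Data.Product using (Σ; ∃; ∃-syntax; _×_; _,_; proj₁; proj₂)
open import Data.Sum as Sum using (_⊎_; inj₁; inj₂)
open import Data.Empty using (⊥; ⊥-elim)
open import Function using (_∘_; id; case_of_)
open import Function.Definitions using (Injective)
open import Relation.Nullary using (¬_; Dec; yes; no; does)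
open import Relation.Nullary.Decidable using (_×-dec_; _⊎-dec_; ¬?; decidable-stable; map′; dec-true; dec-false)
open import Relation.Binary.PropositionalEquality hiding (J)

-- The obstacle is that a large link controls triples of R, not pairs of J: a vertex may have many
-- link pairs outside J. Since such a pair lies in boundedly many triples, only boundedly many
-- vertices are seriously affected. They can be left out of the core, but not of the final count,
-- which is exact. Hence vertices are typed twice: the sets `V` catch most of them through their
-- adjacency to the core, and `type` then covers all of them by comparing each link with the largest
-- one possible. Everything is an inequality in ℕ with denominators cleared. Throughout p = 3 + g,
-- with Q = 2 + g parts; 1/h < 1/M < 1/θ < 1/θ′ are the small proportions. The Turán link has about
-- (1 + g) g (n/Q)^2 ordered pairs; compared with the density g/(1 + g) that Erdős-Stone allows in a
-- neighbourhood, it forces J-degrees of about (1 + g) n/Q.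

-- Finite sums and cardinalities of Boolean predicates

opaque
  ∑ : ∀ {n} → (Fin n → ℕ) → ℕ
  ∑ {zero}  f = 0
  ∑ {suc n} f = f zero + ∑ (λ x → f (suc x))

  ∑-cong : ∀ {n} {f g : Fin n → ℕ} → (∀ x → f x ≡ g x) → ∑ f ≡ ∑ g
  ∑-cong {zero}  h = refl
  ∑-cong {suc n} h = cong₂ _+_ (h zero) (∑-cong (λ x → h (suc x)))

  ∑-+ : ∀ {n} (f g : Fin n → ℕ) → ∑ (λ x → f x + g x) ≡ ∑ f + ∑ g
  ∑-+ {zero}  f g = refl
  ∑-+ {suc n} f g = trans (cong (f zero + g zero +_) (∑-+ (f ∘ suc) (g ∘ suc))) (+-interchange (f zero) (g zero) _ _)
    where
    +-interchange : ∀ a b c d → a + b + (c + d) ≡ a + c + (b + d)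
    +-interchange = solve-∀

  ∑-*ˡ : ∀ {n} c (f : Fin n → ℕ) → ∑ (λ x → c * f x) ≡ c * ∑ f
  ∑-*ˡ {zero}  c f = sym (*-zeroʳ c)
  ∑-*ˡ {suc n} c f = trans (cong (c * f zero +_) (∑-*ˡ c (f ∘ suc))) (sym (*-distribˡ-+ c _ _))

  ∑-*ʳ : ∀ {n} c (f : Fin n → ℕ) → ∑ (λ x → f x * c) ≡ ∑ f * c
  ∑-*ʳ c f = trans (∑-cong (λ x → *-comm (f x) c)) (trans (∑-*ˡ c f) (*-comm c _))

  ∑-const : ∀ n c → ∑ {n} (λ _ → c) ≡ n * c
  ∑-const zero    c = refl
  ∑-const (suc n) c = cong (c +_) (∑-const n c)

  ∑-zero : ∀ {n} {f : Fin n → ℕ} → (∀ x → f x ≡ 0) → ∑ f ≡ 0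
  ∑-zero {n} {f} h = trans (∑-cong h) (trans (∑-const n 0) (*-zeroʳ n))

  ∑-swap : ∀ {m n} (f : Fin m → Fin n → ℕ) → ∑ (λ x → ∑ (λ y → f x y)) ≡ ∑ (λ y → ∑ (λ x → f x y))
  ∑-swap {zero}  {n} f = sym (∑-zero {n} (λ _ → refl))
  ∑-swap {suc m} {n} f = trans (cong (∑ (f zero) +_) (∑-swap (f ∘ suc))) (sym (∑-+ (f zero) _))

  ∑-nil : (f : Fin 0 → ℕ) → ∑ f ≡ 0
  ∑-nil f = refl

  ∑-suc : ∀ {n} (f : Fin (suc n) → ℕ) → ∑ f ≡ f zero + ∑ (λ x → f (suc x))
  ∑-suc f = refl

  ∑-mono : ∀ {n} {f g : Fin n → ℕ} → (∀ x → f x ≤ g x) → ∑ f ≤ ∑ g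
  ∑-mono {zero}  h = z≤n
  ∑-mono {suc n} h = +-mono-≤ (h zero) (∑-mono (λ x → h (suc x)))

  term≤∑ : ∀ {n} (f : Fin n → ℕ) i → f i ≤ ∑ f
  term≤∑ f zero    = m≤m+n _ _
  term≤∑ f (suc i) = ≤-trans (term≤∑ (f ∘ suc) i) (m≤n+m _ _)

infix 4 _≤¿_

-- Sealed copies of the decision procedures, so that Boolean predicates built from them do not unfold.
opaque
  _≤¿_ : ∀ a b → Dec (a ≤ b)
  _≤¿_ = _≤?_

  all¿ : ∀ {n} {P : Fin n → Set} → (∀ x → Dec (P x)) → Dec (∀ x → P x)
  all¿ = Finₚ.all?

  any¿ : ∀ {n} {P : Fin n → Set} → (∀ x → Dec (P x)) → Dec (∃ P)
  any¿ = Finₚ.any?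

𝟙 : Bool → ℕ
𝟙 true  = 1
𝟙 false = 0

card : ∀ {n} → (Fin n → Bool) → ℕ
card A = ∑ (λ x → 𝟙 (A x))

𝟙≤1 : ∀ b → 𝟙 b ≤ 1
𝟙≤1 true  = ≤-refl
𝟙≤1 false = z≤n

_≐_ : ∀ {n} → Fin n → Fin n → Bool
x ≐ y = does (x ≟ y)

≐⇒≡ : ∀ {n} {x y : Fin n} → (x ≐ y) ≡ true → x ≡ y
≐⇒≡ {x = x} {y} eq with x ≟ y
... | yes p = p
≐⇒≡ () | no _

≐-refl : ∀ {n} (x : Fin n) → (x ≐ x) ≡ true
≐-refl x = dec-true (x ≟ x) refl

≢⇒≐ : ∀ {n} {x y : Fin n} → x ≢ y → (x ≐ y) ≡ false
≢⇒≐ {x = x} {y} ne = dec-false (x ≟ y) ne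

≐-false : ∀ {n} {x y : Fin n} → (x ≐ y) ≡ false → x ≢ y
≐-false {x = x} eq refl = case trans (sym eq) (≐-refl x) of λ ()

∑∑-+ : ∀ {m n} (f f′ : Fin m → Fin n → ℕ) → ∑ (λ x → ∑ λ y → f x y + f′ x y) ≡ ∑ (λ x → ∑ (f x)) + ∑ (λ x → ∑ (f′ x))
∑∑-+ f f′ = trans (∑-cong λ x → ∑-+ (f x) (f′ x)) (∑-+ _ _)

∑-bound : ∀ {n} {f : Fin n → ℕ} {c} → (∀ x → f x ≤ c) → ∑ f ≤ n * c
∑-bound {n} {f} {c} h = subst (∑ f ≤_) (∑-const n c) (∑-mono h)

∑-lower : ∀ {n} {f : Fin n → ℕ} {c} → (∀ x → c ≤ f x) → n * c ≤ ∑ f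
∑-lower {n} {f} {c} h = subst (_≤ ∑ f) (∑-const n c) (∑-mono h)

∑-point : ∀ {n} (f : Fin n → ℕ) i → ∑ (λ x → 𝟙 (i ≐ x) * f x) ≡ f i
∑-point {suc n} f zero = trans (∑-suc _) (trans (cong (f zero + 0 +_) (∑-zero (λ _ → refl))) (trans (+-identityʳ _) (+-identityʳ _)))
∑-point {suc n} f (suc i) = trans (∑-suc _) (trans (∑-cong lem) (∑-point (f ∘ suc) i))
  where
  lem : ∀ x → 𝟙 (suc i ≐ suc x) * f (suc x) ≡ 𝟙 (i ≐ x) * f (suc x)
  lem x with i ≟ x
  ... | yes _ = refl
  ... | no _  = refl

card-point : ∀ {n} (i : Fin n) → card (i ≐_) ≡ 1
card-point i = trans (∑-cong (λ x → sym (*-identityʳ _))) (∑-point (λ _ → 1) i)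

card-≤n : ∀ {n} (A : Fin n → Bool) → card A ≤ n
card-≤n {n} A = subst (card A ≤_) (*-identityʳ n) (∑-bound (λ x → 𝟙≤1 (A x)))

𝟙-mono : ∀ {a b} → (a ≡ true → b ≡ true) → 𝟙 a ≤ 𝟙 b
𝟙-mono {false} h = z≤n
𝟙-mono {true}  h rewrite h refl = ≤-refl

card-mono : ∀ {n} {A B : Fin n → Bool} → (∀ x → A x ≡ true → B x ≡ true) → card A ≤ card B
card-mono h = ∑-mono (λ x → 𝟙-mono (h x))

𝟙-split : ∀ a b → 𝟙 a ≡ 𝟙 (a ∧ b) + 𝟙 (a ∧ not b)
𝟙-split true  true  = refl
𝟙-split true  false = refl
𝟙-split false b     = refl

card-split : ∀ {n} (A B : Fin n → Bool) →
             card A ≡ card (λ x → A x ∧ B x) + card (λ x → A x ∧ not (B x))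
card-split A B = trans (∑-cong (λ x → 𝟙-split (A x) (B x))) (∑-+ _ _)

card-not : ∀ {n} (A : Fin n → Bool) → card A + card (not ∘ A) ≡ n
card-not {n} A = trans (sym (card-split (λ _ → true) A)) (trans (∑-const n 1) (*-identityʳ n))

∧-true : ∀ {a b} → a ∧ b ≡ true → a ≡ true × b ≡ true
∧-true {true} eq = refl , eq

∧-true⁺ : ∀ {a b} → a ≡ true → b ≡ true → a ∧ b ≡ true
∧-true⁺ refl refl = refl

not-true : ∀ {a} → not a ≡ true → a ≡ false
not-true {false} _ = refl

true≢false : ∀ {a : Bool} {X : Set} → a ≡ true → a ≡ false → X
true≢false refl ()

≢true : ∀ {a : Bool} → a ≢ true → a ≡ false
≢true {true}  h = ⊥-elim (h refl)
≢true {false} h = refl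

does⇒ : ∀ {P : Set} (d : Dec P) → does d ≡ true → P
does⇒ (yes p) _ = p

does⇒¬ : ∀ {P : Set} (d : Dec P) → does d ≡ false → ¬ P
does⇒¬ (no p) _ = p

card-pos : ∀ {n} (A : Fin n → Bool) → 0 < card A → ∃ λ x → A x ≡ true
card-pos {zero}  A h = ⊥-elim (<-irrefl refl (subst (0 <_) (∑-nil _) h))
card-pos {suc n} A h with A zero in eq | subst (0 <_) (∑-suc _) h
... | true  | _  = zero , eq
... | false | h′ = let x , p = card-pos (A ∘ suc) h′ in suc x , p

-- Union bound: each forbidden set removes at most `e` points of `A`. The greedy choices of third
-- vertices and of vertices of a given type rest on it.
avoid : ∀ {n} (A : Fin n → Bool) e (Bs : List (Fin n → Bool)) →
        All (λ B → card (λ x → A x ∧ B x) ≤ e) Bs → length Bs * e < card A →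
        ∃ λ x → A x ≡ true × All (λ B → B x ≡ false) Bs
avoid A e [] [] h = let x , p = card-pos A h in x , p , []
avoid A e (B ∷ Bs) (b ∷ bs) h =
  let x , p , q = avoid A′ e Bs (All.map (≤-trans (card-mono λ y r →
                    ∧-true⁺ (proj₁ (∧-true (proj₁ (∧-true r)))) (proj₂ (∧-true {A′ y} r)))) bs) h′
  in x , proj₁ (∧-true p) , not-true (proj₂ (∧-true {A x} p)) ∷ q
  where
  A′ : Fin _ → Bool
  A′ x = A x ∧ not (B x)
  h′ : length Bs * e < card A′
  h′ = +-cancelˡ-< (card (λ x → A x ∧ B x)) _ _
         (≤-<-trans (+-monoˡ-≤ (length Bs * e) b) (subst (e + length Bs * e <_) (card-split A B) h))

select : ∀ {n} t (A : Fin n → Bool) → t ≤ card A →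
         Σ (Fin t → Fin n) λ g → Injective _≡_ _≡_ g × (∀ s → A (g s) ≡ true)
select {zero} zero A h = (λ ()) , (λ {}) , λ ()
select {suc n} zero A h = (λ ()) , (λ {}) , λ ()
select {zero} (suc t) A h = ⊥-elim (<⇒≱ (s≤s z≤n) (subst (suc t ≤_) (∑-nil _) h))
select {suc n} (suc t) A h₀ with A zero in eq | subst (suc t ≤_) (∑-suc _) h₀
... | true  | h = let g , inj , p = select t (A ∘ suc) (s≤s⁻¹ h) in
      (λ { zero → zero ; (suc s) → suc (g s) }) ,
      (λ { {zero} {zero} _ → refl ; {suc _} {suc _} e → cong suc (inj (Finₚ.suc-injective e)) }) ,
      λ { zero → eq ; (suc s) → p s }
... | false | h = let g , inj , p = select (suc t) (A ∘ suc) h in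
      suc ∘ g , inj ∘ Finₚ.suc-injective , p

-- Pigeonhole over the 2 ^ L vectors of labels.
refine : ∀ {n} t L (b : Fin L → Fin n → Bool) (A : Fin n → Bool) → t * 2 ^ L ≤ card A →
         Σ (Fin n → Bool) λ A′ → t ≤ card A′ × (∀ x → A′ x ≡ true → A x ≡ true) ×
           (∀ i x y → A′ x ≡ true → A′ y ≡ true → b i x ≡ b i y)
refine t zero b A h = A , subst (_≤ card A) (*-identityʳ t) h , (λ _ p → p) , λ ()
refine {n} t (suc L) b A h with t * 2 ^ L ≤? card (λ x → A x ∧ b zero x)
... | yes h₁ =
  let A′ , c , s , k = refine t L (b ∘ suc) (λ x → A x ∧ b zero x) h₁ in
  A′ , c , (λ x p → proj₁ (∧-true (s x p))) ,
  λ { zero x y p q → trans (proj₂ (∧-true {A x} (s x p))) (sym (proj₂ (∧-true {A y} (s y q))))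
    ; (suc i) → k i }
... | no h₁ =
  let A′ , c , s , k = refine t L (b ∘ suc) (λ x → A x ∧ not (b zero x)) h₂ in
  A′ , c , (λ x p → proj₁ (∧-true (s x p))) ,
  λ { zero x y p q → trans (not-true (proj₂ (∧-true {A x} (s x p)))) (sym (not-true (proj₂ (∧-true {A y} (s y q)))))
    ; (suc i) → k i }
  where
  h₂ : t * 2 ^ L ≤ card (λ x → A x ∧ not (b zero x))
  h₂ = +-cancelˡ-≤ (t * 2 ^ L) _ _ (≤-trans (≤-reflexive (dbl t (2 ^ L)))
         (≤-trans h (≤-trans (≤-reflexive (card-split A (b zero))) (+-monoˡ-≤ _ (<⇒≤ (≰⇒> h₁))))))
    where
    dbl : ∀ t p → t * p + t * p ≡ t * (2 * p)
    dbl = solve-∀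

-- Dense graphs without large complete multipartite subgraphs

∑-≤1 : ∀ {n} (f : Fin n → ℕ) → (∀ x → f x ≤ 1) → (∀ x y → 0 < f x → 0 < f y → x ≡ y) → ∑ f ≤ 1
∑-≤1 f b uniq with any¿ (λ x → 0 <? f x)
... | no none = ≤-trans (≤-reflexive (∑-zero λ x → n≤0⇒n≡0 (≮⇒≥ (λ p → none (x , p))))) z≤n
... | yes (x , p) = ≤-trans (∑-mono bound) (≤-reflexive (card-point x))
  where
  bound : ∀ y → f y ≤ 𝟙 (x ≐ y)
  bound y with x ≟ y
  ... | yes _ = b y
  ... | no ne = ≮⇒≥ (λ q → ne (uniq x y p q))

∑-one-small : ∀ {r} (f : Fin (suc r) → ℕ) i {c d} → (∀ x → f x ≤ c) → f i ≤ d → ∑ f ≤ r * c + d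
∑-one-small {r} f zero {c} {d} b s =
  ≤-trans (≤-reflexive (∑-suc f)) (≤-trans (+-mono-≤ s (∑-bound (λ x → b (suc x)))) (≤-reflexive (+-comm d _)))
∑-one-small {suc r} f (suc i) {c} {d} b s =
  ≤-trans (≤-reflexive (∑-suc f))
    (≤-trans (+-mono-≤ (b zero) (∑-one-small (f ∘ suc) i (λ x → b (suc x)) s))
             (≤-reflexive (sym (+-assoc c (r * c) d))))

Symmetric : ∀ {n} → (Fin n → Fin n → Bool) → Set
Symmetric J = ∀ x y → J x y ≡ J y x

Irreflexive : ∀ {n} → (Fin n → Fin n → Bool) → Set
Irreflexive J = ∀ x → J x x ≡ false

opaque
  weight : ∀ {n} → (Fin n → Fin n → Bool) → (f g : Fin n → ℕ) → ℕ
  weight J f g = ∑ λ x → ∑ λ y → f x * (g y * 𝟙 (J x y))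

  weight-def : ∀ {n} (J : Fin n → Fin n → Bool) f g → weight J f g ≡ ∑ λ x → ∑ λ y → f x * (g y * 𝟙 (J x y))
  weight-def J f g = refl

  weight-rows : ∀ {n} (J : Fin n → Fin n → Bool) f g → weight J f g ≡ ∑ λ x → f x * ∑ λ y → g y * 𝟙 (J x y)
  weight-rows J f g = ∑-cong λ x → ∑-*ˡ (f x) _

  weight-+ˡ : ∀ {n} (J : Fin n → Fin n → Bool) f f′ g →
              weight J (λ x → f x + f′ x) g ≡ weight J f g + weight J f′ g
  weight-+ˡ J f f′ g = trans (∑-cong (λ x → trans (∑-cong (λ y → *-distribʳ-+ (g y * 𝟙 (J x y)) (f x) (f′ x))) (∑-+ _ _))) (∑-+ _ _)

  weight-sym : ∀ {n} (J : Fin n → Fin n → Bool) → Symmetric J → ∀ f g → weight J f g ≡ weight J g f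
  weight-sym J js f g = trans (∑-swap _) (∑-cong λ y → ∑-cong λ x →
    trans (cong (λ b → f x * (g y * 𝟙 b)) (js x y)) (rot (f x) (g y) _))
    where
    rot : ∀ a b c → a * (b * c) ≡ b * (a * c)
    rot = solve-∀

  weight-cong : ∀ {n} (J : Fin n → Fin n → Bool) {f f′ g g′} → (∀ x → f x ≡ f′ x) → (∀ x → g x ≡ g′ x) →
                weight J f g ≡ weight J f′ g′
  weight-cong J p q = ∑-cong λ x → ∑-cong λ y → cong₂ _*_ (p x) (cong (_* 𝟙 (J x y)) (q y))

  weight≤ : ∀ {n} (J : Fin n → Fin n → Bool) f g → weight J f g ≤ ∑ f * ∑ g
  weight≤ J f g = ≤-trans
    (∑-mono λ x → ≤-trans (∑-mono λ y → *-monoʳ-≤ (f x) (≤-trans (*-monoʳ-≤ (g y) (𝟙≤1 _)) (≤-reflexive (*-identityʳ _))))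
                          (≤-reflexive (∑-*ˡ (f x) g)))
    (≤-reflexive (∑-*ʳ (∑ g) f))

weight-square : ∀ {n} (J : Fin n → Fin n → Bool) → Symmetric J → ∀ f g →
                weight J (λ x → f x + g x) (λ x → f x + g x) ≡ weight J f f + 2 * weight J f g + weight J g g
weight-square {n} J js f g = begin
  weight J f+g f+g                                                  ≡⟨ weight-+ˡ J f g _ ⟩
  weight J f f+g + weight J g f+g                                   ≡⟨ cong₂ _+_ (weight-sym J js f _) (weight-sym J js g _) ⟩
  weight J f+g f + weight J f+g g                                   ≡⟨ cong₂ _+_ (weight-+ˡ J f g f) (weight-+ˡ J f g g) ⟩
  weight J f f + weight J g f + (weight J f g + weight J g g)       ≡⟨ cong (λ z → weight J f f + z + (weight J f g + weight J g g)) (weight-sym J js g f) ⟩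
  weight J f f + weight J f g + (weight J f g + weight J g g)       ≡⟨ reorder (weight J f f) (weight J f g) (weight J g g) ⟩
  weight J f f + 2 * weight J f g + weight J g g                    ∎
  where
  open ≡-Reasoning
  f+g : Fin n → ℕ
  f+g x = f x + g x
  reorder : ∀ a b c → a + b + (b + c) ≡ a + 2 * b + c
  reorder = solve-∀

-- Twice the number of edges of J inside A.
edges : ∀ {n} → (Fin n → Fin n → Bool) → (Fin n → Bool) → ℕ
edges J A = weight J (𝟙 ∘ A) (𝟙 ∘ A)

-- A complete `r`-partite subgraph of `J` inside `A`. Disjointness of the parts is not a field:
-- `adj` and irreflexivity of `J` imply it, and `mult≤1` uses this to see that `mult` is the
-- indicator function of the vertex set.
record Blowup {n} (J : Fin n → Fin n → Bool) (A : Fin n → Bool) (r t : ℕ) : Set where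
  field
    part : Fin r → Fin t → Fin n
    inj  : ∀ i → Injective _≡_ _≡_ (part i)
    inA  : ∀ i s → A (part i s) ≡ true
    adj  : ∀ i j s s′ → i ≢ j → J (part i s) (part j s′) ≡ true

  mult : Fin n → ℕ
  mult x = ∑ λ i → ∑ λ s → 𝟙 (part i s ≐ x)

  degreeInto : Fin n → ℕ
  degreeInto x = ∑ λ i → card (λ s → J x (part i s))

  Full : ℕ → Fin n → Set
  Full d x = ∀ i → d ≤ card (λ s → J x (part i s))

  full? : ∀ d x → Dec (Full d x)
  full? d x = all¿ (λ i → d ≤¿ card (λ s → J x (part i s)))

  mult-pos : ∀ x i → 0 < ∑ (λ s → 𝟙 (part i s ≐ x)) → ∃ λ s → part i s ≡ x
  mult-pos x i p = let s , e = card-pos (λ s → part i s ≐ x) p in s , ≐⇒≡ e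

  mult≤1 : Irreflexive J → ∀ x → mult x ≤ 1
  mult≤1 irr x = ∑-≤1 _ (λ i → ∑-≤1 _ (λ s → 𝟙≤1 _) (λ s s′ p q → inj i (trans (hit i s p) (sym (hit i s′ q))))) across
    where
    hit : ∀ i s → 0 < 𝟙 (part i s ≐ x) → part i s ≡ x
    hit i s p with part i s ≟ x
    ... | yes e = e
    hit i s () | no _
    across : ∀ i j → 0 < ∑ (λ s → 𝟙 (part i s ≐ x)) → 0 < ∑ (λ s → 𝟙 (part j s ≐ x)) → i ≡ j
    across i j p q with i ≟ j
    ... | yes e = e
    ... | no ne with mult-pos x i p | mult-pos x j q
    ...   | s , refl | s′ , e = true≢false (subst (λ z → J (part i s) z ≡ true) e (adj i j s s′ ne)) (irr _)

  mult-in : ∀ x → 0 < mult x → A x ≡ true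
  mult-in x p with any¿ (λ i → 0 <? ∑ (λ s → 𝟙 (part i s ≐ x)))
  ... | yes (i , q) = let s , e = mult-pos x i q in subst (λ z → A z ≡ true) e (inA i s)
  ... | no none = ⊥-elim (<-irrefl (sym (∑-zero λ i → n≤0⇒n≡0 (≮⇒≥ (λ q → none (i , q))))) p)

  ∑-mult : ∀ (f : Fin n → ℕ) → ∑ (λ y → mult y * f y) ≡ ∑ λ i → ∑ λ s → f (part i s)
  ∑-mult f = trans (∑-cong λ y → sym (∑-*ʳ (f y) _))
    (trans (∑-swap _) (∑-cong λ i → trans (∑-cong λ y → sym (∑-*ʳ (f y) _))
      (trans (∑-swap _) (∑-cong λ s → ∑-point f (part i s)))))

  total-mult : ∑ mult ≡ r * t
  total-mult = trans (∑-cong λ y → sym (*-identityʳ (mult y)))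
    (trans (∑-mult (λ _ → 1)) (trans (∑-cong λ i → trans (∑-const t 1) (*-identityʳ t)) (∑-const r t)))

  degreeInto-mult : ∀ x → ∑ (λ y → mult y * 𝟙 (J x y)) ≡ degreeInto x
  degreeInto-mult x = ∑-mult (λ y → 𝟙 (J x y))

degreeInto≤ : ∀ {n J A r t} (K : Blowup {n} J A r t) x → Blowup.degreeInto K x ≤ r * t
degreeInto≤ K x = ∑-bound (λ i → card-≤n _)

degree-nonfull : ∀ {n J A r t} (K : Blowup {n} J A (suc r) t) d x → ¬ Blowup.Full K d x →
                 Blowup.degreeInto K x ≤ r * t + d
degree-nonfull {J = J} K d x ¬f with Finₚ.¬∀⟶∃¬ _ _ (λ i → d ≤¿ card (λ s → J x (Blowup.part K i s))) ¬f
... | i , ¬p = ∑-one-small _ i (λ j → card-≤n _) (<⇒≤ (≰⇒> ¬p))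

-- Pigeonhole on the `2 ^ (r * t)` adjacency patterns to `K` yields `suc d` vertices with the same
-- pattern. Each has at least `suc d` neighbours in every part, and these are common to all, so they
-- form the trimmed parts beside the new one.
extend-blowup : ∀ {n J A r t} → Symmetric J → (K : Blowup {n} J A r t) → ∀ d →
                suc d * 2 ^ (r * t) ≤ card (λ x → A x ∧ does (Blowup.full? K (suc d) x)) →
                Blowup J A (suc r) (suc d)
extend-blowup {n} {J} {A} {r} {t} js K d h = record
  { part = new
  ; inj = λ { zero → proj₁ (proj₂ chosen) ; (suc i) → proj₁ (proj₂ (sub i)) ∘ inj i }
  ; inA = λ { zero s → proj₁ (∧-true (A′⊆ _ (inA′ s))) ; (suc i) s → inA i _ }
  ; adj = new-adj }
  where
  open Blowup K
  label : Fin (r * t) → Fin n → Bool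
  label ix x = let i , s = Fin.remQuot {r} t ix in J x (part i s)
  F : Fin n → Bool
  F x = A x ∧ does (full? (suc d) x)
  ref : _
  ref = refine (suc d) (r * t) label F h
  A′ : Fin n → Bool
  A′ = proj₁ ref
  A′⊆ : ∀ x → A′ x ≡ true → F x ≡ true
  A′⊆ = proj₁ (proj₂ (proj₂ ref))
  const : ∀ i s x y → A′ x ≡ true → A′ y ≡ true → J x (part i s) ≡ J y (part i s)
  const i s x y p q = subst (λ c → J x (part (proj₁ c) (proj₂ c)) ≡ J y (part (proj₁ c) (proj₂ c)))
    (Finₚ.remQuot-combine i s) (proj₂ (proj₂ (proj₂ ref)) (Fin.combine i s) x y p q)
  chosen : Σ (Fin (suc d) → Fin n) λ g → Injective _≡_ _≡_ g × (∀ s → A′ (g s) ≡ true)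
  chosen = select (suc d) A′ (proj₁ (proj₂ ref))
  g : Fin (suc d) → Fin n
  g = proj₁ chosen
  inA′ : ∀ s → A′ (g s) ≡ true
  inA′ = proj₂ (proj₂ chosen)
  sub : ∀ i → Σ (Fin (suc d) → Fin t) λ e → Injective _≡_ _≡_ e × (∀ s → J (g zero) (part i (e s)) ≡ true)
  sub i = select (suc d) (λ s → J (g zero) (part i s))
            (does⇒ (full? (suc d) (g zero)) (proj₂ (∧-true {A (g zero)} (A′⊆ _ (inA′ zero)))) i)
  new : Fin (suc r) → Fin (suc d) → Fin n
  new zero    s = g s
  new (suc i) s = part i (proj₁ (sub i) s)
  g-adj : ∀ s i s′ → J (g s) (part i (proj₁ (sub i) s′)) ≡ true
  g-adj s i s′ = trans (const i _ (g s) (g zero) (inA′ s) (inA′ zero)) (proj₂ (proj₂ (sub i)) s′)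
  new-adj : ∀ i j s s′ → i ≢ j → J (new i s) (new j s′) ≡ true
  new-adj zero    zero    s s′ ne = ⊥-elim (ne refl)
  new-adj zero    (suc j) s s′ ne = g-adj s j s′
  new-adj (suc i) zero    s s′ ne = trans (js _ _) (g-adj s′ i s)
  new-adj (suc i) (suc j) s s′ ne = adj i j _ _ (ne ∘ cong suc)

split-𝟙 : ∀ a k → k ≤ 1 → (0 < k → a ≡ true) → 𝟙 a ≡ 𝟙 (a ∧ does (k ≟ℕ 0)) + k
split-𝟙 true  zero    _ _ = refl
split-𝟙 false zero    _ _ = refl
split-𝟙 true  (suc zero) _ _ = refl
split-𝟙 false (suc zero) _ h = case h (s≤s z≤n) of λ ()
split-𝟙 _ (suc (suc _)) (s≤s ()) _

-- Deleting a complete r-partite subgraph with parts of size t = M T removes about 2 (r - 1) t a edges,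
-- because few vertices see T vertices in each of its parts.
edges-delete : ∀ {n} {J : Fin n → Fin n → Bool} → Symmetric J → Irreflexive J → ∀ {A r t} d P →
  (K : Blowup J A (suc r) t) → card (λ x → A x ∧ does (Blowup.full? K d x)) ≤ P →
  Σ (Fin n → Bool) λ A′ → (card A ≡ card A′ + suc r * t) × (∀ x → A′ x ≡ true → A x ≡ true) ×
    edges J A ≤ edges J A′ + 2 * (card A′ * (r * t + d) + P * (suc r * t)) + suc r * t * (suc r * t)
edges-delete {n} {J} js irr {A} {r} {t} d P K few = A′ , size , (λ x p → proj₁ (∧-true p)) , bound
  where
  open Blowup K
  A′ : Fin n → Bool
  A′ x = A x ∧ does (mult x ≟ℕ 0)
  split : ∀ x → 𝟙 (A x) ≡ 𝟙 (A′ x) + mult x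
  split x = split-𝟙 (A x) (mult x) (mult≤1 irr x) (mult-in x)
  size : card A ≡ card A′ + suc r * t
  size = trans (∑-cong split) (trans (∑-+ _ _) (cong (card A′ +_) total-mult))
  row : ∀ x → 𝟙 (A′ x) * degreeInto x ≤ 𝟙 (A′ x) * (r * t + d) + 𝟙 (A x ∧ does (full? d x)) * (suc r * t)
  row x with A x
  ... | false = z≤n
  ... | true with full? d x | does (mult x ≟ℕ 0)
  ...   | _        | false = z≤n
  ...   | yes _    | true = ≤-trans (≤-reflexive (*-identityˡ _)) (≤-trans (degreeInto≤ K x)
                              (≤-trans (≤-reflexive (sym (*-identityˡ (suc r * t)))) (m≤n+m (1 * (suc r * t)) (1 * (r * t + d)))))
  ...   | no ¬f    | true = ≤-trans (*-monoʳ-≤ 1 (degree-nonfull K d x ¬f)) (m≤m+n _ _)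
  cross : weight J (𝟙 ∘ A′) mult ≤ card A′ * (r * t + d) + P * (suc r * t)
  cross = begin
    weight J (𝟙 ∘ A′) mult                                 ≡⟨ trans (weight-rows J _ mult) (∑-cong λ x → cong (𝟙 (A′ x) *_) (degreeInto-mult x)) ⟩
    ∑ (λ x → 𝟙 (A′ x) * degreeInto x)                      ≤⟨ ∑-mono row ⟩
    ∑ (λ x → 𝟙 (A′ x) * (r * t + d) + 𝟙 (A x ∧ does (full? d x)) * (suc r * t))
                                                           ≡⟨ trans (∑-+ _ _) (cong₂ _+_ (∑-*ʳ _ _) (∑-*ʳ _ _)) ⟩
    card A′ * (r * t + d) + card (λ x → A x ∧ does (full? d x)) * (suc r * t)
                                                           ≤⟨ +-monoʳ-≤ _ (*-monoˡ-≤ (suc r * t) few) ⟩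
    card A′ * (r * t + d) + P * (suc r * t)                ∎
    where open ≤-Reasoning
  bound : edges J A ≤ edges J A′ + 2 * (card A′ * (r * t + d) + P * (suc r * t)) + suc r * t * (suc r * t)
  bound = begin
    edges J A                                        ≡⟨ weight-cong J split split ⟩
    weight J (λ x → 𝟙 (A′ x) + mult x) _             ≡⟨ weight-square J js (𝟙 ∘ A′) mult ⟩
    edges J A′ + 2 * weight J (𝟙 ∘ A′) mult + weight J mult mult
                                                     ≤⟨ +-mono-≤ (+-monoʳ-≤ (edges J A′) (*-monoʳ-≤ 2 cross)) (weight≤ J mult mult) ⟩
    edges J A′ + 2 * (card A′ * (r * t + d) + P * (suc r * t)) + ∑ mult * ∑ mult
                                                     ≡⟨ cong (λ z → edges J A′ + 2 * (card A′ * (r * t + d) + P * (suc r * t)) + z * z) total-mult ⟩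
    edges J A′ + 2 * (card A′ * (r * t + d) + P * (suc r * t)) + suc r * t * (suc r * t) ∎
    where open ≤-Reasoning

edges≤ : ∀ {n} (J : Fin n → Fin n → Bool) A → edges J A ≤ card A * card A
edges≤ J A = weight≤ J (𝟙 ∘ A) (𝟙 ∘ A)

-- The bound reads e ≤ ((r + 1/M)/(r + 1)) a^2 + O(a). With `t = M * T` the loss of 2 a (r t + T) in
-- `e` matches exactly the cross term of (a + (r + 1) t)^2; `C` pays for the `P` exceptional
-- vertices and for the edges inside the deleted subgraph.
turán-step : ∀ r M T P C₀ a e e′ → let rr = suc r ; t = M * T ; C = C₀ + M * (2 * P * rr + rr * rr * t) in
  e ≤ e′ + 2 * (a * (r * t + T) + P * (rr * t)) + rr * t * (rr * t) →
  rr * M * e′ ≤ (r * M + 1) * (a * a) + C * a →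
  rr * M * e ≤ (r * M + 1) * ((a + rr * t) * (a + rr * t)) + C * (a + rr * t)
turán-step r M T P C₀ a e e′ h h′ = begin
  rr * M * e                                                     ≤⟨ *-monoʳ-≤ (rr * M) h ⟩
  rr * M * (e′ + X + Y)                                          ≡⟨ distr (rr * M) e′ X Y ⟩
  rr * M * e′ + rr * M * (X + Y)                                 ≤⟨ +-monoˡ-≤ _ h′ ⟩
  (r * M + 1) * (a * a) + C * a + rr * M * (X + Y)               ≤⟨ m≤m+n _ _ ⟩
  (r * M + 1) * (a * a) + C * a + rr * M * (X + Y) + ((r * M + 1) * (rr * t * (rr * t)) + C₀ * (rr * t))
                                                                 ≡⟨ identity r M T P C₀ a ⟩
  (r * M + 1) * ((a + rr * t) * (a + rr * t)) + C * (a + rr * t) ∎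
  where
  open ≤-Reasoning
  rr = suc r
  t = M * T
  C = C₀ + M * (2 * P * rr + rr * rr * t)
  X = 2 * (a * (r * t + T) + P * (rr * t))
  Y = rr * t * (rr * t)
  distr : ∀ m b x y → m * (b + x + y) ≡ m * b + m * (x + y)
  distr = solve-∀
  identity : ∀ r M T P C₀ a → let rr = suc r ; t = M * T ; C = C₀ + M * (2 * P * rr + rr * rr * t) in
    (r * M + 1) * (a * a) + C * a + rr * M * (2 * (a * (r * t + T) + P * (rr * t)) + rr * t * (rr * t))
      + ((r * M + 1) * (rr * t * (rr * t)) + C₀ * (rr * t))
    ≡ (r * M + 1) * ((a + rr * t) * (a + rr * t)) + C * (a + rr * t)
  identity = solve-∀

-- Erdős–Stone: the induction on r supplies a complete r-partite subgraph with large parts,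
-- whose deletion drives the induction on the size of A.
erdős-stone : ∀ r T M → ∃ λ C → ∀ {n} {J : Fin n → Fin n → Bool} → Symmetric J → Irreflexive J → ∀ A →
  Blowup J A (2 + r) (suc T) ⊎ suc r * suc M * edges J A ≤ (r * suc M + 1) * (card A * card A) + C * card A

-- The same density bound as in `erdős-stone`, but with one part fewer in the other alternative. It
-- supplies the subgraph to be deleted there, and is itself a consequence of `erdős-stone` for the
-- preceding `r`.
blowup-or-sparse : ∀ r t M → ∃ λ C → ∀ {n} {J : Fin n → Fin n → Bool} → Symmetric J → Irreflexive J → ∀ A →
  Blowup J A (1 + r) (suc t) ⊎ suc r * suc M * edges J A ≤ (r * suc M + 1) * (card A * card A) + C * card A
blowup-or-sparse zero t M = suc M * suc t , result
  where
  result : ∀ {n} {J : Fin n → Fin n → Bool} → Symmetric J → Irreflexive J → ∀ A →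
    Blowup J A 1 (suc t) ⊎ 1 * suc M * edges J A ≤ (0 * suc M + 1) * (card A * card A) + suc M * suc t * card A
  result {J = J} _ _ A with suc t ≤? card A
  ... | yes p = let g , inj , inA = select (suc t) A p in inj₁ (record
    { part = λ _ → g ; inj = λ _ → inj ; inA = λ _ → inA
    ; adj = λ { zero zero _ _ ne → ⊥-elim (ne refl) } })
  ... | no ¬p = inj₂ (begin
    1 * suc M * edges J A               ≤⟨ *-monoʳ-≤ (1 * suc M) (≤-trans (edges≤ J A) (*-monoˡ-≤ (card A) (<⇒≤ (≰⇒> ¬p)))) ⟩
    1 * suc M * (suc t * card A)        ≡⟨ assoc′ (suc M) (suc t) (card A) ⟩
    suc M * suc t * card A              ≤⟨ m≤n+m _ ((0 * suc M + 1) * (card A * card A)) ⟩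
    (0 * suc M + 1) * (card A * card A) + suc M * suc t * card A ∎)
    where
    open ≤-Reasoning
    assoc′ : ∀ a b c → 1 * a * (b * c) ≡ a * b * c
    assoc′ = solve-∀
-- With `suc r` for `M` the numerator is r (r + 2) + 1 = (r + 1)^2, so the preceding case already
-- gives density (r + 1)/(r + 2), below the one asked for here.
blowup-or-sparse (suc r) t M with erdős-stone r t (suc r)
... | C , es = suc M * C , λ js irr A → Sum.map₂ (scale _ _) (es js irr A)
  where
  open ≤-Reasoning
  scale : ∀ e a → suc r * (2 + r) * e ≤ (r * (2 + r) + 1) * (a * a) + C * a →
    (2 + r) * suc M * e ≤ (suc r * suc M + 1) * (a * a) + suc M * C * a
  scale e a h = *-cancelˡ-≤ (suc r) (begin
    suc r * ((2 + r) * suc M * e)                            ≡⟨ eq₁ r M e ⟩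
    suc M * (suc r * (2 + r) * e)                            ≤⟨ *-monoʳ-≤ (suc M) h ⟩
    suc M * ((r * (2 + r) + 1) * (a * a) + C * a)            ≤⟨ m≤m+n _ _ ⟩
    suc M * ((r * (2 + r) + 1) * (a * a) + C * a) + (suc r * (a * a) + r * (suc M * C * a)) ≡⟨ eq₂ r M C a ⟩
    suc r * ((suc r * suc M + 1) * (a * a) + suc M * C * a)  ∎)
    where
    eq₁ : ∀ r M e → suc r * ((2 + r) * suc M * e) ≡ suc M * (suc r * (2 + r) * e)
    eq₁ = solve-∀
    eq₂ : ∀ r M C a → suc M * ((r * (2 + r) + 1) * (a * a) + C * a) + (suc r * (a * a) + r * (suc M * C * a))
        ≡ suc r * ((suc r * suc M + 1) * (a * a) + suc M * C * a)
    eq₂ = solve-∀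

-- `suc (T + M * suc T)` computes to `suc M * suc T`, the part size for which `turán-step` is made.
erdős-stone r T M with blowup-or-sparse r (T + M * suc T) M
... | C₀ , base = C , λ js irr A → go js irr (card A) A ≤-refl
  where
  t = suc M * suc T
  P = suc T * 2 ^ (suc r * t)
  C = C₀ + suc M * (2 * P * suc r + suc r * suc r * t)
  C₀≤C : C₀ ≤ C
  C₀≤C = m≤m+n _ _
  go : ∀ {n} {J : Fin n → Fin n → Bool} → Symmetric J → Irreflexive J → ∀ fuel A → card A ≤ fuel →
    Blowup J A (2 + r) (suc T) ⊎ suc r * suc M * edges J A ≤ (r * suc M + 1) * (card A * card A) + C * card A
  go {n} {J} js irr fuel A le with base js irr A
  ... | inj₂ h = inj₂ (≤-trans h (+-monoʳ-≤ _ (*-monoˡ-≤ (card A) C₀≤C)))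
  ... | inj₁ K with P ≤? card (λ x → A x ∧ does (Blowup.full? K (suc T) x))
  ...   | yes p = inj₁ (extend-blowup js K T p)
  ...   | no ¬p with edges-delete js irr (suc T) P K (<⇒≤ (≰⇒> ¬p))
  ...     | A′ , size , A′⊆A , bound = recurse fuel le
    where
    smaller : card A′ < card A
    smaller = subst (card A′ <_) (sym size) (m<m+n (card A′) (s≤s z≤n))
    recurse : ∀ fuel → card A ≤ fuel → Blowup J A (2 + r) (suc T) ⊎
      suc r * suc M * edges J A ≤ (r * suc M + 1) * (card A * card A) + C * card A
    recurse zero le = ⊥-elim (<⇒≱ (≤-<-trans z≤n smaller) le)
    recurse (suc fuel) le with go js irr fuel A′ (s≤s⁻¹ (≤-trans smaller le))
    ... | inj₁ K′ = inj₁ (record { part = Blowup.part K′ ; inj = Blowup.inj K′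
                                 ; inA = λ i s → A′⊆A _ (Blowup.inA K′ i s) ; adj = Blowup.adj K′ })
    ... | inj₂ h = inj₂ (subst (λ a → suc r * suc M * edges J A ≤ (r * suc M + 1) * (a * a) + C * a) (sym size)
                           (turán-step r (suc M) (suc T) P C₀ (card A′) (edges J A) (edges J A′) bound h))

-- Embedding F into a multipartite structure

Compatible : ∀ {k} {A : Set} → (Fin k → A → Set) → (Fin k → A → Fin k → A → Set) → (Fin k → Maybe A) → Set
Compatible Q R f = (∀ i a → f i ≡ just a → Q i a) ×
                   (∀ i j a b → i ≢ j → f i ≡ just a → f j ≡ just b → R i a j b)

Extends : ∀ {k} {A : Set} → (f g : Fin k → Maybe A) → Set
Extends f g = ∀ i a → f i ≡ just a → g i ≡ just a

module _ {k : ℕ} {A : Set} (Q : Fin k → A → Set) (R : Fin k → A → Fin k → A → Set)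
         (R-sym : ∀ i a j b → R i a j b → R j b i a) (f₀ : Fin k → Maybe A)
         (choose : ∀ f i → f i ≡ nothing → Extends f₀ f → Compatible Q R f →
                   ∃ λ a → Q i a × (∀ j b → f j ≡ just b → R i a j b)) where

  private
    update : (Fin k → Maybe A) → Fin k → A → Fin k → Maybe A
    update f i a j = if i ≐ j then just a else f j

    update-cases : ∀ f i a j b → update f i a j ≡ just b → (i ≡ j × a ≡ b) ⊎ (i ≢ j × f j ≡ just b)
    update-cases f i a j b eq with i ≟ j
    update-cases f i a j b refl | yes p = inj₁ (p , refl)
    ... | no ne = inj₂ (ne , eq)

    update-extends : ∀ f i a → f i ≡ nothing → Extends f (update f i a)
    update-extends f i a e j b eq with i ≟ j
    ... | no _ = eq
    update-extends f i a e .i b eq | yes refl with trans (sym e) eq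
    ... | ()

    update-here : ∀ f i a → update f i a i ≡ just a
    update-here f i a rewrite ≐-refl i = refl

    update-compatible : ∀ f i a → Compatible Q R f → Q i a → (∀ j b → f j ≡ just b → R i a j b) →
                        Compatible Q R (update f i a)
    update-compatible f i a (q , r) qa ra = q′ , r′
      where
      q′ : ∀ j b → update f i a j ≡ just b → Q j b
      q′ j b eq with update-cases f i a j b eq
      ... | inj₁ (refl , refl) = qa
      ... | inj₂ (_ , eq′) = q j b eq′
      r′ : ∀ j l b c → j ≢ l → update f i a j ≡ just b → update f i a l ≡ just c → R j b l c
      r′ j l b c ne e e′ with update-cases f i a j b e | update-cases f i a l c e′
      ... | inj₁ (refl , _) | inj₁ (refl , _) = ⊥-elim (ne refl)
      ... | inj₁ (refl , refl) | inj₂ (_ , y) = ra l c y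
      ... | inj₂ (_ , x) | inj₁ (refl , refl) = R-sym i a j b (ra j b x)
      ... | inj₂ (_ , x) | inj₂ (_ , y) = r j l b c ne x y

    fillList : ∀ is f → Extends f₀ f → Compatible Q R f →
               ∃ λ g → Extends f g × Compatible Q R g × All (λ i → ∃ λ a → g i ≡ just a) is
    fillList [] f ext c = f , (λ _ _ e → e) , c , []
    fillList (i ∷ is) f ext c with f i in eq
    ... | just a = let g , e , c′ , al = fillList is f ext c in g , e , c′ , (a , e i a eq) ∷ al
    ... | nothing =
      let a , qa , ra = choose f i eq ext c
          up = update-extends f i a eq
          g , e , c′ , al = fillList is (update f i a) (λ j b x → up j b (ext j b x)) (update-compatible f i a c qa ra)
      in g , (λ j b x → e j b (up j b x)) , c′ , (a , e i a (update-here f i a)) ∷ al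

  -- Greedy choice, index by index, starting from the prescribed values `f₀`. It serves for the
  -- vertices of `F` as well as for those added by the expansion.
  complete : Compatible Q R f₀ →
             Σ (Fin k → A) λ g → (∀ i → Q i (g i)) × (∀ i j → i ≢ j → R i (g i) j (g j)) ×
               (∀ i a → f₀ i ≡ just a → g i ≡ a)
  complete c with fillList (allFin k) f₀ (λ _ _ e → e) c
  ... | g , e , (q , r) , al = (λ i → proj₁ (val i)) , (λ i → q i _ (proj₂ (val i))) ,
        (λ i j ne → r i j _ _ ne (proj₂ (val i)) (proj₂ (val j))) ,
        λ i a x → just-injective (trans (sym (proj₂ (val i))) (e i a x))
    where
    val : ∀ i → ∃ λ a → g i ≡ just a
    val i = All.lookup al (∈ₚ.∈-allFin i)

transpose-injective : ∀ {q} (s t : Fin q) → Injective _≡_ _≡_ (PC.transpose s t)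
transpose-injective s t e = trans (sym (PC.transpose-inverse t s)) (trans (cong (PC.transpose t s) e) (PC.transpose-inverse t s))

transpose-at : ∀ {q} (s t : Fin q) → PC.transpose s t s ≡ t
transpose-at s t rewrite ≐-refl s = refl

transpose-fixes : ∀ {q} (s t : Fin q) {x} → x ≢ s → x ≢ t → PC.transpose s t x ≡ x
transpose-fixes s t x≢s x≢t rewrite ≢⇒≐ x≢s | ≢⇒≐ x≢t = refl

tri : ∀ {n} → Fin n → Fin n → Fin n → Subset n
tri x y z = ⁅ x ⁆ ∪ ⁅ y ⁆ ∪ ⁅ z ⁆

tri-swap : ∀ {n} (x y z : Fin n) → tri x y z ≡ tri y x z
tri-swap x y z = trans (sym (Subₚ.∪-assoc _ _ _)) (trans (cong (_∪ ⁅ z ⁆) (Subₚ.∪-comm ⁅ x ⁆ ⁅ y ⁆)) (Subₚ.∪-assoc _ _ _))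

tri-swap′ : ∀ {n} (x y z : Fin n) → tri x y z ≡ tri x z y
tri-swap′ x y z = cong (⁅ x ⁆ ∪_) (Subₚ.∪-comm ⁅ y ⁆ ⁅ z ⁆)

∈-tab : ∀ {A : Set} {k} (f : Fin k → A) i → f i ∈ List.tabulate f
∈-tab f i = ∈ₚ.∈-tabulate⁺ {f = f} i

length-tab : ∀ {A : Set} {k} (f : Fin k → A) → length (List.tabulate f) ≡ k
length-tab f = Listₚ.length-tabulate f

opaque
  lookupPair : ∀ {m n} → List (Fin m × Fin n) → Fin m → Maybe (Fin n)
  lookupPair [] a = nothing
  lookupPair ((b , x) ∷ L) a = if b ≐ a then just x else lookupPair L a

  lookupPair-∈ : ∀ {m n} (L : List (Fin m × Fin n)) a x → lookupPair L a ≡ just x → (a , x) ∈ L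
  lookupPair-∈ ((b , y) ∷ L) a x eq with b ≟ a
  lookupPair-∈ ((b , y) ∷ L) .b x refl | yes refl = here refl
  ... | no _ = there (lookupPair-∈ L a x eq)

  lookupPair-here : ∀ {m n} (L : List (Fin m × Fin n)) a x → lookupPair ((a , x) ∷ L) a ≡ just x
  lookupPair-here L a x rewrite ≐-refl a = refl

  lookupPair-there : ∀ {m n} (L : List (Fin m × Fin n)) a b y → b ≢ a → lookupPair ((b , y) ∷ L) a ≡ lookupPair L a
  lookupPair-there L a b y ne rewrite ≢⇒≐ ne = refl

module Embedding (F : Graph) {n : ℕ} (κ : Subset n → ℕ) where
  open Graph F

  src tgt : Fin k → Fin m
  src = u F
  tgt = v F

  src≢tgt : ∀ i → src i ≢ tgt i
  src≢tgt i eq = <-irrefl (cong toℕ eq) (ordered i)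

  -- The expansion has `m + k` vertices and `k` edges, so tolerance for `m + k` forbidden vertices
  -- and `m + k` forbidden colours is enough at every step of a greedy extension.
  Extensible : Fin n → Fin n → Set
  Extensible x y = ∀ (X : List (Fin n)) (Cs : List ℕ) → length X ≤ m + k → length Cs ≤ m + k →
                   ∃ λ z → z ∉ X × κ (tri x y z) ∉ Cs

  -- Edges that need not be extensible take their third vertex from `z₀`; each of the others gets
  -- one that avoids the vertices and colours already in use.
  rainbow-completion : (φ : Fin m → Fin n) → Injective _≡_ _≡_ φ → (z₀ : Fin k → Maybe (Fin n)) →
    (∀ i w → z₀ i ≡ just w → ∀ a → φ a ≢ w) →
    (∀ i j w w′ → i ≢ j → z₀ i ≡ just w → z₀ j ≡ just w′ →
      w ≢ w′ × κ (tri (φ (src i)) (φ (tgt i)) w) ≢ κ (tri (φ (src j)) (φ (tgt j)) w′)) →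
    (∀ i → z₀ i ≡ nothing → Extensible (φ (src i)) (φ (tgt i))) →
    HasRainbowCopy κ (expansion3 F)
  rainbow-completion φ φ-inj z₀ V₁ V₂ ext =
    Φ , Φ-inj , λ i j ne eq → proj₂ (proj₁ (proj₂ (proj₂ filled)) i j ne) (trans (sym (image i)) (trans eq (image j)))
    where
    colour : Fin k → Fin n → ℕ
    colour i w = κ (tri (φ (src i)) (φ (tgt i)) w)
    Q : Fin k → Fin n → Set
    Q i w = ∀ a → φ a ≢ w
    R : Fin k → Fin n → Fin k → Fin n → Set
    R i w j w′ = w ≢ w′ × colour i w ≢ colour j w′
    choose : ∀ f i → f i ≡ nothing → Extends z₀ f → Compatible Q R f →
             ∃ λ w → Q i w × (∀ j w′ → f j ≡ just w′ → R i w j w′)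
    choose f i eq e _ with z₀ i in eq₀
    ... | just w = case trans (sym eq) (e i w eq₀) of λ ()
    ... | nothing =
      let w , w∉X , c∉C = ext i eq₀ X Cs (≤-reflexive len) (subst (_≤ m + k) (sym (length-tab _)) (m≤n+m k m))
      in w , (λ a e → w∉X (∈ₚ.∈-++⁺ˡ (subst (_∈ List.tabulate φ) e (∈-tab φ a)))) ,
         λ j w′ fj → (λ e → w∉X (∈ₚ.∈-++⁺ʳ (List.tabulate φ) (subst (_∈ List.tabulate old) (trans (cong (fromMaybe d) fj) (sym e)) (∈-tab old j)))) ,
                     λ e → c∉C (subst (_∈ Cs) (trans (cong (λ x → colour j (fromMaybe d x)) fj) (sym e)) (∈-tab (λ j → colour j (old j)) j))
      where
      -- Default for the indices not yet filled; it only enlarges the lists of forbidden vertices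
      -- and colours.
      d = φ (src i)
      old : Fin k → Fin n
      old j = fromMaybe d (f j)
      X = List.tabulate φ ++ List.tabulate old
      Cs = List.tabulate (λ j → colour j (old j))
      len : length X ≡ m + k
      len = trans (Listₚ.length-++ (List.tabulate φ)) (cong₂ _+_ (length-tab φ) (length-tab old))
    filled : Σ (Fin k → Fin n) λ g → (∀ i → Q i (g i)) × (∀ i j → i ≢ j → R i (g i) j (g j)) ×
               (∀ i a → z₀ i ≡ just a → g i ≡ a)
    filled = complete Q R (λ i a j b r → (λ e → proj₁ r (sym e)) , λ e → proj₂ r (sym e)) z₀ choose (V₁ , V₂)
    z : Fin k → Fin n
    z = proj₁ filled
    Φ : Fin (m + k) → Fin n
    Φ = Sum.[ φ , z ] ∘ splitAt m
    image : ∀ i → κ (img3 Φ (u F i ↑ˡ k , v F i ↑ˡ k , m ↑ʳ i)) ≡ colour i (z i)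
    image i rewrite Finₚ.splitAt-↑ˡ m (u F i) k | Finₚ.splitAt-↑ˡ m (v F i) k | Finₚ.splitAt-↑ʳ m k i = refl
    z-inj : ∀ {i j} → z i ≡ z j → i ≡ j
    z-inj {i} {j} e with i ≟ j
    ... | yes p = p
    ... | no ne = ⊥-elim (proj₁ (proj₁ (proj₂ (proj₂ filled)) i j ne) e)
    Φ-inj : Injective _≡_ _≡_ Φ
    Φ-inj {s} {t} eq with splitAt m s in es | splitAt m t in et
    ... | inj₁ a | inj₁ b = trans (sym (Finₚ.splitAt⁻¹-↑ˡ es)) (trans (cong (_↑ˡ k) (φ-inj eq)) (Finₚ.splitAt⁻¹-↑ˡ et))
    ... | inj₁ a | inj₂ j = ⊥-elim (proj₁ (proj₂ filled) j a eq)
    ... | inj₂ i | inj₁ b = ⊥-elim (proj₁ (proj₂ filled) i b (sym eq))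
    ... | inj₂ i | inj₂ j = trans (sym (Finₚ.splitAt⁻¹-↑ʳ es)) (trans (cong (m ↑ʳ_) (z-inj eq)) (Finₚ.splitAt⁻¹-↑ʳ et))

  module Typed {q : ℕ} (J : Fin n → Fin n → Bool) (τ : Fin n → Maybe (Fin q)) where

    -- What a greedy embedding of a multipartite graph asks for at each step. `τ` is partial so that
    -- vertices without a type may occur in `X`, where they only have to be avoided.
    Robust : ℕ → Set
    Robust R = ∀ j (X : List (Fin n)) → length X ≤ R →
      ∃ λ x → τ x ≡ just j × x ∉ X × (∀ s i → s ∈ X → τ s ≡ just i → i ≢ j → J s x ≡ true)

    record Placement (π : Fin m → Fin q) (f₀ : Fin m → Maybe (Fin n)) (X₀ : List (Fin n)) : Set where
      field
        φ         : Fin m → Fin n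
        injective : Injective _≡_ _≡_ φ
        typed     : ∀ a → τ (φ a) ≡ just (π a)
        adjacent  : ∀ a b → π a ≢ π b → J (φ a) (φ b) ≡ true
        agrees    : ∀ a x → f₀ a ≡ just x → φ a ≡ x
        avoids    : ∀ a → f₀ a ≡ nothing → φ a ∉ X₀

    -- Of the `m + R` vertices in the robustness hypothesis, `m` account for the images placed so
    -- far and `R` for `X₀`, which keeps the vertices reserved as third vertices free.
    embed : ∀ {R} → Symmetric J → Robust (m + R) → (π : Fin m → Fin q) (f₀ : Fin m → Maybe (Fin n)) (X₀ : List (Fin n)) →
      length X₀ ≤ R →
      (∀ a x → f₀ a ≡ just x → τ x ≡ just (π a)) →
      (∀ a b x y → a ≢ b → f₀ a ≡ just x → f₀ b ≡ just y → x ≢ y × (π a ≢ π b → J x y ≡ true)) →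
      Placement π f₀ X₀
    embed {R} js rob π f₀ X₀ len V₁ V₂ = record
      { φ = φ ; injective = φ-inj ; typed = λ a → proj₁ (proj₁ (proj₂ filled) a) ; adjacent = φ-adjacent
      ; agrees = proj₂ (proj₂ (proj₂ filled)) ; avoids = λ a → proj₂ (proj₁ (proj₂ filled) a) }
      where
      P : Fin m → Fin n → Fin m → Fin n → Set
      P a x b y = x ≢ y × (π a ≢ π b → J x y ≡ true)
      Q : Fin m → Fin n → Set
      Q a x = τ x ≡ just (π a) × (f₀ a ≡ nothing → x ∉ X₀)
      choose : ∀ f a → f a ≡ nothing → Extends f₀ f → Compatible Q P f →
               ∃ λ x → Q a x × (∀ b y → f b ≡ just y → P a x b y)
      choose f a eq e (q , _) =
        let x , τx , x∉ , adj = rob (π a) X (≤-trans (≤-reflexive (trans (Listₚ.length-++ (List.tabulate old)) (cong (_+ length X₀) (length-tab old)))) (+-monoʳ-≤ m len))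
        in x , (τx , λ _ x∈ → x∉ (∈ₚ.∈-++⁺ʳ (List.tabulate old) x∈)) ,
           λ b y fb → let y∈ = ∈ₚ.∈-++⁺ˡ {ys = X₀} (subst (_∈ List.tabulate old) (cong (fromMaybe d) fb) (∈-tab old b)) in
             (λ x≡y → x∉ (subst (_∈ X) (sym x≡y) y∈)) ,
             λ ne → trans (js x y) (adj y (π b) y∈ (proj₁ (q b y fb)) (ne ∘ sym))
        where
        d = proj₁ (rob (π a) [] z≤n)
        old : Fin m → Fin n
        old b = fromMaybe d (f b)
        X = List.tabulate old ++ X₀
      filled : Σ (Fin m → Fin n) λ g → (∀ i → Q i (g i)) × (∀ i j → i ≢ j → P i (g i) j (g j)) ×
                 (∀ i a → f₀ i ≡ just a → g i ≡ a)
      filled = complete Q P (λ a x b y r → (proj₁ r ∘ sym) , λ ne → trans (js y x) (proj₂ r (ne ∘ sym))) f₀ choose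
                 ((λ a x e → V₁ a x e , λ e′ → case trans (sym e) e′ of λ ()) , V₂)
      φ = proj₁ filled
      φ-inj : Injective _≡_ _≡_ φ
      φ-inj {a} {b} e with a ≟ b
      ... | yes p = p
      ... | no ne = ⊥-elim (proj₁ (proj₁ (proj₂ (proj₂ filled)) a b ne) e)
      φ-adjacent : ∀ a b → π a ≢ π b → J (φ a) (φ b) ≡ true
      φ-adjacent a b ne = proj₂ (proj₁ (proj₂ (proj₂ filled)) a b (ne ∘ cong π)) ne

    -- `z` is unrestricted: two vertices in one type are all that a non-crossing triple guarantees,
    -- and `z` will be the vertex that the expansion adds.
    Inner : Fin q → Fin n → Fin n → Fin n → Set
    Inner i x y z = τ x ≡ just i × τ y ≡ just i × x ≢ y × x ≢ z × y ≢ z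

    embed-classes : Symmetric J → (∀ {x y} → J x y ≡ true → Extensible x y) → Robust (m + (k + 12)) →
      (π : Fin m → Fin q) (c : Fin q → ℕ) →
      (∀ i → π (src i) ≡ π (tgt i) → ∀ {x y z} → Inner (π (src i)) x y z → κ (tri x y z) ≡ c (π (src i))) →
      (∀ i j → i ≢ j → π (src i) ≡ π (tgt i) → π (src j) ≡ π (tgt j) → c (π (src i)) ≢ c (π (src j))) →
      HasRainbowCopy κ (expansion3 F)
    embed-classes js ext rob π c uni dist =
      from-placement (embed js rob π (λ _ → nothing) [] z≤n (λ _ _ ()) (λ _ _ _ _ _ ()))
      where
      from-placement : Placement π (λ _ → nothing) [] → HasRainbowCopy κ (expansion3 F)
      from-placement P = rainbow-completion φ φ-inj z₀
            (λ i w e a → subst (φ a ≢_) (proj₂ (z₀-just i w e)) (proj₁ (proj₂ fresh) i a))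
            (λ i j w w′ ne e e′ → let mi , wi = z₀-just i w e ; mj , wj = z₀-just j w′ e′ in
              (λ w≡w′ → proj₁ (proj₂ (proj₂ fresh)) i j ne (trans wi (trans w≡w′ (sym wj)))) ,
              λ eq → dist i j ne mi mj (trans (sym (colour i w mi wi)) (trans eq (colour j w′ mj wj))))
            (λ i e → ext (φJ (src i) (tgt i) (z₀-nothing i e)))
        where
        open Placement {π} {λ _ → nothing} {[]} P renaming (injective to φ-inj; typed to φτ; adjacent to φJ)
        Q : Fin k → Fin n → Set
        Q i w = ∀ a → φ a ≢ w
        choose : ∀ f i → f i ≡ nothing → Extends (λ _ → nothing) f → Compatible Q (λ _ w _ w′ → w ≢ w′) f →
                 ∃ λ w → Q i w × (∀ j w′ → f j ≡ just w′ → w ≢ w′)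
        choose f i _ _ _ =
          let w , _ , w∉ , _ = rob (π (src i)) X (≤-trans (≤-reflexive len) (+-monoʳ-≤ m (m≤m+n k 12)))
          in w , (λ a e → w∉ (∈ₚ.∈-++⁺ˡ (subst (_∈ List.tabulate φ) e (∈-tab φ a)))) ,
             λ j w′ fj e → w∉ (∈ₚ.∈-++⁺ʳ (List.tabulate φ) (subst (_∈ List.tabulate old) (trans (cong (fromMaybe (φ (src i))) fj) (sym e)) (∈-tab old j)))
          where
          old : Fin k → Fin n
          old j = fromMaybe (φ (src i)) (f j)
          X = List.tabulate φ ++ List.tabulate old
          len : length X ≡ m + k
          len = trans (Listₚ.length-++ (List.tabulate φ)) (cong₂ _+_ (length-tab φ) (length-tab old))
        -- Third vertices are reserved for all edges, but `z₀` keeps only those of the edges inside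
        -- a part.
        fresh : Σ (Fin k → Fin n) λ g → (∀ i → Q i (g i)) × (∀ i j → i ≢ j → g i ≢ g j) ×
                  (∀ i a → nothing ≡ just a → g i ≡ a)
        fresh = complete Q (λ _ w _ w′ → w ≢ w′) (λ _ _ _ _ ne → ne ∘ sym) (λ _ → nothing) choose ((λ _ _ ()) , (λ _ _ _ _ _ ()))
        z : Fin k → Fin n
        z = proj₁ fresh
        z₀ : Fin k → Maybe (Fin n)
        z₀ i = if π (src i) ≐ π (tgt i) then just (z i) else nothing
        z₀-just : ∀ i w → z₀ i ≡ just w → π (src i) ≡ π (tgt i) × z i ≡ w
        z₀-just i w e with π (src i) ≟ π (tgt i)
        z₀-just i w refl | yes p = p , refl
        z₀-nothing : ∀ i → z₀ i ≡ nothing → π (src i) ≢ π (tgt i)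
        z₀-nothing i e with π (src i) ≟ π (tgt i)
        ... | no ne = ne
        colour : ∀ i w → π (src i) ≡ π (tgt i) → z i ≡ w → κ (tri (φ (src i)) (φ (tgt i)) w) ≡ c (π (src i))
        colour i w mi refl = uni i mi
          (φτ (src i) , trans (φτ (tgt i)) (cong just (sym mi)) , src≢tgt i ∘ φ-inj ,
           proj₁ (proj₂ fresh) i (src i) , proj₁ (proj₂ fresh) i (tgt i))

    -- Edges are stored with increasing ends, whereas the common vertex of two edges can be either
    -- end of each.
    Oriented : Fin k → Fin m → Fin m → Set
    Oriented e a b = (src e ≡ a × tgt e ≡ b) ⊎ (src e ≡ b × tgt e ≡ a)

    Consistent : (Fin m → Fin q) → Fin m × Fin n → Fin m × Fin n → Set
    Consistent π (a , x) (b , y) = x ≢ y × (π a ≢ π b → J x y ≡ true)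

    pairwise-lookup : ∀ {A : Set} {R : A → A → Set} → (∀ {x y} → R x y → R y x) → ∀ {xs} → AllPairs R xs →
                      ∀ {x y} → x ∈ xs → y ∈ xs → x ≢ y → R x y
    pairwise-lookup s (a ∷ p) (here refl) (here refl) ne = ⊥-elim (ne refl)
    pairwise-lookup s (a ∷ p) (here refl) (there j)   ne = All.lookup a j
    pairwise-lookup s (a ∷ p) (there i)   (here refl) ne = s (All.lookup a i)
    pairwise-lookup s (a ∷ p) (there i)   (there j)   ne = pairwise-lookup s p i j ne

    module Uniform (js : Symmetric J) (ext : ∀ {x y} → J x y ≡ true → Extensible x y)
                   (noRainbow : ¬ HasRainbowCopy κ (expansion3 F)) (rob : Robust (m + (k + 12)))
                   (e₁ e₂ : Fin k) (e₁≢e₂ : e₁ ≢ e₂) (π₀ : Fin m → Fin q)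
                   (proper : ∀ i → i ≢ e₁ → i ≢ e₂ → π₀ (src i) ≢ π₀ (tgt i))
                   (mono₁ : π₀ (src e₁) ≡ π₀ (tgt e₁)) (mono₂ : π₀ (src e₂) ≡ π₀ (tgt e₂)) where

      -- Were the colours different, then `e₁` on `x y z`, `e₂` on `x′ y′ z′` and all other edges of
      -- `F`, which `π₀` colours properly, on edges of `J` would extend to a rainbow copy. `L`
      -- prescribes the images of the ends of `e₁` and `e₂`; `σ` permutes the types so that `e₁` can
      -- be put into any of them.
      two-inner : (σ : Fin q → Fin q) → Injective _≡_ _≡_ σ → ∀ a b c d → Oriented e₁ a b → Oriented e₂ c d →
        (L : List (Fin m × Fin n)) → All (λ p → τ (proj₂ p) ≡ just (σ (π₀ (proj₁ p)))) L →
        AllPairs (Consistent (σ ∘ π₀)) L → ∀ {x y z x′ y′ z′} →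
        lookupPair L a ≡ just x → lookupPair L b ≡ just y → lookupPair L c ≡ just x′ → lookupPair L d ≡ just y′ →
        z ≢ z′ → All (λ p → proj₂ p ≢ z × proj₂ p ≢ z′) L → κ (tri x y z) ≡ κ (tri x′ y′ z′)
      two-inner σ σ-inj a b c d or₁ or₂ L typed cons {x} {y} {z} {x′} {y′} {z′} la lb lc ld z≢z′ fresh =
        decidable-stable (κ (tri x y z) ≟ℕ κ (tri x′ y′ z′)) λ differ → noRainbow (from-placement placement differ)
        where
        π = σ ∘ π₀
        X₀ = z ∷ z′ ∷ []
        symmetric : ∀ {p p′} → Consistent π p p′ → Consistent π p′ p
        symmetric (p , r) = (p ∘ sym) , λ ne → trans (js _ _) (r (ne ∘ sym))
        placement : Placement π (lookupPair L) X₀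
        placement = embed {k + 12} js rob π (lookupPair L) X₀ (≤-trans (s≤s (s≤s z≤n)) (m≤n+m 12 k))
          (λ s w e → All.lookup typed (lookupPair-∈ L s w e))
          (λ s t w w′ ne e e′ → pairwise-lookup {R = Consistent π} symmetric cons
            (lookupPair-∈ L s w e) (lookupPair-∈ L t w′ e′) (ne ∘ cong proj₁))
        from-placement : Placement π (lookupPair L) X₀ → κ (tri x y z) ≢ κ (tri x′ y′ z′) → HasRainbowCopy κ (expansion3 F)
        from-placement P differ = rainbow-completion φ injective z₀ V₁ V₂
          (λ i e → ext (φJ (src i) (tgt i) (proper i (proj₁ (z₀-nothing i e)) (proj₂ (z₀-nothing i e)) ∘ σ-inj)))
          where
          open Placement {π} {lookupPair L} {X₀} P using (φ; injective) renaming (adjacent to φJ; agrees to φL; avoids to φ∉)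
          φ-fresh : ∀ s → φ s ≢ z × φ s ≢ z′
          φ-fresh s with lookupPair L s in eq
          ... | just w  = subst (λ v → v ≢ z × v ≢ z′) (sym (φL s w eq)) (All.lookup fresh (lookupPair-∈ L s w eq))
          ... | nothing = let no∈ = φ∉ s eq in
                          (λ e → no∈ (here e)) , λ e → no∈ (there (here e))
          z₀ : Fin k → Maybe (Fin n)
          z₀ i = if e₁ ≐ i then just z else (if e₂ ≐ i then just z′ else nothing)
          z₀-cases : ∀ i w → z₀ i ≡ just w → (e₁ ≡ i × z ≡ w) ⊎ (e₂ ≡ i × z′ ≡ w)
          z₀-cases i w e with e₁ ≟ i
          z₀-cases i w refl | yes p = inj₁ (p , refl)
          ... | no _ with e₂ ≟ i
          z₀-cases i w refl | no _ | yes p = inj₂ (p , refl)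
          z₀-nothing : ∀ i → z₀ i ≡ nothing → i ≢ e₁ × i ≢ e₂
          z₀-nothing i e with e₁ ≟ i
          ... | no ne with e₂ ≟ i
          ...   | no ne′ = (ne ∘ sym) , (ne′ ∘ sym)
          oriented : ∀ {e s t w w′} v → Oriented e s t → φ s ≡ w → φ t ≡ w′ → κ (tri (φ (src e)) (φ (tgt e)) v) ≡ κ (tri w w′ v)
          oriented v (inj₁ (refl , refl)) refl refl = refl
          oriented v (inj₂ (refl , refl)) refl refl = cong κ (tri-swap _ _ v)
          col₁ : κ (tri (φ (src e₁)) (φ (tgt e₁)) z) ≡ κ (tri x y z)
          col₁ = oriented z or₁ (φL a x la) (φL b y lb)
          col₂ : κ (tri (φ (src e₂)) (φ (tgt e₂)) z′) ≡ κ (tri x′ y′ z′)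
          col₂ = oriented z′ or₂ (φL c x′ lc) (φL d y′ ld)
          V₁ : ∀ i w → z₀ i ≡ just w → ∀ s → φ s ≢ w
          V₁ i w e s with z₀-cases i w e
          ... | inj₁ (refl , refl) = proj₁ (φ-fresh s)
          ... | inj₂ (refl , refl) = proj₂ (φ-fresh s)
          V₂ : ∀ i j w w′ → i ≢ j → z₀ i ≡ just w → z₀ j ≡ just w′ →
               w ≢ w′ × κ (tri (φ (src i)) (φ (tgt i)) w) ≢ κ (tri (φ (src j)) (φ (tgt j)) w′)
          V₂ i j w w′ ne e e′ with z₀-cases i w e | z₀-cases j w′ e′
          ... | inj₁ (refl , refl) | inj₁ (refl , refl) = ⊥-elim (ne refl)
          ... | inj₁ (refl , refl) | inj₂ (refl , refl) = z≢z′ , λ eq → differ (trans (sym col₁) (trans eq col₂))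
          ... | inj₂ (refl , refl) | inj₁ (refl , refl) = (z≢z′ ∘ sym) , λ eq → differ (trans (sym col₁) (trans (sym eq) col₂))
          ... | inj₂ (refl , refl) | inj₂ (refl , refl) = ⊥-elim (ne refl)

      -- A vertex common to `e₁` and `e₂` forces the two triples compared by `two-inner` to share a
      -- vertex, so this case needs other auxiliary triples than that of disjoint edges.
      data Shape : Set where
        disjoint : src e₁ ≢ src e₂ → src e₁ ≢ tgt e₂ → tgt e₁ ≢ src e₂ → tgt e₁ ≢ tgt e₂ → Shape
        path     : ∀ a b d → Oriented e₁ a b → Oriented e₂ a d → b ≢ d → Shape

      shape : Shape
      shape with src e₁ ≟ src e₂
      ... | yes p = path (src e₁) (tgt e₁) (tgt e₂) (inj₁ (refl , refl)) (inj₁ (sym p , refl))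
                      (λ r → e₁≢e₂ (distinct (cong₂ _,_ p r)))
      ... | no n₁ with src e₁ ≟ tgt e₂
      ...   | yes p = path (src e₁) (tgt e₁) (src e₂) (inj₁ (refl , refl)) (inj₂ (refl , sym p))
                        (λ r → <-asym (ordered e₁) (subst₂ _<_ (cong toℕ (sym r)) (cong toℕ (sym p)) (ordered e₂)))
      ...   | no n₂ with tgt e₁ ≟ src e₂
      ...     | yes p = path (tgt e₁) (src e₁) (tgt e₂) (inj₂ (refl , refl)) (inj₁ (sym p , refl)) n₂
      ...     | no n₃ with tgt e₁ ≟ tgt e₂
      ...       | yes p = path (tgt e₁) (src e₁) (src e₂) (inj₂ (refl , refl)) (inj₂ (refl , sym p)) n₁
      ...       | no n₄ = disjoint n₁ n₂ n₃ n₄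

      -- At most ten vertices have to be avoided at once in the comparisons below; this is what the
      -- 12 in the robustness hypothesis provides for.
      pick : ∀ j X → length X ≤ 12 → ∃ λ x → τ x ≡ just j × x ∉ X × (∀ s i → s ∈ X → τ s ≡ just i → i ≢ j → J s x ≡ true)
      pick j X le = rob j X (≤-trans le (≤-trans (m≤n+m 12 k) (m≤n+m _ m)))

      module _ (i : Fin q) where

        private
          σ : Fin q → Fin q
          σ = PC.transpose (π₀ (src e₁)) i
          σ-inj : Injective _≡_ _≡_ σ
          σ-inj = transpose-injective (π₀ (src e₁)) i
          σe₁ : σ (π₀ (src e₁)) ≡ i
          σe₁ = transpose-at (π₀ (src e₁)) i
          σe₁′ : σ (π₀ (tgt e₁)) ≡ i
          σe₁′ = trans (cong σ (sym mono₁)) σe₁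
          j : Fin q
          j = σ (π₀ (src e₂))

          ∉⇒≢ : ∀ {x y : Fin n} {X} → x ∉ X → y ∈ X → y ≢ x
          ∉⇒≢ nx y∈ refl = nx y∈

        -- The given triples may overlap, so each is compared with a third one, `x₁ y₁ z₁`, which is
        -- disjoint from both and lies in the type that receives `e₂`.
        uniform-disjoint : src e₁ ≢ src e₂ → src e₁ ≢ tgt e₂ → tgt e₁ ≢ src e₂ → tgt e₁ ≢ tgt e₂ →
          ∀ {x y z x′ y′ z′} → Inner i x y z → Inner i x′ y′ z′ → κ (tri x y z) ≡ κ (tri x′ y′ z′)
        uniform-disjoint n₁ n₂ n₃ n₄ {x} {y} {z} {x′} {y′} {z′} I I′ =
          trans (link (here refl) (there (here refl)) (there (there (here refl))) I)
                (sym (link (there (there (there (here refl)))) (there (there (there (there (here refl)))))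
                           (there (there (there (there (there (here refl)))))) I′))
          where
          X = x ∷ y ∷ z ∷ x′ ∷ y′ ∷ z′ ∷ []
          px = pick j X (m≤m+n 6 6)
          x₁ = proj₁ px
          py = pick j (x₁ ∷ X) (m≤m+n 7 5)
          y₁ = proj₁ py
          pz = pick j (y₁ ∷ x₁ ∷ X) (m≤m+n 8 4)
          z₁ = proj₁ pz
          x₁∉ = proj₁ (proj₂ (proj₂ px))
          y₁∉ = proj₁ (proj₂ (proj₂ py))
          z₁∉ = proj₁ (proj₂ (proj₂ pz))
          link : ∀ {s t w} → s ∈ X → t ∈ X → w ∈ X → Inner i s t w → κ (tri s t w) ≡ κ (tri x₁ y₁ z₁)
          link {s} {t} {w} s∈ t∈ w∈ (τs , τt , s≢t , s≢w , t≢w) =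
            two-inner σ σ-inj (src e₁) (tgt e₁) (src e₂) (tgt e₂) (inj₁ (refl , refl)) (inj₁ (refl , refl)) L
              (trans τs (cong just (sym σe₁)) ∷ trans τt (cong just (sym σe₁′)) ∷ proj₁ (proj₂ px) ∷
                trans (proj₁ (proj₂ py)) (cong (just ∘ σ) mono₂) ∷ [])
              (((s≢t , λ ne → ⊥-elim (ne (cong σ mono₁))) ∷
                (∉⇒≢ x₁∉ s∈ , λ ne → proj₂ (proj₂ (proj₂ px)) s i s∈ τs (λ e → ne (trans σe₁ e))) ∷
                (∉⇒≢ y₁∉ (there s∈) , λ ne → proj₂ (proj₂ (proj₂ py)) s i (there s∈) τs (λ e → ne (trans σe₁ (trans e (cong σ mono₂))))) ∷ []) ∷
               ((∉⇒≢ x₁∉ t∈ , λ ne → proj₂ (proj₂ (proj₂ px)) t i t∈ τt (λ e → ne (trans σe₁′ e))) ∷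
                (∉⇒≢ y₁∉ (there t∈) , λ ne → proj₂ (proj₂ (proj₂ py)) t i (there t∈) τt (λ e → ne (trans σe₁′ (trans e (cong σ mono₂))))) ∷ []) ∷
               ((∉⇒≢ y₁∉ (here refl) , λ ne → ⊥-elim (ne (cong σ mono₂))) ∷ []) ∷ [] ∷ [])
              (lookupPair-here _ _ _)
              (trans (lookupPair-there _ _ _ _ (src≢tgt e₁)) (lookupPair-here _ _ _))
              (trans (lookupPair-there _ _ _ _ n₁) (trans (lookupPair-there _ _ _ _ n₃) (lookupPair-here _ _ _)))
              (trans (lookupPair-there _ _ _ _ n₂) (trans (lookupPair-there _ _ _ _ n₄)
                (trans (lookupPair-there _ _ _ _ (src≢tgt e₂)) (lookupPair-here _ _ _))))
              (∉⇒≢ z₁∉ (there (there w∈)))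
              ((s≢w , ∉⇒≢ z₁∉ (there (there s∈))) ∷ (t≢w , ∉⇒≢ z₁∉ (there (there t∈))) ∷
               ((∉⇒≢ x₁∉ w∈ ∘ sym) , ∉⇒≢ z₁∉ (there (here refl))) ∷
               ((∉⇒≢ y₁∉ (there w∈) ∘ sym) , ∉⇒≢ z₁∉ (here refl)) ∷ [])
            where
            L = (src e₁ , s) ∷ (tgt e₁ , t) ∷ (src e₂ , x₁) ∷ (tgt e₂ , y₁) ∷ []

        module _ (a b d : Fin m) (or₁ : Oriented e₁ a b) (or₂ : Oriented e₂ a d) (b≢d : b ≢ d) where

          private
            endpoints : ∀ {e s t} → Oriented e s t → π₀ (src e) ≡ π₀ (tgt e) → s ≢ t × π₀ s ≡ π₀ t × π₀ (src e) ≡ π₀ s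
            endpoints {e} (inj₁ (refl , refl)) mono = src≢tgt e , mono , refl
            endpoints {e} (inj₂ (refl , refl)) mono = (src≢tgt e ∘ sym) , sym mono , mono
            σa : σ (π₀ a) ≡ i
            σa = trans (cong σ (sym (proj₂ (proj₂ (endpoints or₁ mono₁))))) σe₁
            σb : σ (π₀ b) ≡ i
            σb = trans (cong σ (sym (proj₁ (proj₂ (endpoints or₁ mono₁))))) σa
            σd : σ (π₀ d) ≡ i
            σd = trans (cong σ (sym (proj₁ (proj₂ (endpoints or₂ mono₂))))) σa

          -- The common end `a` of `e₁` and `e₂` is mapped to `x`; the inequalities say that the two
          -- triples meet nowhere else.
          common : ∀ {x y z y′ z′} → Inner i x y z → Inner i x y′ z′ → y ≢ y′ → y ≢ z′ → y′ ≢ z → z ≢ z′ →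
                   κ (tri x y z) ≡ κ (tri x y′ z′)
          common {x} {y} {z} {y′} {z′} (τx , τy , x≢y , x≢z , y≢z) (_ , τy′ , x≢y′ , x≢z′ , y′≢z′) y≢y′ y≢z′ y′≢z z≢z′ =
            two-inner σ σ-inj a b a d or₁ or₂ ((a , x) ∷ (b , y) ∷ (d , y′) ∷ [])
              (trans τx (cong just (sym σa)) ∷ trans τy (cong just (sym σb)) ∷ trans τy′ (cong just (sym σd)) ∷ [])
              (((x≢y , λ ne → ⊥-elim (ne (trans σa (sym σb)))) ∷ (x≢y′ , λ ne → ⊥-elim (ne (trans σa (sym σd)))) ∷ []) ∷
               ((y≢y′ , λ ne → ⊥-elim (ne (trans σb (sym σd)))) ∷ []) ∷ [] ∷ [])
              (lookupPair-here _ _ _)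
              (trans (lookupPair-there _ _ _ _ a≢b) (lookupPair-here _ _ _))
              (lookupPair-here _ _ _)
              (trans (lookupPair-there _ _ _ _ (proj₁ (endpoints or₂ mono₂))) (trans (lookupPair-there _ _ _ _ b≢d) (lookupPair-here _ _ _)))
              z≢z′ ((x≢z , x≢z′) ∷ (y≢z , y≢z′) ∷ (y′≢z , y′≢z′) ∷ [])
            where
            a≢b = proj₁ (endpoints or₁ mono₁)

          -- `common` compares only triples that meet in a single vertex, so new vertices connect
          -- the given ones: the pairs `x y`, `x y₂`, `y₂ y₃`, `y₃ x′`, `x′ y′` form a walk, and
          -- consecutive triples meet where their pairs do.
          uniform-path : ∀ {x y z x′ y′ z′} → Inner i x y z → Inner i x′ y′ z′ → κ (tri x y z) ≡ κ (tri x′ y′ z′)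
          uniform-path {x} {y} {z} {x′} {y′} {z′} I I′ = begin
            κ (tri x y z)     ≡⟨ common I (step (here refl) I) (∉⇒≢ y₂∉ (there (here refl))) (∉⇒≢ z₁∉ (there (there (there (here refl))))) (∉⇒≢ y₂∉ (there (there (here refl))) ∘ sym) (∉⇒≢ z₁∉ (there (there (there (there (here refl)))))) ⟩
            κ (tri x y₂ z₁)   ≡⟨ cong κ (tri-swap x y₂ z₁) ⟩
            κ (tri y₂ x z₁)   ≡⟨ common
                                   (flip (step (here refl) I))
                                   (τ₂ , τ₃ , ∉⇒≢ y₃∉ (here refl) , ∉⇒≢ z₃∉ (there (there (there (here refl)))) , ∉⇒≢ z₃∉ (there (there (here refl))))
                                   (∉⇒≢ y₃∉ (there (here refl)))
                                   (∉⇒≢ z₃∉ (there (there (there (there (here refl))))))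
                                   (∉⇒≢ z₁∉ (here refl))
                                   (∉⇒≢ z₃∉ (there (here refl))) ⟩
            κ (tri y₂ y₃ z₃)  ≡⟨ cong κ (tri-swap y₂ y₃ z₃) ⟩
            κ (tri y₃ y₂ z₃)  ≡⟨ common
                                   (τ₃ , τ₂ , (∉⇒≢ y₃∉ (here refl) ∘ sym) , ∉⇒≢ z₃∉ (there (there (here refl))) , ∉⇒≢ z₃∉ (there (there (there (here refl)))))
                                   (flip (step′ I′))
                                   (∉⇒≢ y₂∉ (there (there (there (here refl)))) ∘ sym)
                                   (∉⇒≢ z₂∉ (there (there (here refl))))
                                   (∉⇒≢ z₃∉ (there (there (there (there (there (there (there (here refl)))))))))
                                   (∉⇒≢ z₃∉ (here refl) ∘ sym) ⟩
            κ (tri y₃ x′ z₂)  ≡⟨ cong κ (tri-swap y₃ x′ z₂) ⟩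
            κ (tri x′ y₃ z₂)  ≡⟨ sym (common I′ (step′ I′)
                                   (∉⇒≢ y₃∉ (there (there (there (there (there (here refl)))))))
                                   (∉⇒≢ z₂∉ (there (there (there (there (there (there (there (here refl)))))))))
                                   (∉⇒≢ y₃∉ (there (there (there (there (there (there (here refl))))))) ∘ sym)
                                   (∉⇒≢ z₂∉ (there (there (there (there (there (there (there (there (here refl))))))))))) ⟩
            κ (tri x′ y′ z′)  ∎
            where
            open ≡-Reasoning
            X = x ∷ y ∷ z ∷ x′ ∷ y′ ∷ z′ ∷ []
            p₂ = pick i X (m≤m+n 6 6)
            y₂ = proj₁ p₂
            p₃ = pick i (y₂ ∷ X) (m≤m+n 7 5)
            y₃ = proj₁ p₃
            q₁ = pick i (y₃ ∷ y₂ ∷ X) (m≤m+n 8 4)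
            z₁ = proj₁ q₁
            q₂ = pick i (z₁ ∷ y₃ ∷ y₂ ∷ X) (m≤m+n 9 3)
            z₂ = proj₁ q₂
            q₃ = pick i (z₂ ∷ z₁ ∷ y₃ ∷ y₂ ∷ X) (m≤m+n 10 2)
            z₃ = proj₁ q₃
            τ₂ = proj₁ (proj₂ p₂)
            τ₃ = proj₁ (proj₂ p₃)
            y₂∉ = proj₁ (proj₂ (proj₂ p₂))
            y₃∉ = proj₁ (proj₂ (proj₂ p₃))
            z₁∉ = proj₁ (proj₂ (proj₂ q₁))
            z₂∉ = proj₁ (proj₂ (proj₂ q₂))
            z₃∉ = proj₁ (proj₂ (proj₂ q₃))
            flip : ∀ {s t w} → Inner i s t w → Inner i t s w
            flip (p , q , r , s , t) = q , p , (r ∘ sym) , t , s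
            step : ∀ {s t w} → s ∈ X → Inner i s t w → Inner i s y₂ z₁
            step s∈ (τs , _) = τs , τ₂ , ∉⇒≢ y₂∉ s∈ , ∉⇒≢ z₁∉ (there (there s∈)) , ∉⇒≢ z₁∉ (there (here refl))
            step′ : ∀ {t w} → Inner i x′ t w → Inner i x′ y₃ z₂
            step′ (τs , _) = τs , τ₃ , ∉⇒≢ y₃∉ (there (there (there (there (here refl))))) ,
                             ∉⇒≢ z₂∉ (there (there (there (there (there (there (here refl))))))) , ∉⇒≢ z₂∉ (there (here refl))

        uniform : ∀ {x y z x′ y′ z′} → Inner i x y z → Inner i x′ y′ z′ → κ (tri x y z) ≡ κ (tri x′ y′ z′)
        uniform with shape
        ... | disjoint n₁ n₂ n₃ n₄ = uniform-disjoint n₁ n₂ n₃ n₄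
        ... | path a b d or₁ or₂ b≢d = uniform-path a b d or₁ or₂ b≢d

-- Counting crossing triples

does-iff : ∀ {P Q : Set} → (P → Q) → (Q → P) → (p : Dec P) (q : Dec Q) → does p ≡ does q
does-iff f g (yes p) (yes q) = refl
does-iff f g (yes p) (no ¬q) = ⊥-elim (¬q (f p))
does-iff f g (no ¬p) (yes q) = ⊥-elim (¬p (g q))
does-iff f g (no ¬p) (no ¬q) = refl

countSubsets : ∀ n → (Subset n → Bool) → ℕ
countSubsets zero    P = 𝟙 (P [])
countSubsets (suc n) P = countSubsets n (P ∘ (true ∷_)) + countSubsets n (P ∘ (false ∷_))

countSubsets-cong : ∀ n {P Q : Subset n → Bool} → (∀ s → P s ≡ Q s) → countSubsets n P ≡ countSubsets n Q
countSubsets-cong zero    h = cong 𝟙 (h [])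
countSubsets-cong (suc n) h = cong₂ _+_ (countSubsets-cong n (h ∘ (true ∷_))) (countSubsets-cong n (h ∘ (false ∷_)))

countSubsets-none : ∀ n → countSubsets n (λ _ → false) ≡ 0
countSubsets-none zero    = refl
countSubsets-none (suc n) = cong₂ _+_ (countSubsets-none n) (countSubsets-none n)

length-filter-map : ∀ {A B : Set} {P : B → Set} (P? : ∀ x → Dec (P x)) (f : A → B) xs →
                    length (filter P? (map f xs)) ≡ length (filter (P? ∘ f) xs)
length-filter-map P? f [] = refl
length-filter-map P? f (x ∷ xs) with does (P? (f x))
... | true  = cong suc (length-filter-map P? f xs)
... | false = length-filter-map P? f xs

length-filter-subsets : ∀ n {P : Subset n → Set} (P? : ∀ s → Dec (P s)) →
                        length (filter P? (allSubsets n)) ≡ countSubsets n (does ∘ P?)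
length-filter-subsets zero P? with does (P? [])
... | true  = refl
... | false = refl
length-filter-subsets (suc n) P? = begin
  length (filter P? (map (true ∷_) (allSubsets n) ++ map (false ∷_) (allSubsets n)))
    ≡⟨ cong length (Listₚ.filter-++ P? (map (true ∷_) (allSubsets n)) _) ⟩
  length (filter P? (map (true ∷_) (allSubsets n)) ++ filter P? (map (false ∷_) (allSubsets n)))
    ≡⟨ Listₚ.length-++ (filter P? (map (true ∷_) (allSubsets n))) ⟩
  length (filter P? (map (true ∷_) (allSubsets n))) + length (filter P? (map (false ∷_) (allSubsets n)))
    ≡⟨ cong₂ _+_ (trans (length-filter-map P? (true ∷_) (allSubsets n)) (length-filter-subsets n (P? ∘ (true ∷_))))
                 (trans (length-filter-map P? (false ∷_) (allSubsets n)) (length-filter-subsets n (P? ∘ (false ∷_)))) ⟩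
  countSubsets (suc n) (does ∘ P?) ∎
  where open ≡-Reasoning

length-filter-filter : ∀ {A : Set} {P Q : A → Set} (P? : ∀ x → Dec (P x)) (Q? : ∀ x → Dec (Q x)) xs →
                       length (filter P? (filter Q? xs)) ≡ length (filter (λ x → Q? x ×-dec P? x) xs)
length-filter-filter P? Q? [] = refl
length-filter-filter P? Q? (x ∷ xs) with does (Q? x)
... | false = length-filter-filter P? Q? xs
... | true with does (P? x)
...   | true  = cong suc (length-filter-filter P? Q? xs)
...   | false = length-filter-filter P? Q? xs

partOf : ∀ {n q} → (Fin n → Fin q) → Fin q → Subset n
partOf τ t = tabulate (λ x → τ x ≐ t)

size : ∀ {n q} → (Fin n → Fin q) → Fin q → ℕ
size τ t = card (λ x → τ x ≐ t)

-- Crossing is the case where every capacity is 1. The induction over the vertices needs the general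
-- form, since a chosen vertex uses up the capacity of its part.
Within : ∀ {n q} → (Fin n → Fin q) → (Fin q → Bool) → Subset n → Set
Within τ cap s = ∀ t → ∣ s ∩ partOf τ t ∣ ≤ 𝟙 (cap t)

within? : ∀ {n q} (τ : Fin n → Fin q) cap s → Dec (Within τ cap s)
within? τ cap s = Finₚ.all? (λ t → ∣ s ∩ partOf τ t ∣ ≤? 𝟙 (cap t))

Crossing : ∀ {n q} → (Fin n → Fin q) → Subset n → Set
Crossing τ s = ∀ t → ∣ s ∩ partOf τ t ∣ ≤ 1

crossing? : ∀ {n q} (τ : Fin n → Fin q) s → Dec (Crossing τ s)
crossing? τ s = Finₚ.all? (λ t → ∣ s ∩ partOf τ t ∣ ≤? 1)

-- The `k`-th elementary symmetric polynomial in `a`; evaluated at the part sizes it counts the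
-- crossing `k`-sets.
esym : ∀ q → ℕ → (Fin q → ℕ) → ℕ
esym q       zero    a = 1
esym zero    (suc k) a = 0
esym (suc q) (suc k) a = esym q (suc k) (a ∘ suc) + a zero * esym q k (a ∘ suc)

esym-mono : ∀ q k {a b : Fin q → ℕ} → (∀ t → a t ≤ b t) → esym q k a ≤ esym q k b
esym-mono q       zero    h = ≤-refl
esym-mono zero    (suc k) h = ≤-refl
esym-mono (suc q) (suc k) h = +-mono-≤ (esym-mono q (suc k) (h ∘ suc)) (*-mono-≤ (h zero) (esym-mono q k (h ∘ suc)))

esym-cong : ∀ q k {a b : Fin q → ℕ} → (∀ t → a t ≡ b t) → esym q k a ≡ esym q k b
esym-cong q k h = ≤-antisym (esym-mono q k (λ t → ≤-reflexive (h t))) (esym-mono q k (λ t → ≤-reflexive (sym (h t))))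

drop : ∀ {q} → Fin q → (Fin q → ℕ) → Fin q → ℕ
drop i a t = if i ≐ t then 0 else a t

drop-suc : ∀ {q} (i : Fin q) (a : Fin (suc q) → ℕ) t → drop (suc i) a (suc t) ≡ drop i (a ∘ suc) t
drop-suc i a t with i ≟ t
... | yes _ = refl
... | no _  = refl

-- The monomials without the variable `i`, and then those with it.
esym-affine : ∀ q k (i : Fin q) a → esym q (suc k) a ≡ esym q (suc k) (drop i a) + a i * esym q k (drop i a)
esym-affine (suc q) k zero a = cong₂ _+_ (sym (+-identityʳ _)) (cong (a zero *_) (head k))
  where
  head : ∀ k → esym q k (a ∘ suc) ≡ esym (suc q) k (drop zero a)
  head zero    = refl
  head (suc k) = sym (+-identityʳ _)
esym-affine (suc q) zero (suc i) a = trans (cong (_+ a zero * 1) (trans (esym-affine q zero i (a ∘ suc))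
      (cong (_+ a (suc i) * 1) (esym-cong q 1 (λ t → sym (drop-suc i a t))))))
  (reorder (esym q 1 (drop (suc i) a ∘ suc)) (a (suc i)) (a zero))
  where
  reorder : ∀ x y z → x + y * 1 + z * 1 ≡ x + z * 1 + y * 1
  reorder = solve-∀
esym-affine (suc q) (suc k) (suc i) a = begin
  esym q (2 + k) a′ + a zero * esym q (suc k) a′
    ≡⟨ cong₂ (λ x y → x + a zero * y) (esym-affine q (suc k) i a′) (esym-affine q k i a′) ⟩
  esym q (2 + k) d + y * esym q (suc k) d + a zero * (esym q (suc k) d + y * esym q k d)
    ≡⟨ reorder (esym q (2 + k) d) (esym q (suc k) d) (esym q k d) y (a zero) ⟩
  esym q (2 + k) d + a zero * esym q (suc k) d + y * (esym q (suc k) d + a zero * esym q k d)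
    ≡⟨ cong₂ (λ x z → x + y * z)
         (cong₂ (λ x z → x + a zero * z) (esym-cong q (2 + k) dd) (esym-cong q (suc k) dd))
         (cong₂ (λ x z → x + a zero * z) (esym-cong q (suc k) dd) (esym-cong q k dd)) ⟩
  esym (suc q) (2 + k) (drop (suc i) a) + y * esym (suc q) (suc k) (drop (suc i) a) ∎
  where
  open ≡-Reasoning
  a′ = a ∘ suc
  d = drop i a′
  y = a (suc i)
  dd : ∀ t → d t ≡ drop (suc i) a (suc t)
  dd t = sym (drop-suc i a t)
  reorder : ∀ A B C y z → A + y * B + z * (B + y * C) ≡ A + z * B + y * (B + z * C)
  reorder = solve-∀

∣∷∣ : ∀ {n} b (s : Subset n) → ∣ b ∷ s ∣ ≡ 𝟙 b + ∣ s ∣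
∣∷∣ true  s = refl
∣∷∣ false s = refl

-- A set containing the first vertex has no capacity left in the part `c` of that vertex. Expanding
-- the counts with and without it by `esym-affine` at `c` shows that they add up to the value for
-- the part enlarged by one.
countWithin : ∀ n {q} k (τ : Fin n → Fin q) cap →
  countSubsets n (λ s → does (∣ s ∣ ≟ℕ k) ∧ does (within? τ cap s)) ≡ esym q k (λ t → 𝟙 (cap t) * size τ t)
countWithin zero {q} k τ cap = trans (cong (λ b → 𝟙 (does (0 ≟ℕ k) ∧ b)) (dec-true (within? τ cap []) (λ t → z≤n))) (empty k)
  where
  empty′ : ∀ q k (a : Fin q → ℕ) → (∀ t → a t ≡ 0) → esym q (suc k) a ≡ 0
  empty′ zero    k a z = refl
  empty′ (suc q) k a z rewrite z zero | empty′ q k (a ∘ suc) (z ∘ suc) = refl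
  empty : ∀ k → 𝟙 (does (0 ≟ℕ k) ∧ true) ≡ esym q k (λ t → 𝟙 (cap t) * size τ t)
  empty zero    = refl
  empty (suc k) = sym (empty′ q k _ (λ t → trans (cong (𝟙 (cap t) *_) (∑-nil _)) (*-zeroʳ (𝟙 (cap t)))))
countWithin (suc n) {q} k τ cap = trans (cong₂ _+_ (with-head k) without-head) (combine k)
  where
  τ′ : Fin n → Fin q
  τ′ = τ ∘ suc
  c = τ zero
  a a′ : Fin q → ℕ
  a  t = 𝟙 (cap t) * size τ t
  a′ t = 𝟙 (cap t) * size τ′ t
  cap′ : Fin q → Bool
  cap′ t = cap t ∧ not (c ≐ t)
  meet : ∀ b s t → ∣ (b ∷ s) ∩ partOf τ t ∣ ≡ 𝟙 (b ∧ (c ≐ t)) + ∣ s ∩ partOf τ′ t ∣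
  meet b s t = ∣∷∣ (b ∧ (c ≐ t)) (s ∩ partOf τ′ t)
  without-head : countSubsets n (λ s → does (∣ false ∷ s ∣ ≟ℕ k) ∧ does (within? τ cap (false ∷ s))) ≡ esym q k a′
  without-head = trans (countSubsets-cong n (λ s → cong (does (∣ s ∣ ≟ℕ k) ∧_)
      (does-iff {Within τ cap (false ∷ s)} {Within τ′ cap s} (λ w t → w t) (λ w t → w t) (within? τ cap (false ∷ s)) (within? τ′ cap s))))
    (countWithin n k τ′ cap)
  with-headℕ : ℕ → ℕ
  with-headℕ zero    = 0
  with-headℕ (suc k) = 𝟙 (cap c) * esym q k (λ t → 𝟙 (cap′ t) * size τ′ t)
  with-head : ∀ k → countSubsets n (λ s → does (∣ true ∷ s ∣ ≟ℕ k) ∧ does (within? τ cap (true ∷ s))) ≡ with-headℕ k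
  with-head zero = countSubsets-none n
  with-head (suc k) with cap c in eq
  ... | false = trans (countSubsets-cong n (λ s → trans (cong (does (∣ s ∣ ≟ℕ k) ∧_) (dec-false (within? τ cap (true ∷ s)) (over s))) (∧-false (does (∣ s ∣ ≟ℕ k)))))
                  (countSubsets-none n)
    where
    ∧-false : ∀ b → b ∧ false ≡ false
    ∧-false true  = refl
    ∧-false false = refl
    over : ∀ s → ¬ Within τ cap (true ∷ s)
    over s w = <⇒≱ (s≤s z≤n) (≤-trans (≤-trans (m≤m+n 1 _) (≤-reflexive (sym (trans (meet true s c) (cong (λ b → 𝟙 b + ∣ s ∩ partOf τ′ c ∣) (≐-refl c))))))
                 (≤-trans (w c) (≤-reflexive (cong 𝟙 eq))))
  ... | true = trans (countSubsets-cong n (λ s → cong (does (∣ s ∣ ≟ℕ k) ∧_)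
                 (does-iff (to s) (from s) (within? τ cap (true ∷ s)) (within? τ′ cap′ s))))
               (trans (countWithin n k τ′ cap′) (sym (+-identityʳ _)))
    where
    pointwise : ∀ t → 𝟙 (cap t) ≡ 𝟙 (c ≐ t) + 𝟙 (cap′ t)
    pointwise t with c ≟ t
    ... | yes refl rewrite eq = refl
    ... | no _ with cap t
    ...   | true  = refl
    ...   | false = refl
    to : ∀ s → Within τ cap (true ∷ s) → Within τ′ cap′ s
    to s w t = +-cancelˡ-≤ (𝟙 (c ≐ t)) _ _ (subst₂ _≤_ (meet true s t) (pointwise t) (w t))
    from : ∀ s → Within τ′ cap′ s → Within τ cap (true ∷ s)
    from s w t = subst₂ _≤_ (sym (meet true s t)) (sym (pointwise t)) (+-monoʳ-≤ (𝟙 (c ≐ t)) (w t))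
  drop-a : ∀ t → drop c a t ≡ 𝟙 (cap′ t) * size τ′ t
  drop-a t with c ≟ t
  ... | yes _ with cap t
  ...   | true  = refl
  ...   | false = refl
  drop-a t | no ne with cap t
  ...   | true  = cong (_+ 0) (trans (∑-suc _) (cong (λ b → 𝟙 b + size τ′ t) (≢⇒≐ ne)))
  ...   | false = refl
  drop-a′ : ∀ t → drop c a′ t ≡ 𝟙 (cap′ t) * size τ′ t
  drop-a′ t with c ≟ t
  ... | yes _ with cap t
  ...   | true  = refl
  ...   | false = refl
  drop-a′ t | no ne with cap t
  ...   | true  = refl
  ...   | false = refl
  ac : a c ≡ 𝟙 (cap c) * (1 + size τ′ c)
  ac = cong (𝟙 (cap c) *_) (trans (∑-suc _) (cong (λ b → 𝟙 b + size τ′ c) (≐-refl c)))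
  combine : ∀ k → with-headℕ k + esym q k a′ ≡ esym q k a
  combine zero    = refl
  combine (suc k) = begin
    𝟙 (cap c) * esym q k b + esym q (suc k) a′
      ≡⟨ cong (𝟙 (cap c) * esym q k b +_) (trans (esym-affine q k c a′)
           (cong₂ (λ x y → x + a′ c * y) (esym-cong q (suc k) drop-a′) (esym-cong q k drop-a′))) ⟩
    𝟙 (cap c) * esym q k b + (esym q (suc k) b + 𝟙 (cap c) * size τ′ c * esym q k b)
      ≡⟨ reorder (𝟙 (cap c)) (esym q k b) (esym q (suc k) b) (size τ′ c) ⟩
    esym q (suc k) b + 𝟙 (cap c) * (1 + size τ′ c) * esym q k b
      ≡⟨ cong₂ _+_ (esym-cong q (suc k) (sym ∘ drop-a)) (cong₂ _*_ (sym ac) (esym-cong q k (sym ∘ drop-a))) ⟩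
    esym q (suc k) (drop c a) + a c * esym q k (drop c a)
      ≡⟨ sym (esym-affine q k c a) ⟩
    esym q (suc k) a ∎
    where
    open ≡-Reasoning
    b : Fin q → ℕ
    b t = 𝟙 (cap′ t) * size τ′ t
    reorder : ∀ u e f s → u * e + (f + u * s * e) ≡ f + u * (1 + s) * e
    reorder = solve-∀

length-crossing : ∀ n {q} (τ : Fin n → Fin q) → length (filter (crossing? τ) (triples n)) ≡ esym q 3 (size τ)
length-crossing n {q} τ = trans (length-filter-filter (crossing? τ) (λ s → ∣ s ∣ ≟ℕ 3) (allSubsets n))
  (trans (length-filter-subsets n _) (trans (countWithin n 3 τ (λ _ → true)) (esym-cong q 3 (λ t → +-identityʳ _))))

-- Moving a unit from a part that is too large to one that is too small does not decrease esym.
module _ (q k : ℕ) (b : Fin q → ℕ) (balanced : ∀ i j → b i ≤ suc (b j)) where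

  private
    excess : (Fin q → ℕ) → ℕ
    excess a = ∑ (λ t → a t ∸ b t)

  esym-balanced : ∀ fuel a → excess a ≤ fuel → ∑ a ≡ ∑ b → esym q (2 + k) a ≤ esym q (2 + k) b
  esym-balanced fuel a le same with Finₚ.any? (λ t → b t <? a t)
  ... | no none = esym-mono q (2 + k) (λ t → ≮⇒≥ (λ p → none (t , p)))
  ... | yes (i , bi<ai) with Finₚ.any? (λ t → a t <? b t)
  ...   | no none = ⊥-elim (<-irrefl (sym same) strict)
    where
    strict : suc (∑ b) ≤ ∑ a
    strict = begin
      suc (∑ b)                        ≡⟨ sym (trans (cong (∑ b +_) (card-point i)) (+-comm (∑ b) 1)) ⟩
      ∑ b + card (i ≐_)                ≡⟨ sym (∑-+ b _) ⟩
      ∑ (λ t → b t + 𝟙 (i ≐ t))        ≤⟨ ∑-mono pw ⟩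
      ∑ a                              ∎
      where
      open ≤-Reasoning
      pw : ∀ t → b t + 𝟙 (i ≐ t) ≤ a t
      pw t with i ≟ t
      ... | yes refl = ≤-trans (≤-reflexive (+-comm (b i) 1)) bi<ai
      ... | no _ = ≤-trans (≤-reflexive (+-identityʳ (b t))) (≮⇒≥ (λ p → none (t , p)))
  ...   | yes (j , aj<bj) with a i in ai
  ...     | zero = ⊥-elim (n≮0 bi<ai)
  ...     | suc p = ≤-trans increase (recurse fuel le)
    where
    i≢j : i ≢ j
    i≢j refl = <-asym aj<bj (subst (b i <_) (sym ai) bi<ai)
    -- Balance of `b` gives `a j < b j ≤ suc (b i) ≤ a i`, which keeps the product of the two sizes
    -- from decreasing when a unit is moved.
    aj≤p : a j ≤ p
    aj≤p = s≤s⁻¹ (≤-trans aj<bj (≤-trans (balanced j i) bi<ai))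
    a′ : Fin q → ℕ
    a′ t = if i ≐ t then p else (if j ≐ t then suc (a j) else a t)
    moved : ∀ t → a′ t + 𝟙 (i ≐ t) ≡ a t + 𝟙 (j ≐ t)
    moved t with i ≟ t
    moved t | yes refl rewrite ≢⇒≐ (i≢j ∘ sym) = trans (+-comm p 1) (trans (sym ai) (sym (+-identityʳ _)))
    moved t | no _ with j ≟ t
    ... | yes refl = trans (+-identityʳ _) (+-comm 1 (a j))
    ... | no _ = refl
    same′ : ∑ a′ ≡ ∑ b
    same′ = trans (+-cancelʳ-≡ (card (i ≐_)) (∑ a′) (∑ a) (begin
      ∑ a′ + card (i ≐_)         ≡⟨ sym (∑-+ a′ _) ⟩
      ∑ (λ t → a′ t + 𝟙 (i ≐ t)) ≡⟨ ∑-cong moved ⟩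
      ∑ (λ t → a t + 𝟙 (j ≐ t))  ≡⟨ ∑-+ a _ ⟩
      ∑ a + card (j ≐_)          ≡⟨ cong (∑ a +_) (trans (card-point j) (sym (card-point i))) ⟩
      ∑ a + card (i ≐_)          ∎)) same
      where open ≡-Reasoning
    lessens : ∀ t → a′ t ∸ b t + 𝟙 (i ≐ t) ≤ a t ∸ b t
    lessens t with i ≟ t
    lessens t | yes refl = ≤-reflexive (trans (+-comm (p ∸ b i) 1) (trans (sym (+-∸-assoc 1 (s≤s⁻¹ bi<ai))) (cong (_∸ b i) (sym ai))))
    lessens t | no _ with j ≟ t
    ... | yes refl = ≤-trans (≤-reflexive (trans (+-identityʳ _) (m≤n⇒m∸n≡0 aj<bj))) z≤n
    ... | no _ = ≤-reflexive (+-identityʳ _)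
    excess-less : suc (excess a′) ≤ excess a
    excess-less = ≤-trans (≤-reflexive (trans (+-comm 1 (excess a′)) (trans (cong (excess a′ +_) (sym (card-point i))) (sym (∑-+ _ _))))) (∑-mono lessens)
    recurse : ∀ fuel → excess a ≤ fuel → esym q (2 + k) a′ ≤ esym q (2 + k) b
    recurse zero le = ⊥-elim (<⇒≱ (s≤s z≤n) (≤-trans excess-less le))
    recurse (suc fuel) le = esym-balanced fuel a′ (s≤s⁻¹ (≤-trans excess-less le)) same′
    rest : Fin q → ℕ
    rest = drop j (drop i a)
    expand : ∀ (c : Fin q → ℕ) → (∀ t → drop j (drop i c) t ≡ rest t) →
      esym q (2 + k) c ≡ esym q (2 + k) rest + (c j + c i) * esym q (suc k) rest + c i * c j * esym q k rest
    expand c same = begin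
      esym q (2 + k) c
        ≡⟨ esym-affine q (suc k) i c ⟩
      esym q (2 + k) (drop i c) + c i * esym q (suc k) (drop i c)
        ≡⟨ cong₂ (λ x y → x + c i * y) (esym-affine q (suc k) j (drop i c)) (esym-affine q k j (drop i c)) ⟩
      esym q (2 + k) d + drop i c j * esym q (suc k) d + c i * (esym q (suc k) d + drop i c j * esym q k d)
        ≡⟨ cong₂ (λ (x y : ℕ) → esym q (2 + k) d + x * esym q (suc k) d + c i * (esym q (suc k) d + y * esym q k d)) dc dc ⟩
      esym q (2 + k) d + c j * esym q (suc k) d + c i * (esym q (suc k) d + c j * esym q k d)
        ≡⟨ reorder (esym q (2 + k) d) (esym q (suc k) d) (esym q k d) (c i) (c j) ⟩
      esym q (2 + k) d + (c j + c i) * esym q (suc k) d + c i * c j * esym q k d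
        ≡⟨ cong₂ _+_ (cong₂ (λ x y → x + (c j + c i) * y) (esym-cong q (2 + k) same) (esym-cong q (suc k) same))
                     (cong (c i * c j *_) (esym-cong q k same)) ⟩
      esym q (2 + k) rest + (c j + c i) * esym q (suc k) rest + c i * c j * esym q k rest ∎
      where
      open ≡-Reasoning
      d = drop j (drop i c)
      dc : drop i c j ≡ c j
      dc rewrite ≢⇒≐ i≢j = refl
      reorder : ∀ A B C x y → A + y * B + x * (B + y * C) ≡ A + (y + x) * B + x * y * C
      reorder = solve-∀
    same-rest : ∀ t → drop j (drop i a′) t ≡ rest t
    same-rest t with j ≟ t
    ... | yes _ = refl
    ... | no _ with i ≟ t
    ...   | yes _ = refl
    ...   | no _  = refl
    a′i : a′ i ≡ p
    a′i rewrite ≐-refl i = refl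
    a′j : a′ j ≡ suc (a j)
    a′j rewrite ≢⇒≐ i≢j | ≐-refl j = refl
    increase : esym q (2 + k) a ≤ esym q (2 + k) a′
    increase = begin
      esym q (2 + k) a ≡⟨ expand a (λ _ → refl) ⟩
      esym q (2 + k) rest + (a j + a i) * esym q (suc k) rest + a i * a j * esym q k rest
        ≡⟨ cong (λ x → esym q (2 + k) rest + (a j + x) * esym q (suc k) rest + x * a j * esym q k rest) ai ⟩
      esym q (2 + k) rest + (a j + suc p) * esym q (suc k) rest + suc p * a j * esym q k rest
        ≤⟨ +-mono-≤ (+-monoʳ-≤ (esym q (2 + k) rest) (≤-reflexive (cong (_* esym q (suc k) rest) (+-suc (a j) p)))) (*-monoˡ-≤ (esym q k rest) product) ⟩
      esym q (2 + k) rest + (suc (a j) + p) * esym q (suc k) rest + p * suc (a j) * esym q k rest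
        ≡⟨ cong₂ (λ x y → esym q (2 + k) rest + (x + y) * esym q (suc k) rest + y * x * esym q k rest) (sym a′j) (sym a′i) ⟩
      esym q (2 + k) rest + (a′ j + a′ i) * esym q (suc k) rest + a′ i * a′ j * esym q k rest
        ≡⟨ sym (expand a′ same-rest) ⟩
      esym q (2 + k) a′ ∎
      where
      open ≤-Reasoning
      product : suc p * a j ≤ p * suc (a j)
      product = ≤-trans (+-monoˡ-≤ (p * a j) aj≤p) (≤-reflexive (sym (*-suc p (a j))))

length-filter-cong : ∀ {A : Set} {P Q : A → Set} (P? : ∀ x → Dec (P x)) (Q? : ∀ x → Dec (Q x)) →
                     (∀ x → does (P? x) ≡ does (Q? x)) → ∀ xs → length (filter P? xs) ≡ length (filter Q? xs)
length-filter-cong P? Q? h [] = refl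
length-filter-cong P? Q? h (x ∷ xs) with does (P? x) | does (Q? x) | h x
... | true  | _ | refl = cong suc (length-filter-cong P? Q? h xs)
... | false | _ | refl = length-filter-cong P? Q? h xs

∑-size : ∀ {n q} (τ : Fin n → Fin q) → ∑ (size τ) ≡ n
∑-size {n} τ = trans (∑-swap _) (trans (∑-cong (λ x → card-point (τ x))) (trans (∑-const n 1) (*-identityʳ n)))

-- Residue classes and the Turán number

residue : ∀ q n → Fin n → Fin (suc q)
residue q n x = fromℕ< (m%n<n (toℕ x) (suc q))

residue-≐ : ∀ q n x t → (toℕ {n} x % suc q ≡ᵇ toℕ t) ≡ (residue q n x ≐ t)
residue-≐ q n x t = does-iff (λ e → Finₚ.toℕ-injective (trans (Finₚ.toℕ-fromℕ< _) e))
  (λ e → trans (sym (Finₚ.toℕ-fromℕ< _)) (cong toℕ e)) (toℕ x % suc q ≟ℕ toℕ t) (residue q n x ≟ t)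

partSet≡ : ∀ {n} q t → partSet {n} q t ≡ partOf (residue q n) t
partSet≡ {n} q t = Vecₚ.tabulate-cong (λ x → residue-≐ q n x t)

tp3-esym : ∀ q n → tp3 (2 + q) n ≡ esym (suc q) 3 (size (residue q n))
tp3-esym q n = trans (length-filter-cong _ (crossing? (residue q n)) (λ s → does-iff
    (λ w t → subst (λ P → ∣ s ∩ P ∣ ≤ 1) (partSet≡ q t) (w t))
    (λ w t → subst (λ P → ∣ s ∩ P ∣ ≤ 1) (sym (partSet≡ q t)) (w t))
    (Finₚ.all? (λ t → ∣ s ∩ partSet q t ∣ ≤? 1)) (crossing? (residue q n) s)) (triples n))
  (length-crossing n (residue q n))

module Residues (q : ℕ) where

  class : ℕ → Fin (suc q) → ℕ
  class i t = 𝟙 (i % suc q ≡ᵇ toℕ t)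

  count : ℕ → Fin (suc q) → ℕ
  count n t = ∑ {n} (λ x → class (toℕ x) t)

  size≡count : ∀ n t → size (residue q n) t ≡ count n t
  size≡count n t = ∑-cong (λ x → cong 𝟙 (sym (residue-≐ q n x t)))

  ∑-last : ∀ n (g : ℕ → ℕ) → ∑ {suc n} (g ∘ toℕ) ≡ ∑ {n} (g ∘ toℕ) + g n
  ∑-last zero    g = trans (∑-suc _) (trans (cong (g 0 +_) (∑-nil _)) (trans (+-identityʳ _) (cong (_+ g 0) (sym (∑-nil _)))))
  ∑-last (suc n) g = trans (∑-suc _) (trans (cong (g 0 +_) (∑-last n (g ∘ suc)))
    (trans (sym (+-assoc (g 0) _ _)) (cong (_+ g (suc n)) (sym (∑-suc _)))))

  ∑-append : ∀ a b (g : ℕ → ℕ) → ∑ {a + b} (g ∘ toℕ) ≡ ∑ {a} (g ∘ toℕ) + ∑ {b} (λ x → g (a + toℕ x))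
  ∑-append zero    b g = cong (_+ ∑ {b} (g ∘ toℕ)) (sym (∑-nil _))
  ∑-append (suc a) b g = trans (∑-suc _) (trans (cong (g 0 +_) (∑-append a b (g ∘ suc)))
    (trans (sym (+-assoc (g 0) _ _)) (cong (_+ ∑ {b} (λ x → g (suc a + toℕ x))) (sym (∑-suc _)))))

  period : ∀ t → count (suc q) t ≡ 1
  period t = trans (∑-cong (λ x → cong 𝟙 (trans (residue-≐ q (suc q) x t)
      (does-iff (λ e → sym (trans (sym (fixed x)) e)) (λ e → trans (fixed x) (sym e)) (residue q (suc q) x ≟ t) (t ≟ x))))) (card-point t)
    where
    fixed : ∀ x → residue q (suc q) x ≡ x
    fixed x = Finₚ.toℕ-injective (trans (Finₚ.toℕ-fromℕ< _) (m<n⇒m%n≡m (Finₚ.toℕ<n x)))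

  count-period : ∀ n t → count (suc q + n) t ≡ suc (count n t)
  count-period n t = trans (∑-append (suc q) n (λ i → class i t)) (cong₂ _+_ (period t)
    (∑-cong {n} (λ x → cong (λ i → 𝟙 (i ≡ᵇ toℕ t)) (trans (cong (_% suc q) (+-comm (suc q) (toℕ x))) ([m+n]%n≡m%n (toℕ x) (suc q))))))

  count-remainder : ∀ r → r ≤ suc q → ∀ t → count r t ≤ 1
  count-remainder r le t = ≤-trans (m≤m+n _ _) (≤-trans (≤-reflexive (sym (∑-append r (suc q ∸ r) (λ i → class i t))))
    (≤-reflexive (trans (cong (λ n → count n t) (m+[n∸m]≡n le)) (period t))))

  count-bounds : ∀ k r → r ≤ suc q → ∀ t → k ≤ count (k * suc q + r) t × count (k * suc q + r) t ≤ suc k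
  count-bounds zero    r le t = z≤n , count-remainder r le t
  count-bounds (suc k) r le t with count-bounds k r le t
  ... | lo , hi = subst (λ c → suc k ≤ c × c ≤ suc (suc k))
        (sym (trans (cong (λ n → count n t) (+-assoc (suc q) (k * suc q) r)) (count-period (k * suc q + r) t))) (s≤s lo , s≤s hi)

  size-bounds : ∀ n t → n / suc q ≤ size (residue q n) t × size (residue q n) t ≤ suc (n / suc q)
  size-bounds n t = subst (λ c → n / suc q ≤ c × c ≤ suc (n / suc q))
    (trans (cong (λ n → count n t) (trans (+-comm (n / suc q * suc q) _) (sym (m≡m%n+[m/n]*n n (suc q))))) (sym (size≡count n t)))
    (count-bounds (n / suc q) (n % suc q) (<⇒≤ (m%n<n n (suc q))) t)

  -- Every residue class has `n / suc q` elements or one more, so `esym-balanced` applies with the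
  -- residue classes as the balanced partition.
  crossing-max : ∀ n (τ : Fin n → Fin (suc q)) → length (filter (crossing? τ) (triples n)) ≤ tp3 (2 + q) n
  crossing-max n τ = ≤-trans (≤-reflexive (length-crossing n τ))
    (≤-trans (esym-balanced (suc q) 1 (size (residue q n))
                (λ i j → ≤-trans (proj₂ (size-bounds n i)) (s≤s (proj₁ (size-bounds n j)))) _ (size τ) ≤-refl
                (trans (∑-size τ) (sym (∑-size (residue q n)))))
             (≤-reflexive (sym (tp3-esym q n))))

esym₁ : ∀ q (a : Fin q → ℕ) → esym q 1 a ≡ ∑ a
esym₁ zero    a = sym (∑-nil a)
esym₁ (suc q) a = trans (cong₂ _+_ (esym₁ q (a ∘ suc)) (*-identityʳ (a zero))) (trans (+-comm _ (a zero)) (sym (∑-suc a)))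

-- Twice the second symmetric polynomial is q (q - 1) f^2; the subtracted term has been moved to the
-- left.
esym₂-const : ∀ q f → 2 * esym q 2 (λ _ → f) + q * (f * f) ≡ q * q * (f * f)
esym₂-const zero    f = refl
esym₂-const (suc q) f = begin
  2 * (esym q 2 (λ _ → f) + f * esym q 1 (λ _ → f)) + suc q * (f * f)
    ≡⟨ cong (λ x → 2 * (esym q 2 (λ _ → f) + f * x) + suc q * (f * f)) (trans (esym₁ q _) (∑-const q f)) ⟩
  2 * (esym q 2 (λ _ → f) + f * (q * f)) + suc q * (f * f)
    ≡⟨ eq₁ (esym q 2 (λ _ → f)) q f ⟩
  2 * esym q 2 (λ _ → f) + q * (f * f) + (2 * q + 1) * (f * f)
    ≡⟨ cong (_+ (2 * q + 1) * (f * f)) (esym₂-const q f) ⟩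
  q * q * (f * f) + (2 * q + 1) * (f * f)
    ≡⟨ eq₂ q f ⟩
  suc q * suc q * (f * f) ∎
  where
  open ≡-Reasoning
  eq₁ : ∀ e q f → 2 * (e + f * (q * f)) + suc q * (f * f) ≡ 2 * e + q * (f * f) + (2 * q + 1) * (f * f)
  eq₁ = solve-∀
  eq₂ : ∀ q f → q * q * (f * f) + (2 * q + 1) * (f * f) ≡ suc q * suc q * (f * f)
  eq₂ = solve-∀

esym₂-drop-const : ∀ q f (i : Fin (2 + q)) → 2 * esym (2 + q) 2 (drop i (λ _ → f)) ≡ (1 + q) * q * (f * f)
esym₂-drop-const q f i = +-cancelʳ-≡ (2 * (f * ((1 + q) * f)) + (2 + q) * (f * f)) _ _ (begin
  2 * E₂ + (2 * (f * ((1 + q) * f)) + (2 + q) * (f * f))  ≡⟨ cong (λ x → 2 * E₂ + (2 * (f * x) + (2 + q) * (f * f))) (sym e₁) ⟩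
  2 * E₂ + (2 * (f * E₁) + (2 + q) * (f * f))             ≡⟨ eq₁ E₂ E₁ q f ⟩
  2 * (E₂ + f * E₁) + (2 + q) * (f * f)                   ≡⟨ cong (λ x → 2 * x + (2 + q) * (f * f)) (sym (esym-affine (2 + q) 1 i (λ _ → f))) ⟩
  2 * esym (2 + q) 2 (λ _ → f) + (2 + q) * (f * f)        ≡⟨ esym₂-const (2 + q) f ⟩
  (2 + q) * (2 + q) * (f * f)                             ≡⟨ eq₂ q f ⟩
  (1 + q) * q * (f * f) + (2 * (f * ((1 + q) * f)) + (2 + q) * (f * f)) ∎)
  where
  open ≡-Reasoning
  E₁ = esym (2 + q) 1 (drop i (λ _ → f))
  E₂ = esym (2 + q) 2 (drop i (λ _ → f))
  e₁ : E₁ ≡ (1 + q) * f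
  e₁ = +-cancelʳ-≡ (f * 1) _ _ (trans (sym (esym-affine (2 + q) 0 i (λ _ → f)))
    (trans (esym₁ (2 + q) (λ _ → f)) (trans (∑-const (2 + q) f) (split q f))))
    where
    split : ∀ q f → (2 + q) * f ≡ (1 + q) * f + f * 1
    split = solve-∀
  eq₁ : ∀ E₂ E₁ q f → 2 * E₂ + (2 * (f * E₁) + (2 + q) * (f * f)) ≡ 2 * (E₂ + f * E₁) + (2 + q) * (f * f)
  eq₁ = solve-∀
  eq₂ : ∀ q f → (2 + q) * (2 + q) * (f * f) ≡ (1 + q) * q * (f * f) + (2 * (f * ((1 + q) * f)) + (2 + q) * (f * f))
  eq₂ = solve-∀

-- A new vertex in class `c` forms a crossing triple with every pair from two of the other `1 + q`
-- classes, and each class has at least `n / (2 + q)` vertices.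
tp3-growth : ∀ q n → 2 * tp3 (3 + q) n + (1 + q) * q * (n / (2 + q) * (n / (2 + q))) ≤ 2 * tp3 (3 + q) (suc n)
tp3-growth q n = begin
  2 * tp3 (3 + q) n + (1 + q) * q * (f * f)               ≡⟨ cong₂ (λ x y → 2 * x + y) (tp3-esym (suc q) n) (sym (esym₂-drop-const q f c)) ⟩
  2 * esym Q 3 s + 2 * esym Q 2 (drop c (λ _ → f))        ≤⟨ +-monoʳ-≤ (2 * esym Q 3 s) (*-monoʳ-≤ 2 (esym-mono Q 2 floor)) ⟩
  2 * esym Q 3 s + 2 * esym Q 2 (drop c s)                ≡⟨ sym (*-distribˡ-+ 2 (esym Q 3 s) _) ⟩
  2 * (esym Q 3 s + esym Q 2 (drop c s))                  ≡⟨ cong (λ x → 2 * (x + esym Q 2 (drop c s))) (esym-affine Q 2 c s) ⟩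
  2 * (esym Q 3 (drop c s) + s c * esym Q 2 (drop c s) + esym Q 2 (drop c s))
                                                          ≡⟨ cong (2 *_) (collect (esym Q 3 (drop c s)) (s c) (esym Q 2 (drop c s))) ⟩
  2 * (esym Q 3 (drop c s) + suc (s c) * esym Q 2 (drop c s))
    ≡⟨ cong (2 *_) (sym (trans (esym-affine Q 2 c s′) (cong₂ _+_ (esym-cong Q 3 same)
         (cong₂ _*_ (trans (grow c) (trans (cong (λ b → s c + 𝟙 b) (≐-refl c)) (+-comm (s c) 1))) (esym-cong Q 2 same))))) ⟩
  2 * esym Q 3 s′                                         ≡⟨ cong (2 *_) (sym (tp3-esym (suc q) (suc n))) ⟩
  2 * tp3 (3 + q) (suc n)                                 ∎
  where
  open ≤-Reasoning
  open Residues (suc q)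
  Q = 2 + q
  f = n / Q
  s s′ : Fin Q → ℕ
  s = size (residue (suc q) n)
  s′ = size (residue (suc q) (suc n))
  c : Fin Q
  c = fromℕ< (m%n<n n Q)
  grow : ∀ t → s′ t ≡ s t + 𝟙 (c ≐ t)
  grow t = trans (size≡count (suc n) t) (trans (∑-last n (λ i → class i t)) (cong₂ _+_ (sym (size≡count n t))
    (cong 𝟙 (does-iff (λ e → Finₚ.toℕ-injective (trans (Finₚ.toℕ-fromℕ< _) e))
      (λ e → trans (sym (Finₚ.toℕ-fromℕ< _)) (cong toℕ e)) (n % Q ≟ℕ toℕ t) (c ≟ t)))))
  same : ∀ t → drop c s′ t ≡ drop c s t
  same t with c ≟ t | grow t
  ... | yes _ | _ = refl
  ... | no ne | g = trans g (+-identityʳ _)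
  floor : ∀ t → drop c (λ _ → f) t ≤ drop c s t
  floor t with c ≟ t
  ... | yes _ = z≤n
  ... | no _  = proj₁ (size-bounds n t)
  collect : ∀ A x B → A + x * B + B ≡ A + suc x * B
  collect = solve-∀

-- Triples and families of representatives

∣∪∣≤ : ∀ {n} (s t : Subset n) → ∣ s ∪ t ∣ ≤ ∣ s ∣ + ∣ t ∣
∣∪∣≤ [] [] = z≤n
∣∪∣≤ (true  ∷ s) (true  ∷ t) = s≤s (≤-trans (∣∪∣≤ s t) (+-monoʳ-≤ ∣ s ∣ (n≤1+n ∣ t ∣)))
∣∪∣≤ (true  ∷ s) (false ∷ t) = s≤s (∣∪∣≤ s t)
∣∪∣≤ (false ∷ s) (true  ∷ t) = ≤-trans (s≤s (∣∪∣≤ s t)) (≤-reflexive (sym (+-suc ∣ s ∣ ∣ t ∣)))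
∣∪∣≤ (false ∷ s) (false ∷ t) = ∣∪∣≤ s t

empty-subset : ∀ {n} (s : Subset n) → ∣ s ∣ ≡ 0 → s ≡ ⊥ˢ
empty-subset [] _ = refl
empty-subset (false ∷ s) e = cong (false ∷_) (empty-subset s e)

extract : ∀ {n} (s : Subset n) w → lookup s w ≡ true → ∃ λ s′ → s ≡ ⁅ w ⁆ ∪ s′ × ∣ s ∣ ≡ suc ∣ s′ ∣
extract (true ∷ s) zero _ = false ∷ s , cong (true ∷_) (sym (Subₚ.∪-identityˡ s)) , refl
extract (b ∷ s) (suc w) e with extract s w e
... | s′ , eq , c = b ∷ s′ , cong (b ∷_) eq , trans (∣∷∣ b s) (trans (cong (𝟙 b +_) c) (trans (+-suc (𝟙 b) ∣ s′ ∣) (cong suc (sym (∣∷∣ b s′)))))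

member : ∀ {n} (s : Subset n) {k} → ∣ s ∣ ≡ suc k → ∃ λ w → lookup s w ≡ true
member (true ∷ s)  _ = zero , refl
member (false ∷ s) e = let w , p = member s e in suc w , p

extract-any : ∀ {n} (s : Subset n) {k} → ∣ s ∣ ≡ suc k → ∃ λ w → ∃ λ s′ → lookup s w ≡ true × s ≡ ⁅ w ⁆ ∪ s′ × ∣ s′ ∣ ≡ k
extract-any s e with member s e
... | w , p with extract s w p
...   | s′ , eq , c = w , s′ , p , eq , suc-injective (trans (sym c) e)

pair-from : ∀ {n} (s : Subset n) w → lookup s w ≡ true → ∣ s ∣ ≡ 3 → ∃ λ x → ∃ λ y → s ≡ tri w x y
pair-from s w p e with extract s w p
... | s₁ , eq₁ , c₁ with extract-any s₁ (suc-injective (trans (sym c₁) e))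
...   | x , s₂ , _ , eq₂ , c₂ with extract-any s₂ c₂
...     | y , s₃ , _ , eq₃ , c₃ = x , y , trans eq₁ (cong (⁅ w ⁆ ∪_) (trans eq₂ (cong (⁅ x ⁆ ∪_)
            (trans eq₃ (trans (cong (⁅ y ⁆ ∪_) (empty-subset s₃ c₃)) (Subₚ.∪-identityʳ ⁅ y ⁆))))))

tri-distinct : ∀ {n} (x y z : Fin n) → ∣ tri x y z ∣ ≡ 3 → x ≢ y × x ≢ z × y ≢ z
tri-distinct x y z e = first x y z e ,
  first x z y (trans (cong ∣_∣ (sym (tri-swap′ x y z))) e) ,
  first y z x (trans (cong ∣_∣ (sym (trans (tri-swap x y z) (tri-swap′ y x z)))) e)
  where
  first : ∀ x y z → ∣ tri x y z ∣ ≡ 3 → x ≢ y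
  first x .x z e refl = <⇒≱ {2} {3} ≤-refl (≤-trans (≤-reflexive (sym e))
    (≤-trans (≤-reflexive (cong ∣_∣ (trans (sym (Subₚ.∪-assoc ⁅ x ⁆ ⁅ x ⁆ ⁅ z ⁆)) (cong (_∪ ⁅ z ⁆) (Subₚ.∪-idem ⁅ x ⁆)))))
      (≤-trans (∣∪∣≤ ⁅ x ⁆ ⁅ z ⁆) (≤-reflexive (cong₂ _+_ (Subₚ.∣⁅x⁆∣≡1 x) (Subₚ.∣⁅x⁆∣≡1 z))))))

∈-tri : ∀ {n} (x y z w : Fin n) → w ∈ˢ tri x y z → w ≡ x ⊎ w ≡ y ⊎ w ≡ z
∈-tri x y z w p with Subₚ.x∈p∪q⁻ ⁅ x ⁆ _ p
... | inj₁ q = inj₁ (Subₚ.x∈⁅y⁆⇒x≡y x q)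
... | inj₂ q with Subₚ.x∈p∪q⁻ ⁅ y ⁆ _ q
...   | inj₁ r = inj₂ (inj₁ (Subₚ.x∈⁅y⁆⇒x≡y y r))
...   | inj₂ r = inj₂ (inj₂ (Subₚ.x∈⁅y⁆⇒x≡y z r))

tri-third : ∀ {n} (x y z z′ : Fin n) → x ≢ z → y ≢ z → tri x y z ≡ tri x y z′ → z ≡ z′
tri-third x y z z′ xz yz e with ∈-tri x y z′ z (subst (z ∈ˢ_) e
      (Subₚ.x∈p∪q⁺ (inj₂ (Subₚ.x∈p∪q⁺ {p = ⁅ y ⁆} (inj₂ (Subₚ.x∈⁅x⁆ z))))))
... | inj₁ p = ⊥-elim (xz (sym p))
... | inj₂ (inj₁ p) = ⊥-elim (yz (sym p))
... | inj₂ (inj₂ p) = p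

_≟ˢ_ : ∀ {n} (s t : Subset n) → Dec (s ≡ t)
_≟ˢ_ = Vecₚ.≡-dec _≟ᴮ_

opaque
  _∈¿_ : ∀ {n} (s : Subset n) R → Dec (s ∈ R)
  s ∈¿ R = Any.any? (s ≟ˢ_) R

unique-map-injective : ∀ {A B : Set} (f : A → B) {xs} → Unique (map f xs) → ∀ {x y} → x ∈ xs → y ∈ xs → f x ≡ f y → x ≡ y
unique-map-injective f (_ ∷ u) (here refl) (here refl) e = refl
unique-map-injective f (a ∷ u) (here refl) (there q) e = ⊥-elim (All.lookup a (∈ₚ.∈-map⁺ f q) e)
unique-map-injective f (a ∷ u) (there p) (here refl) e = ⊥-elim (All.lookup a (∈ₚ.∈-map⁺ f p) (sym e))
unique-map-injective f (a ∷ u) (there p) (there q) e = unique-map-injective f u p q e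

unique-filter-map : ∀ {A B : Set} (f : A → B) {P : A → Set} (P? : ∀ x → Dec (P x)) xs → Unique (map f xs) → Unique (map f (filter P? xs))
unique-filter-map f P? [] u = u
unique-filter-map f P? (x ∷ xs) (a ∷ u) with does (P? x)
... | true  = Allₚ.map⁺ (Allₚ.filter⁺ P? (Allₚ.map⁻ a)) ∷ unique-filter-map f P? xs u
... | false = unique-filter-map f P? xs u

length-filter-split : ∀ {A : Set} {P : A → Set} (P? : ∀ x → Dec (P x)) xs →
                      length xs ≡ length (filter P? xs) + length (filter (¬? ∘ P?) xs)
length-filter-split P? [] = refl
length-filter-split P? (x ∷ xs) with does (P? x)
... | true  = cong suc (length-filter-split P? xs)
... | false = trans (cong suc (length-filter-split P? xs)) (sym (+-suc _ _))

unique-⊆⇒length≤ : ∀ {A : Set} {xs ys : List A} → Unique xs → (∀ {x} → x ∈ xs → x ∈ ys) → length xs ≤ length ys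
unique-⊆⇒length≤ {xs = []} _ _ = z≤n
unique-⊆⇒length≤ {xs = x ∷ xs} (a ∷ u) sub with ∈ₚ.∈-∃++ (sub (here refl))
... | as , bs , refl = ≤-trans (s≤s (unique-⊆⇒length≤ u sub′)) (≤-reflexive (trans (cong suc (Listₚ.length-++ as))
        (trans (sym (+-suc (length as) (length bs))) (sym (Listₚ.length-++ as)))))
  where
  sub′ : ∀ {y} → y ∈ xs → y ∈ as ++ bs
  sub′ {y} y∈ with ∈ₚ.∈-++⁻ as (sub (there y∈))
  ... | inj₁ p = ∈ₚ.∈-++⁺ˡ p
  ... | inj₂ (here refl) = ⊥-elim (All.lookup a y∈ refl)
  ... | inj₂ (there p) = ∈ₚ.∈-++⁺ʳ as p

-- Triples of pairwise different colours. Not every colour has to be represented, so the notion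
-- passes to sublists, in particular to the triples that avoid a vertex.
record Representatives {n} (κ : Subset n → ℕ) (R : List (Subset n)) : Set where
  constructor representatives
  field
    sizes  : All (λ s → ∣ s ∣ ≡ 3) R
    rainbow : Unique (map κ R)

contains? : ∀ {n} (w : Fin n) (s : Subset n) → Dec (lookup s w ≡ true)
contains? w s = lookup s w ≟ᴮ true

module Family {n : ℕ} {κ : Subset n → ℕ} {R : List (Subset n)} (reps : Representatives κ R) where

  G : Fin n → Fin n → Fin n → Bool
  G x y z = does (tri x y z ∈¿ R)

  G∈ : ∀ {x y z} → G x y z ≡ true → tri x y z ∈ R
  G∈ {x} {y} {z} = does⇒ (tri x y z ∈¿ R)

  G-distinct : ∀ {x y z} → G x y z ≡ true → x ≢ y × x ≢ z × y ≢ z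
  G-distinct {x} {y} {z} g = tri-distinct x y z (All.lookup (Representatives.sizes reps) (G∈ g))

  G-swap : ∀ x y z → G x y z ≡ G y x z
  G-swap x y z = cong (λ s → does (s ∈¿ R)) (tri-swap x y z)

  G-swap′ : ∀ x y z → G x y z ≡ G x z y
  G-swap′ x y z = cong (λ s → does (s ∈¿ R)) (tri-swap′ x y z)

  G-rotate : ∀ x y z → G x y z ≡ G y z x
  G-rotate x y z = trans (G-swap x y z) (G-swap′ y x z)

  colour-injective : ∀ {s t} → s ∈ R → t ∈ R → κ s ≡ κ t → s ≡ t
  colour-injective = unique-map-injective κ (Representatives.rainbow reps)

  -- Different triples of `R` have different colours; this is why a large codegree offers many
  -- colours at a pair.
  G-third : ∀ {x y z z′} → G x y z ≡ true → G x y z′ ≡ true → κ (tri x y z) ≡ κ (tri x y z′) → z ≡ z′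
  G-third g g′ e = let _ , xz , yz = G-distinct g in tri-third _ _ _ _ xz yz (colour-injective (G∈ g) (G∈ g′) e)

  codegree : Fin n → Fin n → ℕ
  codegree x y = card (G x y)

  -- Ordered pairs are counted, hence twice the degree of `w` in `R`.
  link : Fin n → ℕ
  link w = ∑ λ x → ∑ λ y → 𝟙 (G w x y)

  private
    pairs : Fin n → List (Subset n) → ℕ
    pairs w S = ∑ λ x → ∑ λ y → 𝟙 (does (tri w x y ∈¿ S))

    one-triple : ∀ w s → lookup s w ≡ true → ∣ s ∣ ≡ 3 → 2 ≤ ∑ λ x → ∑ λ y → 𝟙 (does (tri w x y ≟ˢ s))
    one-triple w s p e with pair-from s w p e
    ... | x₀ , y₀ , refl = ≤-trans (≤-reflexive (sym total)) (∑-mono λ x → ∑-mono λ y → pw x y)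
      where
      point : ∀ (a b : Fin n) → ∑ (λ x → ∑ (λ y → 𝟙 (a ≐ x) * 𝟙 (b ≐ y))) ≡ 1
      point a b = trans (∑-cong λ x → trans (∑-*ˡ (𝟙 (a ≐ x)) _) (cong (𝟙 (a ≐ x) *_) (card-point b))) (∑-point (λ _ → 1) a)
      total : ∑ (λ x → ∑ (λ y → 𝟙 (x₀ ≐ x) * 𝟙 (y₀ ≐ y) + 𝟙 (y₀ ≐ x) * 𝟙 (x₀ ≐ y))) ≡ 2
      total = trans (∑-cong λ x → ∑-+ _ _) (trans (∑-+ _ _) (cong₂ _+_ (point x₀ y₀) (point y₀ x₀)))
      x₀≢y₀ : x₀ ≢ y₀
      x₀≢y₀ = proj₂ (proj₂ (tri-distinct w x₀ y₀ e))
      pw : ∀ x y → 𝟙 (x₀ ≐ x) * 𝟙 (y₀ ≐ y) + 𝟙 (y₀ ≐ x) * 𝟙 (x₀ ≐ y) ≤ 𝟙 (does (tri w x y ≟ˢ tri w x₀ y₀))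
      pw x y with x₀ ≟ x | y₀ ≟ x
      ... | yes refl | yes q = ⊥-elim (x₀≢y₀ (sym q))
      ... | no _ | no _ = z≤n
      pw x y | yes refl | no _ with y₀ ≟ y
      ... | yes refl = ≤-reflexive (cong 𝟙 (sym (dec-true (tri w x₀ y₀ ≟ˢ tri w x₀ y₀) refl)))
      ... | no _ = z≤n
      pw x y | no _ | yes refl with x₀ ≟ y
      ... | yes refl = ≤-reflexive (cong 𝟙 (sym (dec-true (tri w y₀ x₀ ≟ˢ tri w x₀ y₀) (tri-swap′ w y₀ x₀))))
      ... | no _ = z≤n

    pairs≥ : ∀ w S → Unique S → All (λ s → lookup s w ≡ true × ∣ s ∣ ≡ 3) S → 2 * length S ≤ pairs w S
    pairs≥ w [] _ _ = z≤n
    pairs≥ w (s ∷ S) (a ∷ u) ((p , e) ∷ al) = ≤-trans (≤-reflexive (*-suc 2 (length S)))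
      (≤-trans (+-mono-≤ (one-triple w s p e) (pairs≥ w S u al))
      (≤-trans (≤-reflexive (sym (trans (∑-cong λ x → ∑-+ _ _) (∑-+ _ _)))) (∑-mono λ x → ∑-mono λ y → pw (tri w x y))))
      where
      pw : ∀ t → 𝟙 (does (t ≟ˢ s)) + 𝟙 (does (t ∈¿ S)) ≤ 𝟙 (does (t ∈¿ (s ∷ S)))
      pw t with t ≟ˢ s | t ∈¿ S
      ... | yes refl | yes q = ⊥-elim (All.lookup a q refl)
      ... | yes refl | no _  = ≤-reflexive (cong 𝟙 (sym (dec-true (t ∈¿ (s ∷ S)) (here refl))))
      ... | no _     | yes q = ≤-reflexive (cong 𝟙 (sym (dec-true (t ∈¿ (s ∷ S)) (there q))))
      ... | no _     | no _  = z≤n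

  link≥ : ∀ w → 2 * length (filter (contains? w) R) ≤ link w
  link≥ w = ≤-trans (pairs≥ w S (Uniqueₚ.filter⁺ (contains? w) (Uniqueₚ.map⁻ (Representatives.rainbow reps)))
      (All.zip (Allₚ.all-filter (contains? w) R , Allₚ.filter⁺ (contains? w) (Representatives.sizes reps))))
    (∑-mono λ x → ∑-mono λ y → 𝟙-mono λ q → dec-true (tri w x y ∈¿ R) (proj₁ (∈ₚ.∈-filter⁻ (contains? w) {xs = R} (does⇒ (tri w x y ∈¿ S) q))))
    where
    S = filter (contains? w) R

-- Deleting a vertex

∣insertAt∣ : ∀ {n} (s : Subset n) w → ∣ Vec.insertAt s w false ∣ ≡ ∣ s ∣
∣insertAt∣ s zero = refl
∣insertAt∣ (b ∷ s) (suc w) = trans (∣∷∣ b (Vec.insertAt s w false)) (trans (cong (𝟙 b +_) (∣insertAt∣ s w)) (sym (∣∷∣ b s)))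

insertAt-∪ : ∀ {n} (s t : Subset n) w → Vec.insertAt (s ∪ t) w false ≡ Vec.insertAt s w false ∪ Vec.insertAt t w false
insertAt-∪ s t zero = refl
insertAt-∪ (b ∷ s) (c ∷ t) (suc w) = cong (_ ∷_) (insertAt-∪ s t w)

insertAt-⊥ : ∀ {n} (w : Fin (suc n)) → Vec.insertAt (⊥ˢ {n}) w false ≡ ⊥ˢ
insertAt-⊥ zero = refl
insertAt-⊥ {suc n} (suc w) = cong (false ∷_) (insertAt-⊥ w)

insertAt-point : ∀ {n} (x : Fin n) w → Vec.insertAt ⁅ x ⁆ w false ≡ ⁅ punchIn w x ⁆
insertAt-point x zero = refl
insertAt-point zero (suc w) = cong (true ∷_) (insertAt-⊥ w)
insertAt-point (suc x) (suc w) = cong (false ∷_) (insertAt-point x w)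

insertAt-tri : ∀ {n} (x y z : Fin n) w → Vec.insertAt (tri x y z) w false ≡ tri (punchIn w x) (punchIn w y) (punchIn w z)
insertAt-tri x y z w = trans (insertAt-∪ ⁅ x ⁆ _ w) (cong₂ _∪_ (insertAt-point x w)
  (trans (insertAt-∪ ⁅ y ⁆ _ w) (cong₂ _∪_ (insertAt-point y w) (insertAt-point z w))))

restrict : ∀ {n} → Fin (suc n) → (Subset (suc n) → ℕ) → Subset n → ℕ
restrict w κ s = κ (Vec.insertAt s w false)

restrict-rainbow : ∀ {n} w (κ : Subset (suc n) → ℕ) H → HasRainbowCopy (restrict w κ) H → HasRainbowCopy κ H
restrict-rainbow w κ H (φ , inj , dist) = punchIn w ∘ φ , (λ e → inj (Finₚ.punchIn-injective w _ _ e)) ,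
  λ i j ne e → dist i j ne (trans (at i) (trans e (sym (at j))))
  where
  at : ∀ i → restrict w κ (img3 φ (Graph3.edge H i)) ≡ κ (img3 (punchIn w ∘ φ) (Graph3.edge H i))
  at i = cong κ (insertAt-tri _ _ _ w)

restrict-reps : ∀ {n} w {κ : Subset (suc n) → ℕ} {R} → Representatives κ R →
  Representatives (restrict w κ) (map (λ s → Vec.removeAt s w) (filter (¬? ∘ contains? w) R))
restrict-reps w {κ} {R} (representatives sizes rainbow) = representatives
  (Allₚ.map⁺ (All.map (λ { {s} (p , e) → trans (sym (∣insertAt∣ (Vec.removeAt s w) w)) (trans (cong ∣_∣ (back s p)) e) }) avoiding))
  (subst Unique (colours R′ (All.map proj₁ avoiding)) (unique-filter-map κ (¬? ∘ contains? w) R rainbow))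
  where
  R′ = filter (¬? ∘ contains? w) R
  avoiding : All (λ s → ¬ (lookup s w ≡ true) × ∣ s ∣ ≡ 3) R′
  avoiding = All.zip (Allₚ.all-filter (¬? ∘ contains? w) R , Allₚ.filter⁺ (¬? ∘ contains? w) sizes)
  back : ∀ s → ¬ (lookup s w ≡ true) → Vec.insertAt (Vec.removeAt s w) w false ≡ s
  back s p = subst (λ b → Vec.insertAt (Vec.removeAt s w) w b ≡ s) (≢true p) (Vecₚ.insertAt-removeAt s w)
  colours : ∀ S → All (λ s → ¬ (lookup s w ≡ true)) S → map κ S ≡ map (restrict w κ) (map (λ s → Vec.removeAt s w) S)
  colours [] [] = refl
  colours (s ∷ S) (p ∷ al) = cong₂ _∷_ (cong κ (sym (back s p))) (colours S al)

-- Pairs of large codegree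

record Critical (F : Graph) (q : ℕ) : Set where
  open Graph F
  field
    e₁ e₂  : Fin k
    e₁≢e₂  : e₁ ≢ e₂
    π₀     : Fin m → Fin q
    proper : ∀ i → i ≢ e₁ → i ≢ e₂ → π₀ (u F i) ≢ π₀ (v F i)
    mono₁  : π₀ (u F e₁) ≡ π₀ (v F e₁)
    mono₂  : π₀ (u F e₂) ≡ π₀ (v F e₂)

pickType : ∀ {n q} → (Fin q → Fin n → Bool) → Fin n → Maybe (Fin q)
pickType T x with any¿ (λ i → T i x ≟ᴮ true)
... | yes (i , _) = just i
... | no _        = nothing

pickType-sound : ∀ {n q} (T : Fin q → Fin n → Bool) x i → pickType T x ≡ just i → T i x ≡ true
pickType-sound T x i e with any¿ (λ i → T i x ≟ᴮ true)
pickType-sound T x i refl | yes (.i , p) = p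

pickType-complete : ∀ {n q} (T : Fin q → Fin n → Bool) → (∀ x i j → T i x ≡ true → T j x ≡ true → i ≡ j) →
                    ∀ x i → T i x ≡ true → pickType T x ≡ just i
pickType-complete T uniq x i p with any¿ (λ i → T i x ≟ᴮ true)
... | yes (j , q) = cong just (uniq x j i q p)
... | no none = ⊥-elim (none (i , p))

module Fat (F : Graph) {n : ℕ} {κ : Subset n → ℕ} {R : List (Subset n)} (reps : Representatives κ R) where
  open Graph F using (m; k)
  open Family reps public
  open Embedding F κ public

  -- Each of the `m + k` forbidden vertices and `m + k` forbidden colours of `Extensible` rules out
  -- at most one third vertex of a triple in `R`; one more is then left.
  threshold : ℕ
  threshold = suc (m + k + (m + k))

  J : Fin n → Fin n → Bool
  J x y = does (threshold ≤¿ codegree x y)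

  J-fat : ∀ {x y} → J x y ≡ true → threshold ≤ codegree x y
  J-fat {x} {y} = does⇒ (threshold ≤¿ codegree x y)

  J-thin : ∀ {x y} → J x y ≡ false → codegree x y ≤ threshold
  J-thin {x} {y} e = <⇒≤ (≰⇒> (does⇒¬ (threshold ≤¿ codegree x y) e))

  J-sym : Symmetric J
  J-sym x y = cong (λ c → does (threshold ≤¿ c)) (∑-cong λ z → cong 𝟙 (G-swap x y z))

  J-irr : Irreflexive J
  J-irr x = ≢true λ p → let z , g = card-pos (G x x) (≤-trans (s≤s z≤n) (J-fat p)) in proj₁ (G-distinct g) refl

  J-extensible : ∀ {x y} → J x y ≡ true → Extensible x y
  J-extensible {x} {y} p X Cs lX lC = z , z∉X , z∉C
    where
    B₁ B₂ : List (Fin n → Bool)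
    B₁ = map _≐_ X
    B₂ = map (λ c z → does (κ (tri x y z) ≟ℕ c)) Cs
    bound₁ : ∀ v → card (λ z → G x y z ∧ (v ≐ z)) ≤ 1
    bound₁ v = ≤-trans (card-mono λ z q → proj₂ (∧-true {G x y z} q)) (≤-reflexive (card-point v))
    bound₂ : ∀ c → card (λ z → G x y z ∧ does (κ (tri x y z) ≟ℕ c)) ≤ 1
    bound₂ c = ∑-≤1 _ (λ z → 𝟙≤1 _) λ z z′ q q′ → let g , e = ∧-true {G x y z} (pos _ q) ; g′ , e′ = ∧-true {G x y z′} (pos _ q′) in
      G-third g g′ (trans (does⇒ (κ (tri x y z) ≟ℕ c) e) (sym (does⇒ (κ (tri x y z′) ≟ℕ c) e′)))
      where
      pos : ∀ b → 0 < 𝟙 b → b ≡ true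
      pos true _ = refl
    found : ∃ λ z → G x y z ≡ true × All (λ B → B z ≡ false) (B₁ ++ B₂)
    found = avoid (G x y) 1 (B₁ ++ B₂) (Allₚ.++⁺ (Allₚ.map⁺ (All.universal bound₁ X)) (Allₚ.map⁺ (All.universal bound₂ Cs)))
      (≤-trans (s≤s (≤-trans (≤-reflexive (trans (*-identityʳ _) (trans (Listₚ.length-++ B₁) (cong₂ _+_ (Listₚ.length-map _ X) (Listₚ.length-map _ Cs)))))
        (+-mono-≤ lX lC))) (J-fat p))
    z = proj₁ found
    z∉X : z ∉ X
    z∉X z∈ = ≐-false {x = z} {z} (All.lookup (Allₚ.map⁻ (Allₚ.++⁻ˡ B₁ (proj₂ (proj₂ found)))) z∈) refl
    z∉C : κ (tri x y z) ∉ Cs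
    z∉C c∈ = does⇒¬ (κ (tri x y z) ≟ℕ κ (tri x y z)) (All.lookup (Allₚ.map⁻ (Allₚ.++⁻ʳ B₁ (proj₂ (proj₂ found)))) c∈) refl

  -- A vertex of `X` rules out at most one candidate by being equal to it and at most `e` by not
  -- being adjacent to it, whence `(R + R) * e`. Candidates are enumerated by `c` so that both the
  -- parts of a blowup and plain sets of vertices can serve.
  robust-by : ∀ {q N} (τ : Fin n → Maybe (Fin q)) R (c : Fin q → Fin N → Fin n) (A : Fin q → Fin N → Bool) e → 1 ≤ e →
    (∀ j → Injective _≡_ _≡_ (c j)) → (∀ j t → A j t ≡ true → τ (c j t) ≡ just j) →
    (∀ j x i → τ x ≡ just i → i ≢ j → card (λ t → A j t ∧ not (J x (c j t))) ≤ e) →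
    (∀ j → (R + R) * e < card (A j)) → Typed.Robust J τ R
  robust-by {q} {N} τ R c A e e≥1 inj typed miss large j X lX =
    c j t , typed j t (proj₁ (proj₂ found)) , c∉X , adjacent
    where
    blocks : Maybe (Fin q) → Fin n → Fin N → Bool
    blocks nothing  x t = false
    blocks (just i) x t = not (i ≐ j) ∧ not (J x (c j t))
    B₁ B₂ : List (Fin N → Bool)
    B₁ = map (λ x t → x ≐ c j t) X
    B₂ = map (λ x → blocks (τ x) x) X
    bound₁ : ∀ x → card (λ t → A j t ∧ (x ≐ c j t)) ≤ e
    bound₁ x = ≤-trans (∑-≤1 _ (λ t → 𝟙≤1 _) λ t t′ p p′ → inj j (trans (sym (hit t p)) (hit t′ p′))) e≥1
      where
      hit : ∀ t → 0 < 𝟙 (A j t ∧ (x ≐ c j t)) → x ≡ c j t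
      hit t p with A j t
      ... | true with x ≟ c j t
      ...   | yes eq = eq
    none : ∀ {P : Fin N → Bool} → (∀ t → P t ≡ false) → card P ≤ e
    none h = ≤-trans (≤-reflexive (∑-zero λ t → cong 𝟙 (h t))) z≤n
    bound₂ : ∀ x → card (λ t → A j t ∧ blocks (τ x) x t) ≤ e
    bound₂ x with τ x in eq
    ... | nothing = none λ t → ≢true λ p → case proj₂ (∧-true {A j t} p) of λ ()
    ... | just i with i ≟ j
    ...   | yes _ = none λ t → ≢true λ p → case proj₂ (∧-true {A j t} p) of λ ()
    ...   | no ne = miss j x i eq ne
    found : ∃ λ t → A j t ≡ true × All (λ B → B t ≡ false) (B₁ ++ B₂)
    found = avoid (A j) e (B₁ ++ B₂) (Allₚ.++⁺ (Allₚ.map⁺ (All.universal bound₁ X)) (Allₚ.map⁺ (All.universal bound₂ X)))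
      (≤-<-trans (*-monoˡ-≤ e (≤-trans (≤-reflexive (trans (Listₚ.length-++ B₁) (cong₂ _+_ (Listₚ.length-map _ X) (Listₚ.length-map _ X)))) (+-mono-≤ lX lX))) (large j))
    t = proj₁ found
    c∉X : c j t ∉ X
    c∉X p = ≐-false {x = c j t} {c j t} (All.lookup (Allₚ.map⁻ (Allₚ.++⁻ˡ B₁ (proj₂ (proj₂ found)))) p) refl
    adjacent : ∀ s i → s ∈ X → τ s ≡ just i → i ≢ j → J s (c j t) ≡ true
    adjacent s i s∈ eq ne with All.lookup (Allₚ.map⁻ (Allₚ.++⁻ʳ B₁ (proj₂ (proj₂ found)))) s∈
    ... | b = case-J (J s (c j t)) refl
      where
      b′ : not (J s (c j t)) ≡ false
      b′ = trans (sym (trans (cong (λ τs → blocks τs s t) eq) (cong (λ b → not b ∧ not (J s (c j t))) (≢⇒≐ ne)))) b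
      case-J : ∀ a → J s (c j t) ≡ a → J s (c j t) ≡ true
      case-J true  e = e
      case-J false e = case trans (sym b′) (cong not e) of λ ()

module Structure (F : Graph) {q : ℕ} (crit : Critical F q) {n : ℕ} {κ : Subset n → ℕ} {R : List (Subset n)}
                 (reps : Representatives κ R) (noRainbow : ¬ HasRainbowCopy κ (expansion3 F)) where
  open Graph F using (m; k)
  open Critical crit
  open Fat F reps public

  ρ : ℕ
  ρ = m + (k + 12)

  module _ (τ : Fin n → Maybe (Fin q)) (rob : Typed.Robust J τ ρ) where

    same-colour : ∀ i {x y z x′ y′ z′} → Typed.Inner J τ i x y z → Typed.Inner J τ i x′ y′ z′ → κ (tri x y z) ≡ κ (tri x′ y′ z′)
    same-colour i = Typed.Uniform.uniform J τ J-sym J-extensible noRainbow rob e₁ e₂ e₁≢e₂ π₀ proper mono₁ mono₂ i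

    -- An edge of `J` lies in two triples of `R`, which have different colours; inside a type both
    -- would have the colour fixed by `same-colour`.
    no-inner : ∀ {x y i} → τ x ≡ just i → τ y ≡ just i → J x y ≡ false
    no-inner {x} {y} {i} τx τy = ≢true contradiction′
      where
      B≥1 : 1 ≤ m + k
      B≥1 = ≤-trans (≤-trans (s≤s z≤n) (Finₚ.toℕ<n e₁)) (m≤n+m k m)
      contradiction′ : ¬ (J x y ≡ true)
      contradiction′ p with card-pos (G x y) (≤-trans (s≤s z≤n) (J-fat p))
      ... | z , g with avoid (G x y) 1 ((z ≐_) ∷ []) (≤-trans (card-mono λ w r → proj₂ (∧-true {G x y w} r)) (≤-reflexive (card-point z)) ∷ [])
                         (≤-trans (s≤s (≤-trans B≥1 (m≤m+n _ _))) (J-fat p))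
      ...   | z′ , g′ , ne ∷ [] = ≐-false ne (G-third g g′ (same-colour i (inner g) (inner g′)))
        where
        inner : ∀ {w} → G x y w ≡ true → Typed.Inner J τ i x y w
        inner g = τx , τy , G-distinct g

  σ : ℕ
  σ = suc (ρ + ρ)

  -- Otherwise w could be added to any of the types, which would create an edge inside that type.
  no-spread : ∀ {N} (T₀ : Fin q → Fin n → Bool) → (∀ x i j → T₀ i x ≡ true → T₀ j x ≡ true → i ≡ j) →
    (c : Fin q → Fin N → Fin n) (A : Fin q → Fin N → Bool) → ∀ e → 1 ≤ e → (∀ j → Injective _≡_ _≡_ (c j)) →
    (∀ j s → A j s ≡ true → T₀ j (c j s) ≡ true) →
    (∀ j x i → T₀ i x ≡ true → i ≢ j → card (λ s → A j s ∧ not (J x (c j s))) ≤ e) →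
    Fin q → ∀ w → ¬ (∀ j → (ρ + ρ) * e < card (λ s → A j s ∧ J w (c j s)))
  no-spread T₀ unique c A e e≥1 inj inT miss₀ i₀ w large = true≢false (proj₂ (∧-true {A i₀ s} Js)) (no-inner τ rob τw (typed i₀ s Js))
    where
    T : Fin q → Fin n → Bool
    T i x = if w ≐ x then i₀ ≐ i else T₀ i x
    T-unique : ∀ x i j → T i x ≡ true → T j x ≡ true → i ≡ j
    T-unique x i j p p′ with w ≟ x
    ... | yes _ = trans (sym (≐⇒≡ {x = i₀} {i} p)) (≐⇒≡ {x = i₀} {j} p′)
    ... | no _ = unique x i j p p′
    τ : Fin n → Maybe (Fin q)
    τ = pickType T
    τw : τ w ≡ just i₀
    τw = pickType-complete T T-unique w i₀ (trans (cong (λ b → if b then i₀ ≐ i₀ else T₀ i₀ w) (≐-refl w)) (≐-refl i₀))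
    typed : ∀ j s → A j s ∧ J w (c j s) ≡ true → τ (c j s) ≡ just j
    typed j s p = pickType-complete T T-unique (c j s) j (trans (cong (λ b → if b then i₀ ≐ j else T₀ j (c j s)) (≢⇒≐ w≢)) (inT j s (proj₁ (∧-true p))))
      where
      w≢ : w ≢ c j s
      w≢ e = true≢false (subst (λ z → J w z ≡ true) (sym e) (proj₂ (∧-true {A j s} p))) (J-irr w)
    T-cases : ∀ i x → T i x ≡ true → w ≡ x ⊎ T₀ i x ≡ true
    T-cases i x p with w ≟ x
    ... | yes e = inj₁ e
    ... | no _ = inj₂ p
    miss : ∀ j x i → τ x ≡ just i → i ≢ j → card (λ s → (A j s ∧ J w (c j s)) ∧ not (J x (c j s))) ≤ e
    miss j x i τx ne = case T-cases i x (pickType-sound T x i τx) of λ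
      { (inj₁ refl) → ≤-trans (≤-reflexive (∑-zero λ s → cong 𝟙 (≢true λ r →
          true≢false (proj₂ (∧-true {A j s} (proj₁ (∧-true r)))) (not-true (proj₂ (∧-true {A j s ∧ J w (c j s)} r)))))) z≤n
      ; (inj₂ p) → ≤-trans (card-mono λ s r → ∧-true⁺ (proj₁ (∧-true (proj₁ (∧-true r)))) (proj₂ (∧-true {A j s ∧ J w (c j s)} r))) (miss₀ j x i p ne) }
    rob : Typed.Robust J τ ρ
    rob = robust-by τ ρ c (λ j s → A j s ∧ J w (c j s)) e e≥1 inj typed miss large
    found : ∃ λ s → A i₀ s ∧ J w (c i₀ s) ≡ true
    found = card-pos _ (≤-trans (s≤s z≤n) (large i₀))
    s = proj₁ found
    Js : A i₀ s ∧ J w (c i₀ s) ≡ true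
    Js = proj₂ found

  -- The parts of `K` serve as types in which nothing is missing, and `σ` exceeds the `ρ + ρ`
  -- candidates that robustness may lose. In particular no neighbourhood in `J` contains a complete
  -- `q`-partite graph with parts of size `σ`, which is what Erdős-Stone is applied to.
  no-full-vertex : ∀ {t A} (K : Blowup J A q t) → Fin q → ∀ w → ¬ Blowup.Full K σ w
  no-full-vertex {t} K i₀ w full = no-spread inPart unique part (λ _ _ → true) 1 ≤-refl inj
      (λ j s _ → dec-true (any¿ (λ s′ → part j s′ ≟ part j s)) (s , refl)) miss i₀ w
      (λ j → ≤-trans (≤-reflexive (cong suc (*-identityʳ (ρ + ρ)))) (full j))
    where
    open Blowup K
    inPart : Fin q → Fin n → Bool
    inPart i x = does (any¿ (λ s → part i s ≟ x))
    unique : ∀ x i j → inPart i x ≡ true → inPart j x ≡ true → i ≡ j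
    unique x i j p p′ with does⇒ (any¿ (λ s → part i s ≟ x)) p | does⇒ (any¿ (λ s → part j s ≟ x)) p′ | i ≟ j
    ... | _ | _ | yes e = e
    ... | s , refl | s′ , e | no ne = true≢false (subst (λ z → J (part i s) z ≡ true) e (adj i j s s′ ne)) (J-irr _)
    miss : ∀ j x i → inPart i x ≡ true → i ≢ j → card (λ s → not (J x (part j s))) ≤ 1
    miss j x i p ne with does⇒ (any¿ (λ s → part i s ≟ x)) p
    ... | s₀ , refl = ≤-trans (≤-reflexive (∑-zero λ s → cong (𝟙 ∘ not) (adj i j s₀ s ne))) z≤n

-- Degrees in J

-- Since M is large, a degree below the bound would leave too few edges in the neighbourhood for the link.
degree-arith : ∀ g h n d e L b D c C → 1 ≤ g → 1 ≤ h → let Q = 2 + g ; H = h * (1 + g) ; M = 2 * H in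
  (1 + g) * g * (n * n) ≤ Q * Q * L + c * n →
  L ≤ e + 2 * (n * D) + b →
  Q * Q * ((1 + g) * M) * b ≤ n * n →
  (1 + g) * M * e ≤ (g * M + 1) * (d * d) + C * d →
  d ≤ n →
  h * h * (Q * Q * C + (1 + g) * M * (Q * Q * (2 * D) + c)) < n →
  H * n ≤ h * Q * d + n
degree-arith g@(suc g′) h@(suc h′) n d e L b D c C _ _ link≤ split thin sparse d≤n large = ≮⇒≥ absurd
  where
  Q = 2 + g
  H = h * (1 + g)
  M = 2 * H
  E = h * h * (Q * Q * C + (1 + g) * M * (Q * Q * (2 * D) + c))
  y = h * Q * d
  absurd : ¬ (y + n < H * n)
  absurd lt = <⇒≱ large (*-cancelʳ-≤ n E n {{>-nonZero (≤-<-trans z≤n large)}} (+-cancelʳ-≤ _ (n * n) (E * n) final))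
    where
    open ≤-Reasoning
    t = H * n ∸ (y + n)
    u≡ : y + n + t ≡ H * n
    u≡ = m+[n∸m]≡n (<⇒≤ lt)
    main : g * M * (H * n * (H * n)) ≤ (g * M + 1) * (y * y) + h * h * (n * n) + E * n
    main = begin
      g * M * (H * n * (H * n))                              ≡⟨ eq₁ g h M n ⟩
      (1 + g) * M * (h * h) * ((1 + g) * g * (n * n))        ≤⟨ *-monoʳ-≤ ((1 + g) * M * (h * h)) (≤-trans link≤ (+-monoˡ-≤ (c * n) (*-monoʳ-≤ (Q * Q) split))) ⟩
      (1 + g) * M * (h * h) * (Q * Q * (e + 2 * (n * D) + b) + c * n)
                                                             ≡⟨ eq₂ (1 + g) M (h * h) (Q * Q) e n D b c ⟩
      h * h * (Q * Q) * ((1 + g) * M * e) + h * h * (Q * Q * ((1 + g) * M) * b) + h * h * ((1 + g) * M * (Q * Q * (2 * D) + c)) * n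
        ≤⟨ +-monoˡ-≤ _ (+-mono-≤ (*-monoʳ-≤ (h * h * (Q * Q)) (≤-trans sparse (+-monoʳ-≤ ((g * M + 1) * (d * d)) (*-monoʳ-≤ C d≤n)))) (*-monoʳ-≤ (h * h) thin)) ⟩
      h * h * (Q * Q) * ((g * M + 1) * (d * d) + C * n) + h * h * (n * n) + h * h * ((1 + g) * M * (Q * Q * (2 * D) + c)) * n
        ≡⟨ eq₃ h Q (g * M + 1) d C n ((1 + g) * M * (Q * Q * (2 * D) + c)) ⟩
      (g * M + 1) * (y * y) + h * h * (n * n) + E * n        ∎
      where
      eq₁ : ∀ g h M n → g * M * (h * (1 + g) * n * (h * (1 + g) * n)) ≡ (1 + g) * M * (h * h) * ((1 + g) * g * (n * n))
      eq₁ = solve-∀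
      eq₂ : ∀ g M hh QQ e n D b c → g * M * hh * (QQ * (e + 2 * (n * D) + b) + c * n) ≡
            hh * QQ * (g * M * e) + hh * (QQ * (g * M) * b) + hh * (g * M * (QQ * (2 * D) + c)) * n
      eq₂ = solve-∀
      eq₃ : ∀ h Q K d C n X → h * h * (Q * Q) * (K * (d * d) + C * n) + h * h * (n * n) + h * h * X * n ≡
            K * (h * Q * d * (h * Q * d)) + h * h * (n * n) + h * h * (Q * Q * C + X) * n
      eq₃ = solve-∀
    -- The square of y ≤ H n - n, freed of subtraction.
    square : y * y + 2 * (H * n * n) ≤ H * n * (H * n) + n * n
    square = subst (λ u → y * y + 2 * (u * n) ≤ u * u + n * n) u≡ (≤-trans (m≤m+n _ (2 * (y * t) + t * t)) (≤-reflexive (eq y n t)))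
      where
      eq : ∀ y n t → y * y + 2 * ((y + n + t) * n) + (2 * (y * t) + t * t) ≡ (y + n + t) * (y + n + t) + n * n
      eq = solve-∀
    both : g * M * (H * n * (H * n)) + (g * M + 1) * (2 * (H * n * n)) ≤ (g * M + 1) * (H * n * (H * n) + n * n) + h * h * (n * n) + E * n
    both = begin
      g * M * (H * n * (H * n)) + (g * M + 1) * (2 * (H * n * n))  ≤⟨ +-monoˡ-≤ _ main ⟩
      (g * M + 1) * (y * y) + h * h * (n * n) + E * n + (g * M + 1) * (2 * (H * n * n)) ≡⟨ eq (g * M + 1) (y * y) (h * h * (n * n)) (E * n) (2 * (H * n * n)) ⟩
      (g * M + 1) * (y * y + 2 * (H * n * n)) + h * h * (n * n) + E * n ≤⟨ +-monoˡ-≤ (E * n) (+-monoˡ-≤ (h * h * (n * n)) (*-monoʳ-≤ (g * M + 1) square)) ⟩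
      (g * M + 1) * (H * n * (H * n) + n * n) + h * h * (n * n) + E * n ∎
      where
      eq : ∀ K y a b z → K * y + a + b + K * z ≡ K * (y + z) + a + b
      eq = solve-∀
    hh≤HH : h * h ≤ H * H
    hh≤HH = *-mono-≤ (m≤m*n h (1 + g)) (m≤m*n h (1 + g))
    rest : ℕ → ℕ
    rest H = g * (2 * H) * (H * n * (H * n)) + H * H * (n * n) + (g * (2 * H) + 1) * (n * n) + H * H * (n * n)
    final : n * n + rest H ≤ E * n + rest H
    final = begin
      n * n + rest H                                                        ≤⟨ expand H (*-mono-≤ {1} {h} (s≤s z≤n) (s≤s z≤n)) ⟩
      g * M * (H * n * (H * n)) + (g * M + 1) * (2 * (H * n * n))           ≤⟨ both ⟩
      (g * M + 1) * (H * n * (H * n) + n * n) + h * h * (n * n) + E * n     ≤⟨ +-monoˡ-≤ (E * n) (+-monoʳ-≤ ((g * M + 1) * (H * n * (H * n) + n * n)) (*-monoˡ-≤ (n * n) hh≤HH)) ⟩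
      (g * M + 1) * (H * n * (H * n) + n * n) + H * H * (n * n) + E * n     ≡⟨ eq g H n (E * n) ⟩
      E * n + rest H                                                        ∎
      where
      expand : ∀ H → 1 ≤ H → n * n + rest H ≤ g * (2 * H) * (H * n * (H * n)) + (g * (2 * H) + 1) * (2 * (H * n * n))
      expand (suc H′) _ = ≤-trans (m≤m+n _ ((2 * (suc g′ * (suc H′ * H′)) + 2 * (g′ * (suc H′ * suc H′)) + 2 * H′) * (n * n))) (≤-reflexive (eq′ g′ H′ n))
        where
        eq′ : ∀ g′ H′ n → let g = suc g′ ; H = suc H′ in
          n * n + (g * (2 * H) * (H * n * (H * n)) + H * H * (n * n) + (g * (2 * H) + 1) * (n * n) + H * H * (n * n))
            + (2 * (g * (H * H′)) + 2 * (g′ * (H * H)) + 2 * H′) * (n * n)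
          ≡ g * (2 * H) * (H * n * (H * n)) + (g * (2 * H) + 1) * (2 * (H * n * n))
        eq′ = solve-∀
      eq : ∀ g H n x → (g * (2 * H) + 1) * (H * n * (H * n) + n * n) + H * H * (n * n) + x ≡
           x + (g * (2 * H) * (H * n * (H * n)) + H * H * (n * n) + (g * (2 * H) + 1) * (n * n) + H * H * (n * n))
      eq = solve-∀

-- A graph with these degrees is too dense for Erdős–Stone.
global-arith : ∀ g h n a b e C → let Q = 2 + g ; H = h * (1 + g) ; M = 2 * Q in
  a + b ≡ n →
  a * (H * n) ≤ h * Q * (e + a * b) + a * n →
  (1 + g) * M * e ≤ (g * M + 1) * (a * a) + C * a →
  2 * Q ≤ h →
  h * Q * C + (1 + g) * M * (h * Q + 1) * b + b < n → ⊥
global-arith g h _ a b e C refl degrees sparse 2Q≤h large = <⇒≱ large (+-monoˡ-≤ b a≤E)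
  where
  open ≤-Reasoning
  Q = 2 + g
  H = h * (1 + g)
  M = 2 * Q
  E = h * Q * C + (1 + g) * M * (h * Q + 1) * b
  common : ℕ
  common = h * (Q * g) * M * (a * a) + h * Q * (a * a) + (1 + g) * M * (a * a)
  combined : 2 * Q * (a * a) + common ≤ E * a + common
  combined = begin
    2 * Q * (a * a) + common                                      ≡⟨ eq₁ h g Q M (a * a) ⟩
    h * (Q * g) * M * (a * a) + h * Q * (a * a) + 2 * Q * (1 + (1 + g)) * (a * a)
                                                                  ≤⟨ +-monoʳ-≤ (h * (Q * g) * M * (a * a) + h * Q * (a * a)) (*-monoˡ-≤ (a * a) (*-monoˡ-≤ Q 2Q≤h)) ⟩
    h * (Q * g) * M * (a * a) + h * Q * (a * a) + h * Q * (a * a)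
                                                                  ≤⟨ m≤m+n _ ((1 + g) * M * (H * b) * a) ⟩
    h * (Q * g) * M * (a * a) + h * Q * (a * a) + h * Q * (a * a) + (1 + g) * M * (H * b) * a
                                                                  ≡⟨ eq₂ g h a b ⟩
    (1 + g) * M * (a * (H * (a + b)))                             ≤⟨ *-monoʳ-≤ ((1 + g) * M) degrees ⟩
    (1 + g) * M * (h * Q * (e + a * b) + a * (a + b))             ≡⟨ eq₃ ((1 + g) * M) (h * Q) e a b ⟩
    h * Q * ((1 + g) * M * e) + (1 + g) * M * (h * Q * (a * b) + a * (a + b))
                                                                  ≤⟨ +-monoˡ-≤ _ (*-monoʳ-≤ (h * Q) sparse) ⟩
    h * Q * ((g * M + 1) * (a * a) + C * a) + (1 + g) * M * (h * Q * (a * b) + a * (a + b))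
                                                                  ≡⟨ eq₄ h Q g M a b C ⟩
    E * a + common                                                ∎
    where
    eq₁ : ∀ h g Q M x → 2 * Q * x + (h * (Q * g) * M * x + h * Q * x + (1 + g) * (2 * Q) * x) ≡
          h * (Q * g) * M * x + h * Q * x + 2 * Q * (1 + (1 + g)) * x
    eq₁ = solve-∀
    eq₂ : ∀ g h a b → let Q = 2 + g ; H = h * (1 + g) ; M = 2 * Q in
          h * (Q * g) * M * (a * a) + h * Q * (a * a) + h * Q * (a * a) + (1 + g) * M * (H * b) * a ≡ (1 + g) * M * (a * (H * (a + b)))
    eq₂ = solve-∀
    eq₃ : ∀ k hq e a b → k * (hq * (e + a * b) + a * (a + b)) ≡ hq * (k * e) + k * (hq * (a * b) + a * (a + b))
    eq₃ = solve-∀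
    eq₄ : ∀ h Q g M a b C → h * Q * ((g * M + 1) * (a * a) + C * a) + (1 + g) * M * (h * Q * (a * b) + a * (a + b)) ≡
          (h * Q * C + (1 + g) * M * (h * Q + 1) * b) * a + (h * (Q * g) * M * (a * a) + h * Q * (a * a) + (1 + g) * M * (a * a))
    eq₄ = solve-∀
  aa≤Ea : a * a ≤ E * a
  aa≤Ea = ≤-trans (≤-trans (≤-reflexive (sym (*-identityˡ (a * a)))) (*-monoˡ-≤ (a * a) {1} {2 * Q} (s≤s z≤n))) (+-cancelʳ-≤ common _ _ combined)
  a≤E : a ≤ E
  a≤E = cancel a aa≤Ea
    where
    cancel : ∀ a → a * a ≤ E * a → a ≤ E
    cancel zero    _ = z≤n
    cancel (suc a) p = *-cancelʳ-≤ (suc a) E (suc a) p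

-- Count the edges of `J` at the core, `S` in all, from both sides and compare with (1 + g) T n.
-- With `σ = suc s`, the upper estimate exceeds it by σ n, the lower one falls short by T n/h = σ n,
-- and each of the `α` atypical vertices costs `h`. Thus h α ≤ 2 σ n, which explains `h = σ * M`.
typical-arith : ∀ g s M h T n S α → let Q = 2 + g in 1 ≤ M → h ≡ suc s * M → T ≡ suc s * h →
  S + h * α ≤ n * ((1 + g) * T + suc s) →
  Q * T * (h * (1 + g) * n) ≤ h * Q * S + Q * T * n →
  M * α ≤ 2 * n
typical-arith g s M@(suc _) h T n S α _ refl refl p r = *-cancelˡ-≤ (suc s * M * Q * suc s) (+-cancelˡ-≤ (h * Q * S + Q * T * (h * (1 + g) * n)) _ _ (begin
  h * Q * S + Q * T * (h * (1 + g) * n) + suc s * M * Q * suc s * (M * α)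
    ≡⟨ eq₁ (suc s) M (suc s) Q g n S α ⟩
  h * Q * (S + h * α) + Q * T * (h * (1 + g) * n)
    ≤⟨ +-mono-≤ (*-monoʳ-≤ (h * Q) p) r ⟩
  h * Q * (n * ((1 + g) * T + suc s)) + (h * Q * S + Q * T * n)
    ≡⟨ eq₂ (suc s) M (suc s) Q g n S ⟩
  h * Q * S + Q * T * (h * (1 + g) * n) + suc s * M * Q * suc s * (2 * n) ∎))
  where
  open ≤-Reasoning
  Q = 2 + g
  eq₁ : ∀ H M s Q g n S α → H * M * Q * S + Q * (H * (s * M)) * (H * M * (1 + g) * n) + H * M * Q * s * (M * α) ≡
        H * M * Q * (S + s * M * α) + Q * (H * (s * M)) * (H * M * (1 + g) * n)
  eq₁ = solve-∀
  eq₂ : ∀ H M s Q g n S → H * M * Q * (n * ((1 + g) * (H * (s * M)) + s)) + (H * M * Q * S + Q * (H * (s * M)) * n) ≡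
        H * M * Q * S + Q * (H * (s * M)) * (H * M * (1 + g) * n) + H * M * Q * s * (2 * n)
  eq₂ = solve-∀

-- A vertex of an independent part of size `v` is non-adjacent to that part and to `μ` vertices
-- elsewhere; almost full degree leaves room for only n/Q + n/(h Q) of these.
part-arith : ∀ g h n d v μ → let Q = 2 + g in
  h * (1 + g) * n ≤ h * Q * d + n → d + v + μ ≤ n → h * Q * v + h * Q * μ ≤ h * n + n
part-arith g h n d v μ deg le = +-cancelˡ-≤ (h * Q * d) _ _ (begin
  h * Q * d + (h * Q * v + h * Q * μ)  ≡⟨ eq₁ (h * Q) d v μ ⟩
  h * Q * (d + v + μ)                  ≤⟨ *-monoʳ-≤ (h * Q) le ⟩
  h * Q * n                            ≡⟨ eq₂ h g n ⟩
  h * n + h * (1 + g) * n              ≤⟨ +-monoʳ-≤ (h * n) deg ⟩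
  h * n + (h * Q * d + n)              ≡⟨ eq₃ (h * n) (h * Q * d) n ⟩
  h * Q * d + (h * n + n)              ∎)
  where
  open ≤-Reasoning
  Q = 2 + g
  eq₁ : ∀ k d v μ → k * d + (k * v + k * μ) ≡ k * (d + v + μ)
  eq₁ = solve-∀
  eq₂ : ∀ h g n → h * (2 + g) * n ≡ h * n + h * (1 + g) * n
  eq₂ = solve-∀
  eq₃ : ∀ a b n → a + (b + n) ≡ b + (a + n)
  eq₃ = solve-∀

-- What the upper bounds on the other `1 + g` parts, `w` vertices in total, and the `ν` vertices
-- outside leave over.
part-lower : ∀ g h n v w ν → let Q = 2 + g in
  n ≡ v + w + ν → h * Q * w ≤ (1 + g) * (h * n + n) → h * n ≤ h * Q * v + (1 + g) * n + h * Q * ν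
part-lower g h n v w ν total others = +-cancelˡ-≤ (h * (1 + g) * n) _ _ (begin
  h * (1 + g) * n + h * n                    ≡⟨ eq₁ h g n ⟩
  h * Q * n                                  ≡⟨ cong (h * Q *_) total ⟩
  h * Q * (v + w + ν)                        ≡⟨ eq₂ (h * Q) v w ν ⟩
  h * Q * w + (h * Q * v + h * Q * ν)        ≤⟨ +-monoˡ-≤ _ others ⟩
  (1 + g) * (h * n + n) + (h * Q * v + h * Q * ν) ≡⟨ eq₃ g h n (h * Q * v) (h * Q * ν) ⟩
  h * (1 + g) * n + (h * Q * v + (1 + g) * n + h * Q * ν) ∎)
  where
  open ≤-Reasoning
  Q = 2 + g
  eq₁ : ∀ h g n → h * (1 + g) * n + h * n ≡ h * (2 + g) * n
  eq₁ = solve-∀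
  eq₂ : ∀ k v w ν → k * (v + w + ν) ≡ k * w + (k * v + k * ν)
  eq₂ = solve-∀
  eq₃ : ∀ g h n x y → (1 + g) * (h * n + n) + (x + y) ≡ h * (1 + g) * n + (x + (1 + g) * n + y)
  eq₃ = solve-∀

-- The bounds on `v` from above and below leave at most n/h + ν for `μ`, and `ν` is at most 3 n/M.
miss-arith : ∀ g h M n v μ ν → let Q = 2 + g in 1 ≤ h →
  h * Q * v + h * Q * μ ≤ h * n + n → h * n ≤ h * Q * v + (1 + g) * n + h * Q * ν →
  M * ν ≤ 3 * n → M ≤ h → M * μ ≤ 4 * n
miss-arith g h@(suc _) M n v μ ν _ upper lower Mν M≤h = *-cancelˡ-≤ (h * Q) (begin
  h * Q * (M * μ)                    ≡⟨ eq₁ (h * Q) M μ ⟩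
  M * (h * Q * μ)                    ≤⟨ *-monoʳ-≤ M few ⟩
  M * (Q * n + h * Q * ν)            ≡⟨ eq₂ M Q n h ν ⟩
  Q * (M * n) + h * Q * (M * ν)      ≤⟨ +-mono-≤ (*-monoʳ-≤ Q (*-monoˡ-≤ n M≤h)) (*-monoʳ-≤ (h * Q) Mν) ⟩
  Q * (h * n) + h * Q * (3 * n)      ≡⟨ eq₃ Q h n ⟩
  h * Q * (4 * n)                    ∎)
  where
  open ≤-Reasoning
  Q = 2 + g
  few : h * Q * μ ≤ Q * n + h * Q * ν
  few = +-cancelˡ-≤ (h * Q * v + h * n) _ _ (begin
    h * Q * v + h * n + h * Q * μ                             ≡⟨ eq₄ (h * Q * v) (h * n) (h * Q * μ) ⟩
    h * Q * v + h * Q * μ + h * n                             ≤⟨ +-mono-≤ upper lower ⟩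
    h * n + n + (h * Q * v + (1 + g) * n + h * Q * ν)         ≡⟨ eq₅ (h * n) n (h * Q * v) g (h * Q * ν) ⟩
    h * Q * v + h * n + (Q * n + h * Q * ν)                   ∎)
    where
    eq₄ : ∀ a b c → a + b + c ≡ a + c + b
    eq₄ = solve-∀
    eq₅ : ∀ a n b g c → a + n + (b + (1 + g) * n + c) ≡ b + a + ((2 + g) * n + c)
    eq₅ = solve-∀
  eq₁ : ∀ k M μ → k * (M * μ) ≡ M * (k * μ)
  eq₁ = solve-∀
  eq₂ : ∀ M Q n h ν → M * (Q * n + h * Q * ν) ≡ Q * (M * n) + h * Q * (M * ν)
  eq₂ = solve-∀
  eq₃ : ∀ Q h n → Q * (h * n) + h * Q * (3 * n) ≡ h * Q * (4 * n)
  eq₃ = solve-∀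

-- `v` falls short of n/Q by at most n/h + ν, hence by at most 4 n/M, which is half of n/Q if
-- `M = 8 * Q`.
large-part : ∀ g h M n v ν → let Q = 2 + g in 1 ≤ h → 1 ≤ M →
  h * n ≤ h * Q * v + (1 + g) * n + h * Q * ν → M * ν ≤ 3 * n → M ≤ h → 8 * Q ≤ M → n ≤ 2 * Q * v
large-part g h@(suc _) M@(suc _) n v ν _ _ lower Mν M≤h 8Q≤M = *-cancelˡ-≤ (h * M) (+-cancelˡ-≤ (h * M * n) _ _ (begin
  h * M * n + h * M * n                                                  ≡⟨ eq₁ h M n ⟩
  2 * M * (h * n)                                                        ≤⟨ *-monoʳ-≤ (2 * M) lower ⟩
  2 * M * (h * Q * v + (1 + g) * n + h * Q * ν)                          ≡⟨ eq₂ M h Q v g n ν ⟩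
  h * M * (2 * Q * v) + 2 * (1 + g) * (M * n) + 2 * h * Q * (M * ν)      ≤⟨ +-mono-≤ (+-monoʳ-≤ (h * M * (2 * Q * v)) (*-monoʳ-≤ (2 * (1 + g)) (*-monoˡ-≤ n M≤h))) (*-monoʳ-≤ (2 * h * Q) Mν) ⟩
  h * M * (2 * Q * v) + 2 * (1 + g) * (h * n) + 2 * h * Q * (3 * n)      ≤⟨ m≤m+n _ (2 * (h * n)) ⟩
  h * M * (2 * Q * v) + 2 * (1 + g) * (h * n) + 2 * h * Q * (3 * n) + 2 * (h * n) ≡⟨ eq₃ (h * M * (2 * Q * v)) g h n ⟩
  h * M * (2 * Q * v) + h * n * (8 * Q)                                  ≤⟨ +-monoʳ-≤ (h * M * (2 * Q * v)) (*-monoʳ-≤ (h * n) 8Q≤M) ⟩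
  h * M * (2 * Q * v) + h * n * M                                        ≡⟨ eq₄ (h * M * (2 * Q * v)) h n M ⟩
  h * M * n + h * M * (2 * Q * v)                                        ∎))
  where
  open ≤-Reasoning
  Q = 2 + g
  eq₁ : ∀ h M n → h * M * n + h * M * n ≡ 2 * M * (h * n)
  eq₁ = solve-∀
  eq₂ : ∀ M h Q v g n ν → 2 * M * (h * Q * v + (1 + g) * n + h * Q * ν) ≡ h * M * (2 * Q * v) + 2 * (1 + g) * (M * n) + 2 * h * Q * (M * ν)
  eq₂ = solve-∀
  eq₃ : ∀ x g h n → x + 2 * (1 + g) * (h * n) + 2 * h * (2 + g) * (3 * n) + 2 * (h * n) ≡ x + h * n * (8 * (2 + g))
  eq₃ = solve-∀
  eq₄ : ∀ x h n M → x + h * n * M ≡ h * M * n + x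
  eq₄ = solve-∀

-- The link of a vertex w missing μ vertices of some part is too small unless μ is a small fraction of n.
link-arith : ∀ g h n D c θ L X ν α μ → 1 ≤ g → 1 ≤ h → 1 ≤ n → let Q = 2 + g in
  (1 + g) * g * (n * n) ≤ Q * Q * L + c * n →
  L ≤ 2 * (n * D) + 2 * (n * ν) + 2 * (n * α) + n + X →
  h * Q * (h * Q) * X + g * (h + 1) * n * (h * Q) * μ ≤ g * (1 + g) * ((h + 1) * (h + 1)) * (n * n) →
  8 * θ * Q * ν ≤ n → 8 * θ * Q * α ≤ n → 12 * θ * g ≤ h → 4 * θ * (Q * Q * (2 * D + 1) + c) ≤ n →
  θ * μ ≤ n
link-arith g@(suc g′) h@(suc h′) n@(suc _) D c θ L X ν α μ _ _ _ link≤ split products few adjacent h-large n-large =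
  *-cancelˡ-≤ (4 * (h * h * Q)) (begin
    4 * (h * h * Q) * (θ * μ)                                    ≤⟨ m≤m+n _ (4 * θ * (h * Q * μ + g′ * (h + 1) * (h * Q) * μ)) ⟩
    4 * (h * h * Q) * (θ * μ) + 4 * θ * (h * Q * μ + g′ * (h + 1) * (h * Q) * μ) ≡⟨ eq₁ g′ h Q θ μ ⟩
    4 * θ * (g * (h + 1) * (h * Q) * μ)                          ≤⟨ *-monoʳ-≤ (4 * θ) divided ⟩
    4 * θ * (h * Q * (h * Q) * (2 * D + 1 + 2 * ν + 2 * α) + h * h * c + g * (1 + g) * (2 * h + 1) * n)
                                                                 ≡⟨ eq₂ θ h Q D ν α c g n ⟩
    h * h * Q * (8 * θ * Q * ν) + h * h * Q * (8 * θ * Q * α) + h * h * (4 * θ * (Q * Q * (2 * D + 1) + c)) + (1 + g) * (2 * h + 1) * n * (4 * θ * g)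
      ≤⟨ +-mono-≤ (+-mono-≤ (+-mono-≤ (*-monoʳ-≤ (h * h * Q) few) (*-monoʳ-≤ (h * h * Q) adjacent)) (*-monoʳ-≤ (h * h) n-large)) last ⟩
    h * h * Q * n + h * h * Q * n + h * h * n + (1 + g) * (h * h) * n
                                                                 ≤⟨ m≤m+n _ (h * h * Q * n) ⟩
    h * h * Q * n + h * h * Q * n + h * h * n + (1 + g) * (h * h) * n + h * h * Q * n
                                                                 ≡⟨ eq₃ (h * h) g n ⟩
    4 * (h * h * Q) * n                                          ∎)
  where
  open ≤-Reasoning
  Q = 2 + g
  last : (1 + g) * (2 * h + 1) * n * (4 * θ * g) ≤ (1 + g) * (h * h) * n
  last = begin
    (1 + g) * (2 * h + 1) * n * (4 * θ * g)                      ≤⟨ m≤m+n _ ((1 + g) * h′ * n * (4 * θ * g)) ⟩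
    (1 + g) * (2 * h + 1) * n * (4 * θ * g) + (1 + g) * h′ * n * (4 * θ * g) ≡⟨ eq g h′ n θ ⟩
    (1 + g) * h * n * (12 * θ * g)                               ≤⟨ *-monoʳ-≤ ((1 + g) * h * n) h-large ⟩
    (1 + g) * h * n * h                                          ≡⟨ eq′ (1 + g) h n ⟩
    (1 + g) * (h * h) * n                                        ∎
    where
    eq : ∀ g h′ n θ → (1 + g) * (2 * suc h′ + 1) * n * (4 * θ * g) + (1 + g) * h′ * n * (4 * θ * g) ≡ (1 + g) * suc h′ * n * (12 * θ * g)
    eq = solve-∀
    eq′ : ∀ a h n → a * h * n * h ≡ a * (h * h) * n
    eq′ = solve-∀
  divided : g * (h + 1) * (h * Q) * μ ≤ h * Q * (h * Q) * (2 * D + 1 + 2 * ν + 2 * α) + h * h * c + g * (1 + g) * (2 * h + 1) * n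
  divided = *-cancelˡ-≤ n (+-cancelˡ-≤ (h * h * ((1 + g) * g * (n * n)) + h * Q * (h * Q) * X) _ _ (begin
    h * h * ((1 + g) * g * (n * n)) + h * Q * (h * Q) * X + n * (g * (h + 1) * (h * Q) * μ)
      ≡⟨ eq₄ (h * h * ((1 + g) * g * (n * n))) (h * Q * (h * Q) * X) n g h (h * Q) μ ⟩
    h * h * ((1 + g) * g * (n * n)) + (h * Q * (h * Q) * X + g * (h + 1) * n * (h * Q) * μ)
      ≤⟨ +-mono-≤ (*-monoʳ-≤ (h * h) (≤-trans link≤ (+-monoˡ-≤ (c * n) (*-monoʳ-≤ (Q * Q) split)))) products ⟩
    h * h * (Q * Q * (2 * (n * D) + 2 * (n * ν) + 2 * (n * α) + n + X) + c * n) + g * (1 + g) * ((h + 1) * (h + 1)) * (n * n)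
      ≡⟨ eq₅ h Q n D ν α X c g ⟩
    h * h * ((1 + g) * g * (n * n)) + h * Q * (h * Q) * X
      + n * (h * Q * (h * Q) * (2 * D + 1 + 2 * ν + 2 * α) + h * h * c + g * (1 + g) * (2 * h + 1) * n) ∎))
    where
    eq₄ : ∀ a b n g h k μ → a + b + n * (g * (h + 1) * k * μ) ≡ a + (b + g * (h + 1) * n * k * μ)
    eq₄ = solve-∀
    eq₅ : ∀ h Q n D ν α X c g →
      h * h * (Q * Q * (2 * (n * D) + 2 * (n * ν) + 2 * (n * α) + n + X) + c * n) + g * (1 + g) * ((h + 1) * (h + 1)) * (n * n) ≡
      h * h * ((1 + g) * g * (n * n)) + h * Q * (h * Q) * X
        + n * (h * Q * (h * Q) * (2 * D + 1 + 2 * ν + 2 * α) + h * h * c + g * (1 + g) * (2 * h + 1) * n)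
    eq₅ = solve-∀
  eq₁ : ∀ g′ h Q θ μ → 4 * (h * h * Q) * (θ * μ) + 4 * θ * (h * Q * μ + g′ * (h + 1) * (h * Q) * μ) ≡ 4 * θ * (suc g′ * (h + 1) * (h * Q) * μ)
  eq₁ = solve-∀
  eq₂ : ∀ θ h Q D ν α c g n → 4 * θ * (h * Q * (h * Q) * (2 * D + 1 + 2 * ν + 2 * α) + h * h * c + g * (1 + g) * (2 * h + 1) * n) ≡
    h * h * Q * (8 * θ * Q * ν) + h * h * Q * (8 * θ * Q * α) + h * h * (4 * θ * (Q * Q * (2 * D + 1) + c)) + (1 + g) * (2 * h + 1) * n * (4 * θ * g)
  eq₂ = solve-∀
  eq₃ : ∀ a g n → a * (2 + g) * n + a * (2 + g) * n + a * n + (1 + g) * a * n + a * (2 + g) * n ≡ 4 * (a * (2 + g)) * n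
  eq₃ = solve-∀

∑-two-zero : ∀ {r} (f : Fin (2 + r) → ℕ) i j {b} → i ≢ j → f i ≡ 0 → f j ≡ 0 → (∀ x → f x ≤ b) → ∑ f ≤ r * b
∑-two-zero {r} f i j {b} i≢j fi fj bound = +-cancelʳ-≤ b _ _ (begin
  ∑ f + b                             ≡⟨ cong (∑ f +_) (sym (∑-point (λ _ → b) j)) ⟩
  ∑ f + ∑ (λ x → 𝟙 (j ≐ x) * b)       ≡⟨ sym (∑-+ f _) ⟩
  ∑ (λ x → f x + 𝟙 (j ≐ x) * b)       ≤⟨ ∑-one-small _ i pw (≤-reflexive (trans (cong₂ (λ a t → a + 𝟙 t * b) fi (≢⇒≐ (i≢j ∘ sym))) refl)) ⟩
  (1 + r) * b + 0                     ≡⟨ eq r b ⟩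
  r * b + b                           ∎)
  where
  open ≤-Reasoning
  pw : ∀ x → f x + 𝟙 (j ≐ x) * b ≤ b
  pw x with j ≟ x
  ... | yes refl = ≤-reflexive (trans (cong (_+ 1 * b) fj) (*-identityˡ b))
  ... | no _ = ≤-trans (≤-reflexive (+-identityʳ (f x))) (bound x)
  eq : ∀ r b → (1 + r) * b + 0 ≡ r * b + b
  eq = solve-∀

∑-drop : ∀ {q} (i : Fin q) (a : Fin q → ℕ) → ∑ a ≡ a i + ∑ (drop i a)
∑-drop i a = trans (∑-cong split) (trans (∑-+ _ (drop i a)) (cong (_+ ∑ (drop i a)) (∑-point a i)))
  where
  split : ∀ t → a t ≡ 𝟙 (i ≐ t) * a t + drop i a t
  split t with i ≟ t
  ... | yes _ = sym (trans (+-identityʳ _) (*-identityˡ (a t)))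
  ... | no _ = refl

drop-here : ∀ {q} (i : Fin q) (a : Fin q → ℕ) → drop i a i ≡ 0
drop-here i a rewrite ≐-refl i = refl

drop-there : ∀ {q} (i : Fin q) (a : Fin q → ℕ) {t} → i ≢ t → drop i a t ≡ a t
drop-there i a ne rewrite ≢⇒≐ ne = refl

∑-drop-swap : ∀ {q N} (i : Fin q) (f : Fin N → Fin q → ℕ) t → ∑ (λ y → drop i (f y) t) ≡ drop i (λ t → ∑ (λ y → f y t)) t
∑-drop-swap i f t with i ≟ t
... | yes _ = ∑-zero (λ _ → refl)
... | no _ = refl

-- Turns inequalities with cleared denominators into the integer bound `e` expected by `robust-by`
-- and `no-spread`.
quotient : ∀ θ n → 1 ≤ θ → ∃ λ e → θ * e ≤ n × (∀ μ → θ * μ ≤ n → μ ≤ e)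
quotient θ@(suc _) n _ = n / θ , ≤-trans (≤-reflexive (*-comm θ (n / θ))) (m/n*n≤m n θ) ,
  λ μ p → ≤-trans (≤-reflexive (sym (m*n/n≡m μ θ))) (/-monoˡ-≤ θ (≤-trans (≤-reflexive (*-comm μ θ)) p))

suc-pred′ : ∀ x → 1 ≤ x → suc (pred x) ≡ x
suc-pred′ (suc x) _ = refl

-- The structure of J when every link is almost as large as in the Turán 3-graph

module Counting (F : Graph) {g : ℕ} (g≥1 : 1 ≤ g) (crit : Critical F (2 + g)) {n : ℕ} (n≥1 : 1 ≤ n) {κ : Subset n → ℕ} {R : List (Subset n)}
                (reps : Representatives κ R) (noRainbow : ¬ HasRainbowCopy κ (expansion3 F)) (c : ℕ)
                (link-large : ∀ w → (1 + g) * g * (n * n) ≤ (2 + g) * (2 + g) * Family.link reps w + c * n) where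
  open Graph F using (m; k)
  open Structure F crit reps noRainbow public

  Q : ℕ
  Q = 2 + g

  D : ℕ
  D = threshold

  degree : Fin n → ℕ
  degree w = card (J w)

  -- A single vertex may have many link pairs outside `J`, but such a pair lies in at most `D`
  -- triples, so the total over all vertices is only of order n^2.
  thinLink : Fin n → ℕ
  thinLink w = ∑ λ x → ∑ λ y → 𝟙 (G w x y) * 𝟙 (not (J x y))

  thin-row : ∀ x y → ∑ (λ w → 𝟙 (G w x y) * 𝟙 (not (J x y))) ≤ D
  thin-row x y with J x y in eq
  ... | true  = ≤-trans (≤-reflexive (∑-zero λ w → *-zeroʳ (𝟙 (G w x y)))) z≤n
  ... | false = ≤-trans (≤-reflexive (∑-cong λ w → trans (*-identityʳ _) (cong 𝟙 (G-rotate w x y)))) (J-thin eq)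

  thin-total : ∑ thinLink ≤ n * (n * D)
  thin-total = ≤-trans (≤-reflexive (trans (∑-swap _) (∑-cong λ x → ∑-swap _))) (∑-bound λ x → ∑-bound λ y → thin-row x y)

  bad : ℕ → Fin n → Bool
  bad M w = does (n * n ≤¿ M * thinLink w)

  -- Markov's inequality for `thin-total`; the bound does not depend on `n`.
  bad-few : ∀ M → card (bad M) ≤ M * D
  bad-few M = *-cancelʳ-≤ (card (bad M)) (M * D) (n * n) {{>-nonZero (*-mono-≤ n≥1 n≥1)}} (begin
    card (bad M) * (n * n)          ≡⟨ sym (∑-*ʳ (n * n) _) ⟩
    ∑ (λ w → 𝟙 (bad M w) * (n * n)) ≤⟨ ∑-mono pw ⟩
    ∑ (λ w → M * thinLink w)        ≡⟨ ∑-*ˡ M thinLink ⟩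
    M * ∑ thinLink                  ≤⟨ *-monoʳ-≤ M thin-total ⟩
    M * (n * (n * D))               ≡⟨ eq M n D ⟩
    M * D * (n * n)                 ∎)
    where
    open ≤-Reasoning
    pw : ∀ w → 𝟙 (bad M w) * (n * n) ≤ M * thinLink w
    pw w with n * n ≤¿ M * thinLink w
    ... | yes p = ≤-trans (≤-reflexive (+-identityʳ (n * n))) p
    ... | no _  = z≤n
    eq : ∀ M n D → M * (n * (n * D)) ≡ M * D * (n * n)
    eq = solve-∀

  sparse-row : ∀ w x → ∑ (λ y → 𝟙 (G w x y) * 𝟙 (not (J w x))) ≤ D
  sparse-row w x with J w x in eq
  ... | true  = ≤-trans (≤-reflexive (∑-zero λ y → *-zeroʳ (𝟙 (G w x y)))) z≤n
  ... | false = ≤-trans (≤-reflexive (∑-cong λ y → *-identityʳ _)) (J-thin eq)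

  sparse-rows : ∀ w → ∑ (λ x → ∑ (λ y → 𝟙 (G w x y) * 𝟙 (not (J w x)))) ≤ n * D
  sparse-rows w = ∑-bound (sparse-row w)

  sparse-columns : ∀ w → ∑ (λ x → ∑ (λ y → 𝟙 (G w x y) * 𝟙 (not (J w y)))) ≤ n * D
  sparse-columns w = ≤-trans (≤-reflexive (trans (∑-swap _) (∑-cong λ y → ∑-cong λ x → cong (λ b → 𝟙 b * 𝟙 (not (J w y))) (G-swap′ w x y)))) (sparse-rows w)

  -- A triple at `w` either has all its pairs in `J`, and then gives an edge of `J` inside the
  -- neighbourhood of `w`, or is charged to a pair outside `J`.
  link-split : ∀ w → link w ≤ edges J (J w) + 2 * (n * D) + thinLink w
  link-split w = begin
    link w
      ≤⟨ ∑-mono (λ x → ∑-mono λ y → pw (G w x y) (J w x) (J w y) (J x y)) ⟩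
    ∑ (λ x → ∑ λ y → 𝟙 (J w x) * (𝟙 (J w y) * 𝟙 (J x y)) + 𝟙 (G w x y) * 𝟙 (not (J w x)) + 𝟙 (G w x y) * 𝟙 (not (J w y)) + 𝟙 (G w x y) * 𝟙 (not (J x y)))
      ≡⟨ ∑∑-+ _ _ ⟩
    ∑ (λ x → ∑ λ y → 𝟙 (J w x) * (𝟙 (J w y) * 𝟙 (J x y)) + 𝟙 (G w x y) * 𝟙 (not (J w x)) + 𝟙 (G w x y) * 𝟙 (not (J w y))) + thinLink w
      ≡⟨ cong (_+ thinLink w) (trans (∑∑-+ _ _) (cong (_+ ∑ (λ x → ∑ λ y → 𝟙 (G w x y) * 𝟙 (not (J w y)))) (∑∑-+ _ _))) ⟩
    ∑ (λ x → ∑ λ y → 𝟙 (J w x) * (𝟙 (J w y) * 𝟙 (J x y))) + ∑ (λ x → ∑ λ y → 𝟙 (G w x y) * 𝟙 (not (J w x)))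
      + ∑ (λ x → ∑ λ y → 𝟙 (G w x y) * 𝟙 (not (J w y))) + thinLink w
      ≤⟨ +-monoˡ-≤ (thinLink w) (+-mono-≤ (+-mono-≤ (≤-reflexive (sym (weight-def J _ _))) (sparse-rows w)) (sparse-columns w)) ⟩
    edges J (J w) + n * D + n * D + thinLink w
      ≡⟨ cong (_+ thinLink w) (eq (edges J (J w)) (n * D)) ⟩
    edges J (J w) + 2 * (n * D) + thinLink w ∎
    where
    open ≤-Reasoning
    pw : ∀ a b d e → 𝟙 a ≤ 𝟙 b * (𝟙 d * 𝟙 e) + 𝟙 a * 𝟙 (not b) + 𝟙 a * 𝟙 (not d) + 𝟙 a * 𝟙 (not e)
    pw false _ _ _ = z≤n
    pw true false false false = s≤s z≤n
    pw true false false true  = s≤s z≤n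
    pw true false true  false = s≤s z≤n
    pw true false true  true  = s≤s z≤n
    pw true true  false false = s≤s z≤n
    pw true true  false true  = s≤s z≤n
    pw true true  true  false = s≤s z≤n
    pw true true  true  true  = s≤s z≤n
    eq : ∀ e x → e + x + x ≡ e + 2 * x
    eq = solve-∀

  module Scale (h : ℕ) (h≥1 : 1 ≤ h) where

    H M₁ M₀ C₁ : ℕ
    H = h * (1 + g)
    M₁ = 2 * H
    M₀ = Q * Q * ((1 + g) * M₁)
    -- `erdős-stone` takes the predecessors of the part size and of the precision, here those of `σ`
    -- and `M₁`.
    C₁ = proj₁ (erdős-stone g (ρ + ρ) (pred M₁))

    E₁ : ℕ
    E₁ = h * h * (Q * Q * C₁ + (1 + g) * M₁ * (Q * Q * (2 * D) + c))

    good : Fin n → Bool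
    good = not ∘ bad M₀

    M₁≥1 : 1 ≤ M₁
    M₁≥1 = *-mono-≤ {1} {2} (s≤s z≤n) (*-mono-≤ {1} {h} {1} {1 + g} h≥1 (s≤s z≤n))

    -- By `no-full-vertex` Erdős-Stone can only return sparsity of `J` in the neighbourhood of `w`.
    -- An almost extremal link then needs a neighbourhood of almost (1 + g) n/Q vertices.
    good-degree : E₁ < n → ∀ w → good w ≡ true → H * n ≤ h * Q * degree w + n
    good-degree E<n w gw = case proj₂ (erdős-stone g (ρ + ρ) (pred M₁)) J-sym J-irr (J w) of λ
      { (inj₁ K)      → ⊥-elim (no-full-vertex K zero w λ i → ≤-reflexive (sym (trans (∑-cong λ s → cong 𝟙 (Blowup.inA K i s)) (trans (∑-const σ 1) (*-identityʳ σ)))))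
      ; (inj₂ sparse) → degree-arith g h n (degree w) (edges J (J w)) (link w) (thinLink w) D c C₁ g≥1 h≥1 (link-large w) (link-split w)
            (<⇒≤ (≰⇒> (does⇒¬ (n * n ≤¿ M₀ * thinLink w) (not-true gw))))
            (subst (λ M → (1 + g) * M * edges J (J w) ≤ (g * M + 1) * (degree w * degree w) + C₁ * degree w) (suc-pred′ M₁ M₁≥1) sparse) (card-≤n (J w)) E<n }

    b₀ : ℕ
    b₀ = M₀ * D

    -- Degrees near (1 + g) n/Q exceed what the sparse alternative of Erdős-Stone, with density
    -- about g/(1 + g), permits. Bad vertices are left out because their degrees are not controlled;
    -- as their number is bounded, this hardly lowers the degrees of the others.
    core : ∀ T → 2 * Q ≤ h → E₁ < n →
           h * Q * proj₁ (erdős-stone g T (pred (2 * Q))) + (1 + g) * (2 * Q) * (h * Q + 1) * b₀ + b₀ < n →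
           Blowup J good Q (suc T)
    core T 2Q≤h E<n E′<n = case proj₂ (erdős-stone g T (pred (2 * Q))) J-sym J-irr good of λ
      { (inj₁ K)      → K
      ; (inj₂ sparse) → ⊥-elim (global-arith g h n (card good) (card (bad M₀)) (edges J good) C total degrees sparse 2Q≤h
          (≤-<-trans (+-mono-≤ (+-monoʳ-≤ (h * Q * C) (*-monoʳ-≤ ((1 + g) * (2 * Q) * (h * Q + 1)) (bad-few M₀))) (bad-few M₀)) E′<n)) }
      where
      C = proj₁ (erdős-stone g T (pred (2 * Q)))
      total : card good + card (bad M₀) ≡ n
      total = trans (+-comm (card good) (card (bad M₀))) (card-not (bad M₀))
      open ≤-Reasoning
      row : ∀ x → degree x ≤ ∑ (λ y → 𝟙 (good y) * 𝟙 (J x y)) + card (bad M₀)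
      row x = ≤-trans (∑-mono λ y → pw (bad M₀ y) (J x y)) (≤-reflexive (∑-+ _ _))
        where
        pw : ∀ b j → 𝟙 j ≤ 𝟙 (not b) * 𝟙 j + 𝟙 b
        pw true  true  = s≤s z≤n
        pw true  false = z≤n
        pw false true  = s≤s z≤n
        pw false false = z≤n
      good-row : ∀ x → 𝟙 (good x) * (H * n) ≤ h * Q * (𝟙 (good x) * ∑ (λ y → 𝟙 (good y) * 𝟙 (J x y)) + 𝟙 (good x) * card (bad M₀)) + 𝟙 (good x) * n
      good-row x with good x in eq
      ... | false = z≤n
      ... | true = begin
        1 * (H * n)                                                   ≡⟨ *-identityˡ (H * n) ⟩
        H * n                                                         ≤⟨ good-degree E<n x eq ⟩
        h * Q * degree x + n                                          ≤⟨ +-monoˡ-≤ n (*-monoʳ-≤ (h * Q) (row x)) ⟩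
        h * Q * (∑ (λ y → 𝟙 (good y) * 𝟙 (J x y)) + card (bad M₀)) + n ≡⟨ sym (cong₂ (λ a b → h * Q * a + b) (cong₂ _+_ (*-identityˡ (∑ (λ y → 𝟙 (good y) * 𝟙 (J x y)))) (*-identityˡ (card (bad M₀)))) (*-identityˡ n)) ⟩
        h * Q * (1 * ∑ (λ y → 𝟙 (good y) * 𝟙 (J x y)) + 1 * card (bad M₀)) + 1 * n ∎
      degrees : card good * (H * n) ≤ h * Q * (edges J good + card good * card (bad M₀)) + card good * n
      degrees = begin
        card good * (H * n)                ≡⟨ sym (∑-*ʳ (H * n) _) ⟩
        ∑ (λ x → 𝟙 (good x) * (H * n))     ≤⟨ ∑-mono good-row ⟩
        ∑ (λ x → h * Q * (𝟙 (good x) * ∑ (λ y → 𝟙 (good y) * 𝟙 (J x y)) + 𝟙 (good x) * card (bad M₀)) + 𝟙 (good x) * n)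
          ≡⟨ trans (∑-+ _ _) (cong₂ _+_ (trans (∑-*ˡ (h * Q) _) (cong (h * Q *_) (trans (∑-+ _ _) (cong₂ _+_ (sym (weight-rows J (𝟙 ∘ good) (𝟙 ∘ good))) (∑-*ʳ (card (bad M₀)) _))))) (∑-*ʳ n _)) ⟩
        h * Q * (edges J good + card good * card (bad M₀)) + card good * n ∎

  ρ≥1 : 1 ≤ ρ
  ρ≥1 = ≤-trans (≤-trans (s≤s z≤n) (m≤n+m 12 k)) (m≤n+m (k + 12) m)

  -- Most vertices typed by their adjacency to the core

  module Partition (M h T : ℕ) (M≥1 : 1 ≤ M) (h≥1 : 1 ≤ h) (h≡ : h ≡ σ * M) (T≡ : T ≡ σ * h)
                   (K : Blowup J (Scale.good h h≥1) Q T) (E₁<n : Scale.E₁ h h≥1 < n) (b₀-small : M * Scale.b₀ h h≥1 ≤ n) where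

    open Scale h h≥1 public
    open Blowup K

    σ+h≤T : σ + h ≤ T
    σ+h≤T = ≤-trans (≤-trans (+-monoˡ-≤ h (≤-trans (≤-reflexive (sym (*-identityʳ σ))) (≤-trans (*-monoʳ-≤ σ M≥1) (≤-reflexive (sym h≡)))))
              (+-monoʳ-≤ h (≤-trans (≤-reflexive (sym (*-identityˡ h))) (*-monoˡ-≤ h (≤-trans ρ≥1 (m≤m+n ρ ρ))))))
              (≤-reflexive (sym T≡))

    M≤h : M ≤ h
    M≤h = ≤-trans (m≤m+n M ((ρ + ρ) * M)) (≤-reflexive (sym h≡))

    low : Fin Q → Fin n → ℕ
    low i x = card (λ t → J x (part i t))

    Class : Fin Q → Fin n → Set
    Class i x = suc (low i x) ≤ σ × (∀ j → i ≡ j ⊎ T ≤ low j x + h)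

    class? : ∀ i x → Dec (Class i x)
    class? i x = (suc (low i x) ≤¿ σ) ×-dec all¿ (λ j → (i ≟ j) ⊎-dec (T ≤¿ low j x + h))

    typical : Fin n → Bool
    typical x = does (any¿ (λ i → class? i x))

    V : Fin Q → Fin n → Bool
    V i x = good x ∧ does (class? i x)

    V-class : ∀ {i x} → V i x ≡ true → Class i x
    V-class {i} {x} p = does⇒ (class? i x) (proj₂ (∧-true {good x} p))

    low-part : ∀ x → ∃ λ i → suc (low i x) ≤ σ
    low-part x = let i , p = Finₚ.¬∀⟶∃¬ Q _ (λ i → σ ≤¿ low i x) (no-full-vertex K zero x) in i , ≰⇒> p

    -- By `no-full-vertex` some part of the core contributes less than `σ`; an atypical vertex loses
    -- more than `h` in another part as well.
    degreeInto-bound : ∀ x → degreeInto x + h * 𝟙 (not (typical x)) ≤ (1 + g) * T + σ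
    degreeInto-bound x with any¿ (λ i → class? i x)
    ... | yes _ = ≤-trans (≤-reflexive (trans (cong (degreeInto x +_) (*-zeroʳ h)) (+-identityʳ _))) (degree-nonfull K σ x (no-full-vertex K zero x))
    ... | no none = let i , small = low-part x in atypical i small
      (Finₚ.¬∀⟶∃¬ Q _ (λ j → (i ≟ j) ⊎-dec (T ≤¿ low j x + h)) (λ all → none (i , small , all)))
      where
      atypical : ∀ i → suc (low i x) ≤ σ → (∃ λ j → ¬ (i ≡ j ⊎ T ≤ low j x + h)) → degreeInto x + h * 1 ≤ (1 + g) * T + σ
      atypical i small (j , ne) = begin
        degreeInto x + h * 1                     ≡⟨ cong (degreeInto x +_) (trans (*-identityʳ h) (sym (∑-point (λ _ → h) j))) ⟩
        degreeInto x + ∑ (λ l → 𝟙 (j ≐ l) * h)   ≡⟨ sym (∑-+ (λ l → low l x) _) ⟩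
        ∑ (λ l → low l x + 𝟙 (j ≐ l) * h)        ≤⟨ ∑-one-small _ i pw at-i ⟩
        (1 + g) * T + σ                           ∎
        where
        open ≤-Reasoning
        pw : ∀ l → low l x + 𝟙 (j ≐ l) * h ≤ T
        pw l with j ≟ l
        ... | yes refl = ≤-trans (≤-reflexive (cong (low j x +_) (*-identityˡ h))) (<⇒≤ (≰⇒> (ne ∘ inj₂)))
        ... | no _ = ≤-trans (≤-reflexive (+-identityʳ _)) (card-≤n _)
        at-i : low i x + 𝟙 (j ≐ i) * h ≤ σ
        at-i = ≤-trans (≤-reflexive (trans (cong (λ b → low i x + 𝟙 b * h) (≢⇒≐ (ne ∘ inj₁ ∘ sym))) (+-identityʳ _))) (<⇒≤ small)

    atypical-few : M * card (not ∘ typical) ≤ 2 * n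
    atypical-few = typical-arith g (ρ + ρ) M h T n (∑ degreeInto) (card (not ∘ typical)) M≥1 h≡ T≡ upper lower
      where
      open ≤-Reasoning
      upper : ∑ degreeInto + h * card (not ∘ typical) ≤ n * ((1 + g) * T + σ)
      upper = ≤-trans (≤-reflexive (sym (trans (∑-+ degreeInto _) (cong (∑ degreeInto +_) (∑-*ˡ h _))))) (∑-bound degreeInto-bound)
      S≡ : ∑ degreeInto ≡ ∑ (λ i → ∑ λ t → degree (part i t))
      S≡ = trans (∑-swap _) (∑-cong λ i → trans (∑-swap _) (∑-cong λ t → ∑-cong λ x → cong 𝟙 (J-sym x (part i t))))
      lower : Q * T * (H * n) ≤ h * Q * ∑ degreeInto + Q * T * n
      lower = begin
        Q * T * (H * n)                                       ≡⟨ *-assoc Q T (H * n) ⟩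
        Q * (T * (H * n))                                     ≤⟨ ∑-lower (λ i → ∑-lower λ t → good-degree E₁<n (part i t) (inA i t)) ⟩
        ∑ (λ i → ∑ λ t → h * Q * degree (part i t) + n)       ≡⟨ trans (∑-cong λ i → trans (∑-+ _ _) (cong₂ _+_ (∑-*ˡ (h * Q) _) (∑-const T n))) (trans (∑-+ _ _) (cong₂ _+_ (∑-*ˡ (h * Q) _) (∑-const Q (T * n)))) ⟩
        h * Q * ∑ (λ i → ∑ λ t → degree (part i t)) + Q * (T * n) ≡⟨ cong₂ (λ a b → h * Q * a + b) (sym S≡) (sym (*-assoc Q T n)) ⟩
        h * Q * ∑ degreeInto + Q * T * n                      ∎

    outside : Fin n → Bool
    outside x = not (does (any¿ (λ i → V i x ≟ᴮ true)))

    ν : ℕ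
    ν = card outside

    outside-few : M * ν ≤ 3 * n
    outside-few = begin
      M * ν                                            ≤⟨ *-monoʳ-≤ (M) (≤-trans (∑-mono pw) (≤-reflexive (∑-+ _ _))) ⟩
      M * (card (not ∘ typical) + card (bad M₀))       ≡⟨ *-distribˡ-+ (M) _ _ ⟩
      M * card (not ∘ typical) + M * card (bad M₀) ≤⟨ +-mono-≤ atypical-few (≤-trans (*-monoʳ-≤ (M) (bad-few M₀)) b₀-small) ⟩
      2 * n + n                                            ≡⟨ +-comm (2 * n) n ⟩
      3 * n                                                ∎
      where
      open ≤-Reasoning
      pw : ∀ x → 𝟙 (outside x) ≤ 𝟙 (not (typical x)) + 𝟙 (bad M₀ x)
      pw x = cases (any¿ (λ i → V i x ≟ᴮ true)) (any¿ (λ i → class? i x)) (bad M₀ x) refl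
        where
        cases : (d : Dec (∃ λ i → V i x ≡ true)) (d′ : Dec (∃ λ i → Class i x)) → ∀ b → bad M₀ x ≡ b →
                𝟙 (not (does d)) ≤ 𝟙 (not (does d′)) + 𝟙 b
        cases (yes _) _ _ _ = z≤n
        cases (no _) (no _) _ _ = s≤s z≤n
        cases (no _) (yes _) true _ = s≤s z≤n
        cases (no none) (yes (i , cl)) false eq = ⊥-elim (none (i , ∧-true⁺ (cong not eq) (dec-true (class? i x) cl)))

    -- Class `i` means fewer than `σ` neighbours in part `i` of the core, any other class at least T
    -- - h, and `σ + h ≤ T`.
    V-unique : ∀ x i j → V i x ≡ true → V j x ≡ true → i ≡ j
    V-unique x i j p q = case proj₂ (V-class p) j of λ
      { (inj₁ e)   → e
      ; (inj₂ big) → ⊥-elim (<⇒≱ (≤-trans (+-monoˡ-≤ h (proj₁ (V-class q))) σ+h≤T) big) }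

    τ₀ : Fin n → Maybe (Fin Q)
    τ₀ = pickType V

    τ₀-complete : ∀ {x i} → V i x ≡ true → τ₀ x ≡ just i
    τ₀-complete {x} {i} = pickType-complete V V-unique x i

    low-other : ∀ i j t → i ≢ j → low j (part i t) ≡ T
    low-other i j t ne = trans (∑-cong λ t′ → cong 𝟙 (adj i j t t′ ne)) (trans (∑-const T 1) (*-identityʳ T))

    part-typed : ∀ j t → V j (part j t) ≡ true
    part-typed j t = ∧-true⁺ (inA j t) (dec-true (class? j (part j t)) (small , big))
      where
      small : suc (low j (part j t)) ≤ σ
      small = let i , p = low-part (part j t) in from i p (j ≟ i)
        where
        from : ∀ i → suc (low i (part j t)) ≤ σ → Dec (j ≡ i) → suc (low j (part j t)) ≤ σ
        from i p (yes refl) = p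
        from i p (no ne) = ⊥-elim (<⇒≱ p (≤-trans (m≤m+n σ h) (≤-trans σ+h≤T (≤-reflexive (sym (low-other j i t ne))))))
      big : ∀ i → j ≡ i ⊎ T ≤ low i (part j t) + h
      big i with j ≟ i
      ... | yes e = inj₁ e
      ... | no ne = inj₂ (≤-trans (≤-reflexive (sym (low-other j i t ne))) (m≤m+n _ h))

    -- The vertices of the core are the candidates: a typed vertex misses at most `h` of the `T` in
    -- a part of another type, and `T = σ * h` is more than `(ρ + ρ) * h`.
    rob₀ : Typed.Robust J τ₀ ρ
    rob₀ = robust-by τ₀ ρ part (λ _ _ → true) h h≥1 inj (λ j t _ → τ₀-complete (part-typed j t)) miss
             (λ j → ≤-trans (m<n+m ((ρ + ρ) * h) h≥1) (≤-reflexive (sym (trans (∑-const T 1) (trans (*-identityʳ T) T≡)))))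
      where
      miss : ∀ j x i → τ₀ x ≡ just i → i ≢ j → card (λ t → not (J x (part j t))) ≤ h
      miss j x i e ne = case proj₂ (V-class (pickType-sound V x i e)) j of λ
        { (inj₁ eq)  → ⊥-elim (ne eq)
        ; (inj₂ big) → +-cancelˡ-≤ (low j x) _ _ (≤-trans (≤-reflexive (card-not (λ t → J x (part j t)))) big) }

    V-independent : ∀ {i x y} → V i x ≡ true → V i y ≡ true → J x y ≡ false
    V-independent p q = no-inner τ₀ rob₀ (τ₀-complete p) (τ₀-complete q)

    size-V : Fin Q → ℕ
    size-V i = card (V i)

    missing : Fin Q → Fin n → ℕ
    missing j x = card (λ y → V j y ∧ not (J x y))

    neighbours : Fin Q → Fin n → ℕ
    neighbours j x = card (λ y → V j y ∧ J x y)

    neighbours+missing : ∀ j x → neighbours j x + missing j x ≡ size-V j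
    neighbours+missing j x = sym (card-split (V j) (J x))

    -- `V i` is independent in `J` and disjoint from `V j`, so the three sets counted do not
    -- overlap.
    degree-split : ∀ i j x → V i x ≡ true → i ≢ j → degree x + size-V i + missing j x ≤ n
    degree-split i j x p ne = begin
      degree x + size-V i + missing j x                                    ≡⟨ sym (trans (∑-+ _ _) (cong (_+ missing j x) (∑-+ _ _))) ⟩
      ∑ (λ y → 𝟙 (J x y) + 𝟙 (V i y) + 𝟙 (V j y ∧ not (J x y)))            ≤⟨ ∑-bound pw ⟩
      n * 1                                                                ≡⟨ *-identityʳ n ⟩
      n                                                                    ∎
      where
      open ≤-Reasoning
      pw : ∀ y → 𝟙 (J x y) + 𝟙 (V i y) + 𝟙 (V j y ∧ not (J x y)) ≤ 1
      pw y with J x y in ej | V i y in ei | V j y in ej′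
      ... | true  | true  | _     = true≢false ej (V-independent p ei)
      ... | true  | false | true  = s≤s z≤n
      ... | true  | false | false = s≤s z≤n
      ... | false | true  | true  = ⊥-elim (ne (V-unique y i j ei ej′))
      ... | false | true  | false = s≤s z≤n
      ... | false | false | true  = s≤s z≤n
      ... | false | false | false = z≤n

    other : ∀ (i : Fin Q) → ∃ λ j → i ≢ j
    other zero    = suc zero , λ ()
    other (suc i) = zero , λ ()

    V-good : ∀ {i x} → V i x ≡ true → good x ≡ true
    V-good p = proj₁ (∧-true p)

    upper+missing : ∀ {i j x} → V i x ≡ true → i ≢ j → h * Q * size-V i + h * Q * missing j x ≤ h * n + n
    upper+missing {i} {j} {x} p ne = part-arith g h n (degree x) (size-V i) (missing j x)
      (good-degree E₁<n x (V-good {i} {x} p)) (degree-split i j x p ne)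

    upper : ∀ i → h * Q * size-V i ≤ h * n + n
    upper i with 0 <? size-V i
    ... | yes p = let x , q = card-pos (V i) p ; j , ne = other i in ≤-trans (m≤m+n _ _) (upper+missing q ne)
    ... | no ¬p = ≤-trans (≤-reflexive (trans (cong (h * Q *_) (n≤0⇒n≡0 (≮⇒≥ ¬p))) (*-zeroʳ (h * Q)))) z≤n

    total : n ≡ ∑ size-V + ν
    total = begin-equality
      n                                                ≡⟨ sym (trans (∑-const n 1) (*-identityʳ n)) ⟩
      ∑ {n} (λ _ → 1)                                  ≡⟨ ∑-cong pw ⟩
      ∑ (λ x → ∑ (λ i → 𝟙 (V i x)) + 𝟙 (outside x))    ≡⟨ trans (∑-+ _ _) (cong (_+ ν) (∑-swap _)) ⟩
      ∑ size-V + ν                                     ∎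
      where
      open ≤-Reasoning
      pw : ∀ x → 1 ≡ ∑ (λ i → 𝟙 (V i x)) + 𝟙 (outside x)
      pw x with any¿ (λ i → V i x ≟ᴮ true)
      ... | no none = cong (_+ 1) (sym (∑-zero λ i → cong 𝟙 (≢true λ p → none (i , p))))
      ... | yes (i , p) = sym (trans (+-identityʳ _) (trans (∑-cong same) (card-point i)))
        where
        same : ∀ j → 𝟙 (V j x) ≡ 𝟙 (i ≐ j)
        same j with i ≟ j
        ... | yes refl = cong 𝟙 p
        ... | no ne = cong 𝟙 (≢true λ q → ne (V-unique x i j p q))

    lower : ∀ i → h * n ≤ h * Q * size-V i + (1 + g) * n + h * Q * ν
    lower i = part-lower g h n (size-V i) (∑ (drop i size-V)) ν (trans total (cong (_+ ν) (∑-drop i size-V)))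
      (≤-trans (≤-reflexive (sym (∑-*ˡ (h * Q) (drop i size-V))))
        (≤-trans (∑-one-small _ i bound (≤-reflexive (trans (cong (h * Q *_) (drop-here i size-V)) (*-zeroʳ (h * Q)))))
          (≤-reflexive (+-identityʳ _))))
      where
      bound : ∀ j → h * Q * drop i size-V j ≤ h * n + n
      bound j with i ≟ j
      ... | yes _ = ≤-trans (≤-reflexive (*-zeroʳ (h * Q))) z≤n
      ... | no _ = upper j

    few-missing : ∀ {i j x} → V i x ≡ true → i ≢ j → M * missing j x ≤ 4 * n
    few-missing {i} {j} {x} p ne = miss-arith g h M n (size-V i) (missing j x) ν h≥1 (upper+missing p ne) (lower i) outside-few M≤h

    size-V-large : 8 * Q ≤ M → ∀ i → n ≤ 2 * Q * size-V i
    size-V-large 8Q≤M i = large-part g h M n (size-V i) ν h≥1 M≥1 (lower i) outside-few M≤h 8Q≤M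

    -- Types of all vertices

    module Types (θ θ′ : ℕ) (θ≥1 : 1 ≤ θ) (θ′≥1 : 1 ≤ θ′) (θ≡ : θ ≡ 8 * θ′ * Q) (θ′≡ : θ′ ≡ 8 * Q * ρ)
                 (M-large : 16 * ρ * θ ≤ M) (h-large : 12 * θ′ * g ≤ h) (M≤n : M ≤ n) (θ′≤n : θ′ ≤ n)
                 (n-large : 4 * θ′ * (Q * Q * (2 * D + 1) + c) ≤ n) where

      4ρe : ∀ e v → 1 ≤ e → 4 * ρ * e ≤ v → (ρ + ρ) * e < v
      4ρe e v e≥1 le = ≤-trans (≤-trans (m<m+n ((ρ + ρ) * e) (*-mono-≤ (≤-trans ρ≥1 (m≤m+n ρ ρ)) e≥1)) (≤-reflexive (eq ρ e))) le
        where
        eq : ∀ ρ e → (ρ + ρ) * e + (ρ + ρ) * e ≡ 4 * ρ * e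
        eq = solve-∀

      -- `no-spread` is applied to the neighbours of `w` in the sets `V j`, where a typed vertex
      -- misses at most 4 n/M of another set. By `16 * ρ * θ ≤ M`, the n/θ candidates in each set
      -- outnumber those that can be lost.
      not-spread : ∀ w → ¬ (∀ i → n ≤ θ * neighbours i w)
      not-spread w all with quotient M (4 * n) M≥1
      ... | e , Me≤4n , bound = no-spread V V-unique (λ _ x → x) V e e≥1 (λ _ p → p) (λ _ _ p → p)
              (λ j x i p ne → bound (missing j x) (few-missing p ne)) zero w (λ j → 4ρe e (neighbours j w) e≥1 (enough j))
        where
        e≥1 : 1 ≤ e
        e≥1 = bound 1 (≤-trans (≤-reflexive (*-identityʳ M)) (≤-trans M≤n (m≤m+n n (3 * n))))
        enough : ∀ j → 4 * ρ * e ≤ neighbours j w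
        enough j = *-cancelˡ-≤ (4 * θ) {{>-nonZero (*-mono-≤ {1} {4} (s≤s z≤n) θ≥1)}} (begin
          4 * θ * (4 * ρ * e)         ≡⟨ eq₁ θ ρ e ⟩
          16 * ρ * θ * e              ≤⟨ *-monoˡ-≤ e M-large ⟩
          M * e                       ≤⟨ Me≤4n ⟩
          4 * n                       ≤⟨ *-monoʳ-≤ 4 (all j) ⟩
          4 * (θ * neighbours j w)    ≡⟨ sym (*-assoc 4 θ (neighbours j w)) ⟩
          4 * θ * neighbours j w      ∎)
          where
          open ≤-Reasoning
          eq₁ : ∀ θ ρ e → 4 * θ * (4 * ρ * e) ≡ 16 * ρ * θ * e
          eq₁ = solve-∀

      sparse-type : ∀ w → ∃ λ i → suc (θ * neighbours i w) ≤ n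
      sparse-type w = case any¿ (λ i → suc (θ * neighbours i w) ≤¿ n) of λ
        { (yes p)   → p
        ; (no none) → ⊥-elim (not-spread w (λ i → ≮⇒≥ (λ lt → none (i , lt)))) }

      adjV : Fin n → Fin Q → Fin n → Bool
      adjV w k y = V k y ∧ J w y

      same : Fin n → Fin n → Bool
      same x y = does (any¿ (λ j → (V j x ∧ V j y) ≟ᴮ true))

      -- For fixed `w` and `x`, all triples with `y` in the same type as `x` have one colour, and
      -- `R` contains at most one triple of each colour.
      inner-row : ∀ w x → ∑ (λ y → 𝟙 (G w x y ∧ same x y)) ≤ 1
      inner-row w x = ∑-≤1 _ (λ _ → 𝟙≤1 _) λ y y′ p p′ → one (pos p) (pos p′)
        where
        pos : ∀ {b} → 0 < 𝟙 b → b ≡ true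
        pos {true} _ = refl
        one : ∀ {y y′} → G w x y ∧ same x y ≡ true → G w x y′ ∧ same x y′ ≡ true → y ≡ y′
        one {y} {y′} p p′ = G-third g₁ g₂ (trans (cong κ (rot y)) (trans coincide (cong κ (sym (rot y′)))))
          where
          g₁ : G w x y ≡ true
          g₁ = proj₁ (∧-true p)
          g₂ : G w x y′ ≡ true
          g₂ = proj₁ (∧-true p′)
          rot : ∀ z → tri w x z ≡ tri x z w
          rot z = trans (tri-swap w x z) (tri-swap′ x w z)
          s₁ : ∃ λ j → V j x ∧ V j y ≡ true
          s₁ = does⇒ (any¿ (λ j → (V j x ∧ V j y) ≟ᴮ true)) (proj₂ (∧-true {G w x y} p))
          s₂ : ∃ λ j → V j x ∧ V j y′ ≡ true
          s₂ = does⇒ (any¿ (λ j → (V j x ∧ V j y′) ≟ᴮ true)) (proj₂ (∧-true {G w x y′} p′))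
          inner : ∀ j {z} → G w x z ≡ true → V j x ≡ true → V j z ≡ true → Typed.Inner J τ₀ j x z w
          inner j gz vx vz = let wx , wz , xz = G-distinct gz in τ₀-complete vx , τ₀-complete vz , xz , (wx ∘ sym) , (wz ∘ sym)
          coincide : κ (tri x y w) ≡ κ (tri x y′ w)
          coincide = at (proj₁ s₁) (proj₁ s₂) (∧-true (proj₂ s₁)) (∧-true (proj₂ s₂))
            where
            at : ∀ j j′ → V j x ≡ true × V j y ≡ true → V j′ x ≡ true × V j′ y′ ≡ true → κ (tri x y w) ≡ κ (tri x y′ w)
            at j j′ (vx , vy) (vx′ , vy′) = same-colour τ₀ rob₀ j (inner j g₁ vx vy)
              (inner j g₂ vx (subst (λ l → V l y′ ≡ true) (V-unique x j′ j vx′ vx) vy′))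

      module AtVertex (w : Fin n) (i : Fin Q) where

        a b : Fin Q → ℕ
        a j = neighbours j w
        b = drop i a

        -- The ordered pairs of neighbours of `w` in two different parts other than `i`: up to small
        -- errors, an upper bound for the whole link. `χ` is their indicator.
        X : ℕ
        X = ∑ λ j → b j * ∑ (drop j b)

        indicator : Fin n → Fin Q → ℕ
        indicator x = drop i (λ j → 𝟙 (adjV w j x))

        χ : Fin n → Fin n → ℕ
        χ x y = ∑ λ j → indicator x j * ∑ (drop j (indicator y))

        ∑χ : ∑ (λ x → ∑ (χ x)) ≡ X
        ∑χ = begin-equality
          ∑ (λ x → ∑ (χ x))
            ≡⟨ trans (∑-cong λ x → ∑-swap _) (∑-swap _) ⟩
          ∑ (λ j → ∑ (λ x → ∑ (λ y → indicator x j * ∑ (drop j (indicator y)))))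
            ≡⟨ ∑-cong (λ j → trans (∑-cong λ x → ∑-*ˡ (indicator x j) _) (∑-*ʳ _ _)) ⟩
          ∑ (λ j → ∑ (λ x → indicator x j) * ∑ (λ y → ∑ (drop j (indicator y))))
            ≡⟨ ∑-cong (λ j → cong₂ _*_ (column j) (trans (∑-swap _) (∑-cong λ k → trans (∑-drop-swap j indicator k) (drop-cong j column k)))) ⟩
          X ∎
          where
          open ≤-Reasoning
          column : ∀ j → ∑ (λ x → indicator x j) ≡ b j
          column j = ∑-drop-swap i (λ x j → 𝟙 (adjV w j x)) j
          drop-cong : ∀ {q} (j : Fin q) {f f′ : Fin q → ℕ} → (∀ k → f k ≡ f′ k) → ∀ k → drop j f k ≡ drop j f′ k
          drop-cong j h k with j ≟ k
          ... | yes _ = refl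
          ... | no _ = h k

        α : ℕ
        α = neighbours i w

        bounds : Fin n → Fin n → ℕ
        bounds x y = 𝟙 (G w x y) * 𝟙 (not (J w x)) + (𝟙 (G w x y) * 𝟙 (not (J w y)) + (𝟙 (outside x) + (𝟙 (outside y) +
                     (𝟙 (adjV w i x) + (𝟙 (adjV w i y) + (𝟙 (G w x y ∧ same x y) + χ x y))))))

        -- A link pair not counted by `χ` leaves the neighbourhood of `w`, or has an end outside all
        -- `V j`, or has an end in `V i`, or lies inside one part; `bounds` has summands for each
        -- case.
        link-pointwise : ∀ x y → 𝟙 (G w x y) ≤ bounds x y
        link-pointwise x y = go (G w x y) refl (J w x) refl (J w y) refl (any¿ (λ j → V j x ≟ᴮ true)) refl (any¿ (λ j → V j y ≟ᴮ true)) refl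
          where
          skip : ∀ {a b c} → a ≤ c → a ≤ b + c
          skip {b = b} p = ≤-trans p (m≤n+m _ b)
          stop : ∀ {a b c} → a ≤ b → a ≤ b + c
          stop {c = c} p = ≤-trans p (m≤m+n _ c)
          one : ∀ {e} → e ≡ true → 1 ≤ 𝟙 e
          one refl = s≤s z≤n
          go : ∀ b₁ → G w x y ≡ b₁ → ∀ b₂ → J w x ≡ b₂ → ∀ b₃ → J w y ≡ b₃ →
               (d : Dec (∃ λ j → V j x ≡ true)) → does d ≡ does (any¿ (λ j → V j x ≟ᴮ true)) →
               (d′ : Dec (∃ λ j → V j y ≡ true)) → does d′ ≡ does (any¿ (λ j → V j y ≟ᴮ true)) → 𝟙 b₁ ≤ bounds x y
          go false _ _ _ _ _ _ _ _ _ = z≤n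
          go true g false e _ _ _ _ _ _ = stop (*-mono-≤ (one g) (one (cong not e)))
          go true g true _ false e _ _ _ _ = skip {b = 𝟙 (G w x y) * 𝟙 (not (J w x))} (stop (*-mono-≤ (one g) (one (cong not e))))
          go true g true jx true jy dx ex dy ey = skip {b = 𝟙 (G w x y) * 𝟙 (not (J w x))} (skip {b = 𝟙 (G w x y) * 𝟙 (not (J w y))} (typed dx ex dy ey))
            where
            different : ∀ j k → V j x ≡ true → V k y ≡ true → Dec (j ≡ i) → Dec (k ≡ i) → Dec (j ≡ k) →
              1 ≤ 𝟙 (adjV w i x) + (𝟙 (adjV w i y) + (𝟙 (G w x y ∧ same x y) + χ x y))
            different j k p r (yes refl) _ _ = stop (one (∧-true⁺ p jx))
            different j k p r (no _) (yes refl) _ = skip {b = 𝟙 (adjV w i x)} (stop (one (∧-true⁺ r jy)))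
            different j k p r (no _) (no _) (yes refl) = skip {b = 𝟙 (adjV w i x)} (skip {b = 𝟙 (adjV w i y)} (stop (one (∧-true⁺ g
              (dec-true (any¿ (λ j → (V j x ∧ V j y) ≟ᴮ true)) (j , ∧-true⁺ p r))))))
            different j k p r (no ji) (no ki) (no jk) = skip {b = 𝟙 (adjV w i x)} (skip {b = 𝟙 (adjV w i y)} (skip {b = 𝟙 (G w x y ∧ same x y)} (begin
              1                                               ≤⟨ *-mono-≤ (one (∧-true⁺ p jx)) (one (∧-true⁺ r jy)) ⟩
              𝟙 (adjV w j x) * 𝟙 (adjV w k y)                 ≡⟨ sym (cong₂ _*_ (drop-there i (λ j → 𝟙 (adjV w j x)) (ji ∘ sym)) (trans (drop-there j (indicator y) jk) (drop-there i (λ j → 𝟙 (adjV w j y)) (ki ∘ sym)))) ⟩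
              indicator x j * drop j (indicator y) k          ≤⟨ *-monoʳ-≤ (indicator x j) (term≤∑ (drop j (indicator y)) k) ⟩
              indicator x j * ∑ (drop j (indicator y))        ≤⟨ term≤∑ (λ j → indicator x j * ∑ (drop j (indicator y))) j ⟩
              χ x y                                           ∎)))
              where open ≤-Reasoning
            typed : (d : Dec (∃ λ j → V j x ≡ true)) → does d ≡ does (any¿ (λ j → V j x ≟ᴮ true)) →
               (d′ : Dec (∃ λ j → V j y ≡ true)) → does d′ ≡ does (any¿ (λ j → V j y ≟ᴮ true)) →
               1 ≤ 𝟙 (outside x) + (𝟙 (outside y) + (𝟙 (adjV w i x) + (𝟙 (adjV w i y) + (𝟙 (G w x y ∧ same x y) + χ x y))))
            typed (no _) e _ _ = stop (one (cong not (sym e)))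
            typed (yes _) _ (no _) e = skip {b = 𝟙 (outside x)} (stop (one (cong not (sym e))))
            typed (yes (j , p)) _ (yes (k , r)) _ = skip {b = 𝟙 (outside x)} (skip {b = 𝟙 (outside y)} (different j k p r (j ≟ i) (k ≟ i) (j ≟ k)))

        link-bound : link w ≤ 2 * (n * D) + 2 * (n * ν) + 2 * (n * α) + n + X
        link-bound = begin
          link w                                                     ≤⟨ ∑-mono (λ x → ∑-mono (link-pointwise x)) ⟩
          ∑ (λ x → ∑ (bounds x))                                     ≡⟨ trans (∑∑-+ _ _) (cong (S₁ +_) (trans (∑∑-+ _ _) (cong (S₂ +_) (trans (∑∑-+ _ _) (cong (S₃ +_)
                                                                        (trans (∑∑-+ _ _) (cong (S₄ +_) (trans (∑∑-+ _ _) (cong (S₅ +_) (trans (∑∑-+ _ _) (cong (S₆ +_) (∑∑-+ _ _)))))))))))) ⟩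
          S₁ + (S₂ + (S₃ + (S₄ + (S₅ + (S₆ + (S₇ + ∑ (λ x → ∑ (χ x))))))))
            ≤⟨ +-mono-≤ (sparse-rows w) (+-mono-≤ (sparse-columns w) (+-mono-≤ (≤-reflexive (rows _)) (+-mono-≤ (≤-reflexive (∑-const n ν))
                 (+-mono-≤ (≤-reflexive (rows _)) (+-mono-≤ (≤-reflexive (∑-const n α)) (+-mono-≤ (∑-bound (inner-row w)) (≤-reflexive ∑χ))))))) ⟩
          n * D + (n * D + (ν * n + (n * ν + (α * n + (n * α + (n * 1 + X))))))
                                                                     ≡⟨ eq n D ν α X ⟩
          2 * (n * D) + 2 * (n * ν) + 2 * (n * α) + n + X            ∎
          where
          open ≤-Reasoning
          S₁ = ∑ (λ x → ∑ (λ y → 𝟙 (G w x y) * 𝟙 (not (J w x))))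
          S₂ = ∑ (λ x → ∑ (λ y → 𝟙 (G w x y) * 𝟙 (not (J w y))))
          S₃ = ∑ (λ x → ∑ {n} (λ y → 𝟙 (outside x)))
          S₄ = ∑ {n} (λ x → ∑ (λ y → 𝟙 (outside y)))
          S₅ = ∑ (λ x → ∑ {n} (λ y → 𝟙 (adjV w i x)))
          S₆ = ∑ {n} (λ x → ∑ (λ y → 𝟙 (adjV w i y)))
          S₇ = ∑ (λ x → ∑ (λ y → 𝟙 (G w x y ∧ same x y)))
          rows : ∀ (P : Fin n → Bool) → ∑ (λ x → ∑ {n} (λ y → 𝟙 (P x))) ≡ card P * n
          rows P = trans (∑-cong λ x → trans (∑-const n (𝟙 (P x))) (*-comm n _)) (∑-*ʳ n _)
          eq : ∀ n D ν α X → n * D + (n * D + (ν * n + (n * ν + (α * n + (n * α + (n * 1 + X)))))) ≡ 2 * (n * D) + 2 * (n * ν) + 2 * (n * α) + n + X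
          eq = solve-∀

        U : ℕ
        U = h * n + n

        b≤U : ∀ j → h * Q * b j ≤ U
        b≤U j = ≤-trans (*-monoʳ-≤ (h * Q) (small j)) (upper j)
          where
          small : ∀ j → b j ≤ size-V j
          small j with i ≟ j
          ... | yes _ = z≤n
          ... | no _ = card-mono λ y p → proj₁ (∧-true p)

        -- Each `b l` is at most U/(h Q), so row `l` of `X` is at most `b l` times g U/(h Q). The
        -- `1 + g` parts other than `i` have at most (1 + g) U/(h Q) vertices together, and `w`
        -- misses `μ` of those in part `j`.
        products : ∀ j → i ≢ j → h * Q * (h * Q) * X + g * (h + 1) * n * (h * Q) * missing j w ≤ g * (1 + g) * ((h + 1) * (h + 1)) * (n * n)
        products j i≢j = begin
          h * Q * (h * Q) * X + g * (h + 1) * n * (h * Q) * μ   ≡⟨ eq₁ (h * Q) X g h n μ ⟩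
          h * Q * (h * Q * X) + h * Q * μ * (g * U)             ≤⟨ +-monoˡ-≤ _ (*-monoʳ-≤ (h * Q) step) ⟩
          h * Q * (∑ b * (g * U)) + h * Q * μ * (g * U)         ≡⟨ eq₂ (h * Q) (∑ b) μ (g * U) ⟩
          (h * Q * ∑ b + h * Q * μ) * (g * U)                   ≤⟨ *-monoˡ-≤ (g * U) sum ⟩
          (1 + g) * U * (g * U)                                 ≡⟨ eq₃ g h n ⟩
          g * (1 + g) * ((h + 1) * (h + 1)) * (n * n)           ∎
          where
          open ≤-Reasoning
          μ = missing j w
          eq₁ : ∀ k X g h n μ → k * k * X + g * (h + 1) * n * k * μ ≡ k * (k * X) + k * μ * (g * (h * n + n))
          eq₁ = solve-∀
          eq₂ : ∀ k S μ U → k * (S * U) + k * μ * U ≡ (k * S + k * μ) * U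
          eq₂ = solve-∀
          eq₃ : ∀ g h n → (1 + g) * (h * n + n) * (g * (h * n + n)) ≡ g * (1 + g) * ((h + 1) * (h + 1)) * (n * n)
          eq₃ = solve-∀
          row : ∀ l → h * Q * (b l * ∑ (drop l b)) ≤ b l * (g * U)
          row l = case i ≟ l of λ
            { (yes refl) → ≤-trans (≤-reflexive (trans (cong (λ z → h * Q * (z * ∑ (drop i b))) (drop-here i a)) (*-zeroʳ (h * Q)))) z≤n
            ; (no ne) → ≤-trans (≤-reflexive (trans (swap (h * Q) (b l) _) (cong (b l *_) (sym (∑-*ˡ (h * Q) (drop l b))))))
                (*-monoʳ-≤ (b l) (∑-two-zero (λ x → h * Q * drop l b x) i l ne
                  (trans (cong (h * Q *_) (trans (drop-there l b (ne ∘ sym)) (drop-here i a))) (*-zeroʳ (h * Q)))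
                  (trans (cong (h * Q *_) (drop-here l b)) (*-zeroʳ (h * Q)))
                  (λ x → ≤-trans (*-monoʳ-≤ (h * Q) (drop-≤-self l x)) (b≤U x)))) }
            where
            swap : ∀ k b s → k * (b * s) ≡ b * (k * s)
            swap = solve-∀
            drop-≤-self : ∀ l x → drop l b x ≤ b x
            drop-≤-self l x with l ≟ x
            ... | yes _ = z≤n
            ... | no _ = ≤-refl
          step : h * Q * X ≤ ∑ b * (g * U)
          step = ≤-trans (≤-reflexive (sym (∑-*ˡ (h * Q) _))) (≤-trans (∑-mono row) (≤-reflexive (∑-*ʳ (g * U) b)))
          sum : h * Q * ∑ b + h * Q * μ ≤ (1 + g) * U
          sum = begin
            h * Q * ∑ b + h * Q * μ                             ≡⟨ cong₂ _+_ (sym (∑-*ˡ (h * Q) b)) (sym (∑-point (λ _ → h * Q * μ) j)) ⟩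
            ∑ (λ l → h * Q * b l) + ∑ (λ l → 𝟙 (j ≐ l) * (h * Q * μ)) ≡⟨ sym (∑-+ _ _) ⟩
            ∑ (λ l → h * Q * b l + 𝟙 (j ≐ l) * (h * Q * μ))     ≤⟨ ∑-one-small _ i pw (≤-reflexive at-i) ⟩
            (1 + g) * U + 0                                     ≡⟨ +-identityʳ _ ⟩
            (1 + g) * U                                         ∎
            where
            at-i : h * Q * b i + 𝟙 (j ≐ i) * (h * Q * μ) ≡ 0
            at-i = cong₂ _+_ (trans (cong (h * Q *_) (drop-here i a)) (*-zeroʳ (h * Q))) (cong (λ t → 𝟙 t * (h * Q * μ)) (≢⇒≐ (i≢j ∘ sym)))
            pw : ∀ l → h * Q * b l + 𝟙 (j ≐ l) * (h * Q * μ) ≤ U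
            pw l with j ≟ l
            ... | no _ = ≤-trans (≤-reflexive (+-identityʳ _)) (b≤U l)
            ... | yes refl = ≤-trans (≤-reflexive (trans (cong (h * Q * b j +_) (*-identityˡ _)) (trans (cong (λ z → h * Q * z + h * Q * μ) (drop-there i a i≢j))
                    (trans (sym (*-distribˡ-+ (h * Q) (neighbours j w) μ)) (cong (h * Q *_) (neighbours+missing j w)))))) (upper j)

        nearly-complete : suc (θ * α) ≤ n → ∀ j → i ≢ j → θ′ * missing j w ≤ n
        nearly-complete θα j ne = link-arith g h n D c θ′ (link w) X ν α (missing j w) g≥1 h≥1 n≥1 (link-large w) link-bound (products j ne)
          few-outside (subst (λ t → t * α ≤ n) θ≡ (<⇒≤ θα)) h-large n-large
          where
          few-outside : 8 * θ′ * Q * ν ≤ n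
          few-outside = subst (λ t → t * ν ≤ n) θ≡ (*-cancelˡ-≤ 3 (≤-trans (≤-reflexive (sym (*-assoc 3 θ ν))) (≤-trans (*-monoˡ-≤ ν 3θ≤M) outside-few)))
            where
            3θ≤M : 3 * θ ≤ M
            3θ≤M = ≤-trans (*-monoˡ-≤ θ (≤-trans (s≤s (s≤s (s≤s z≤n))) (*-monoʳ-≤ 16 ρ≥1))) M-large

      type : Fin n → Fin Q
      type w = proj₁ (sparse-type w)

      8Q≤θ : 8 * Q ≤ θ
      8Q≤θ = ≤-trans (≤-trans (≤-reflexive (cong (_* Q) {8} {8 * 1} refl)) (*-monoˡ-≤ Q (*-monoʳ-≤ 8 θ′≥1))) (≤-reflexive (sym θ≡))

      16θ≤M : 16 * θ ≤ M
      16θ≤M = ≤-trans (*-monoˡ-≤ θ (*-monoʳ-≤ 16 ρ≥1)) M-large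

      V-large : ∀ i → n ≤ 2 * Q * size-V i
      V-large = size-V-large (≤-trans 8Q≤θ (≤-trans (m≤m+n θ (15 * θ)) 16θ≤M))

      -- A vertex of `V j` is adjacent to almost all of every other `V i`, so `sparse-type` cannot
      -- have selected such an `i`.
      type-V : ∀ j x → V j x ≡ true → type x ≡ j
      type-V j x p = decidable-stable (type x ≟ j) λ ne → absurd (type x) (proj₂ (sparse-type x)) (ne ∘ sym)
        where
        absurd : ∀ i → suc (θ * neighbours i x) ≤ n → j ≢ i → ⊥
        absurd i θa ne = <⇒≱ (+-mono-≤-< ≤-refl (≤-trans n≥1 (m≤m+n n (n + 0)))) (begin
          n + n + (n + (n + 0))                                   ≡⟨ eq n ⟩
          4 * n                                                   ≤⟨ *-monoʳ-≤ 4 (V-large i) ⟩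
          4 * (2 * Q * size-V i)                                  ≡⟨ trans (cong (λ z → 4 * (2 * Q * z)) (sym (neighbours+missing i x))) (eq₂ Q (neighbours i x) (missing i x)) ⟩
          8 * Q * neighbours i x + 8 * Q * missing i x            ≤⟨ +-mono-≤ (≤-trans (*-monoˡ-≤ (neighbours i x) 8Q≤θ) (<⇒≤ θa)) few ⟩
          n + n                                                   ≡⟨ sym (+-identityʳ (n + n)) ⟩
          n + n + 0                                               ∎)
          where
          open ≤-Reasoning
          few : 8 * Q * missing i x ≤ n
          few = *-cancelˡ-≤ 4 (≤-trans (≤-reflexive (sym (*-assoc 4 (8 * Q) (missing i x)))) (≤-trans (*-monoˡ-≤ (missing i x)
                  (≤-trans (*-mono-≤ {4} {16} (s≤s (s≤s (s≤s (s≤s z≤n)))) 8Q≤θ) 16θ≤M)) (few-missing p ne)))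
          eq : ∀ n → n + n + (n + (n + 0)) ≡ 4 * n
          eq = solve-∀
          eq₂ : ∀ Q a b → 4 * (2 * Q * (a + b)) ≡ 8 * Q * a + 8 * Q * b
          eq₂ = solve-∀

      -- Every vertex, even one outside all `V j`, misses at most n/θ′ vertices of each `V j` of
      -- another type. Since `V j` has at least n/(2 Q) vertices, `θ′ = 8 * Q * ρ` is large enough.
      type-robust : Typed.Robust J (just ∘ type) ρ
      type-robust with quotient θ′ n θ′≥1
      ... | e , θe≤n , bound = robust-by (just ∘ type) ρ (λ _ x → x) V e e≥1 (λ _ p → p) (λ j x p → cong just (type-V j x p)) miss
              (λ j → 4ρe e (size-V j) e≥1 (enough j))
        where
        e≥1 : 1 ≤ e
        e≥1 = bound 1 (≤-trans (≤-reflexive (*-identityʳ θ′)) θ′≤n)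
        miss : ∀ j x i → just (type x) ≡ just i → i ≢ j → missing j x ≤ e
        miss j x .(type x) refl ne = bound (missing j x) (AtVertex.nearly-complete x (type x) (proj₂ (sparse-type x)) j ne)
        enough : ∀ j → 4 * ρ * e ≤ size-V j
        enough j = *-cancelˡ-≤ (2 * Q) (begin
          2 * Q * (4 * ρ * e)      ≡⟨ eq Q ρ e ⟩
          8 * Q * ρ * e            ≡⟨ cong (_* e) (sym θ′≡) ⟩
          θ′ * e                   ≤⟨ θe≤n ⟩
          n                        ≤⟨ V-large j ⟩
          2 * Q * size-V j         ∎)
          where
          open ≤-Reasoning
          eq : ∀ Q ρ e → 2 * Q * (4 * ρ * e) ≡ 8 * Q * ρ * e
          eq = solve-∀

-- Large minimum degree forces a rainbow copy

-- The reciprocals of `θ′`, `θ`, `M` and `h` are the proportions of `n` tolerated in the different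
-- estimates, and `T` is the part size of the core. `E₁`, `E₂` and `E₃` are the thresholds for `n`
-- demanded by `good-degree`, `core` and `link-arith`.
module Constants (F : Graph) (g c : ℕ) where
  open Graph F using (m; k)

  Q ρ σ D θ′ θ M h T : ℕ
  Q = 2 + g
  ρ = m + (k + 12)
  σ = suc (ρ + ρ)
  D = suc (m + k + (m + k))
  θ′ = 8 * Q * ρ
  θ = 8 * θ′ * Q
  M = 16 * ρ * θ
  h = σ * M
  T = σ * h

  M₁ M₀ E₁ b₀ E₂ E₃ size₀ : ℕ
  M₁ = 2 * (h * (1 + g))
  M₀ = Q * Q * ((1 + g) * M₁)
  E₁ = h * h * (Q * Q * proj₁ (erdős-stone g (ρ + ρ) (pred M₁)) + (1 + g) * M₁ * (Q * Q * (2 * D) + c))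
  b₀ = M₀ * D
  E₂ = h * Q * proj₁ (erdős-stone g (pred T) (pred (2 * Q))) + (1 + g) * (2 * Q) * (h * Q + 1) * b₀ + b₀
  E₃ = 4 * θ′ * (Q * Q * (2 * D + 1) + c)
  size₀ = suc (E₁ + E₂ + M * b₀ + M + θ′ + E₃)

-- The whole structure is passed on as robustness of a total typing; the common colour inside each
-- type then follows from `same-colour`.
structured : ∀ (F : Graph) {g} → 1 ≤ g → (crit : Critical F (2 + g)) → ∀ c {n} → Constants.size₀ F g c ≤ n →
  ∀ {κ : Subset n → ℕ} {R} (reps : Representatives κ R) → ¬ HasRainbowCopy κ (expansion3 F) →
  (∀ w → (1 + g) * g * (n * n) ≤ (2 + g) * (2 + g) * Family.link reps w + c * n) →
  ∃ λ (type : Fin n → Fin (2 + g)) → Embedding.Typed.Robust F κ (Fat.J F reps) (just ∘ type) (Graph.m F + (Graph.k F + 12))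
structured F {g} g≥1 crit c {n} large {κ} reps noRainbow link-large = type , type-robust
  where
  open Constants F g c hiding (M₁; M₀)
  ρ≥1 : 1 ≤ ρ
  ρ≥1 = ≤-trans (≤-trans (s≤s z≤n) (m≤n+m 12 (Graph.k F))) (m≤n+m (Graph.k F + 12) (Graph.m F))
  θ′≥1 : 1 ≤ θ′
  θ′≥1 = *-mono-≤ {1} {8 * Q} (s≤s z≤n) ρ≥1
  θ≥1 : 1 ≤ θ
  θ≥1 = *-mono-≤ {1} {8 * θ′} {1} {Q} (*-mono-≤ {1} {8} (s≤s z≤n) θ′≥1) (s≤s z≤n)
  M≥1 : 1 ≤ M
  M≥1 = *-mono-≤ {1} {16 * ρ} {1} {θ} (*-mono-≤ {1} {16} (s≤s z≤n) ρ≥1) θ≥1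
  h≥1 : 1 ≤ h
  h≥1 = *-mono-≤ {1} {σ} {1} {M} (s≤s z≤n) M≥1
  T≥1 : 1 ≤ T
  T≥1 = *-mono-≤ {1} {σ} {1} {h} (s≤s z≤n) h≥1
  M≤h : M ≤ h
  M≤h = m≤m+n M _
  n≥1 : 1 ≤ n
  n≥1 = ≤-trans (s≤s z≤n) large
  ≤-sum₁ : E₁ < n
  ≤-sum₁ = ≤-trans (s≤s (≤-trans (m≤m+n E₁ E₂) (≤-trans (m≤m+n _ (M * b₀)) (≤-trans (m≤m+n _ M) (≤-trans (m≤m+n _ θ′) (m≤m+n _ E₃)))))) large
  ≤-sum₂ : E₂ < n
  ≤-sum₂ = ≤-trans (s≤s (≤-trans (m≤n+m E₂ E₁) (≤-trans (m≤m+n _ (M * b₀)) (≤-trans (m≤m+n _ M) (≤-trans (m≤m+n _ θ′) (m≤m+n _ E₃)))))) large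
  ≤-sum₃ : M * b₀ ≤ n
  ≤-sum₃ = ≤-trans (≤-trans (m≤n+m (M * b₀) (E₁ + E₂)) (≤-trans (m≤m+n _ M) (≤-trans (m≤m+n _ θ′) (m≤m+n _ E₃)))) (<⇒≤ large)
  ≤-sum₄ : M ≤ n
  ≤-sum₄ = ≤-trans (≤-trans (m≤n+m M (E₁ + E₂ + M * b₀)) (≤-trans (m≤m+n _ θ′) (m≤m+n _ E₃))) (<⇒≤ large)
  ≤-sum₅ : θ′ ≤ n
  ≤-sum₅ = ≤-trans (≤-trans (m≤n+m θ′ (E₁ + E₂ + M * b₀ + M)) (m≤m+n _ E₃)) (<⇒≤ large)
  ≤-sum₆ : E₃ ≤ n
  ≤-sum₆ = ≤-trans (m≤n+m E₃ (E₁ + E₂ + M * b₀ + M + θ′)) (<⇒≤ large)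
  open Counting F g≥1 crit n≥1 reps noRainbow c link-large using (module Scale; module Partition; J)
  θ≤M : θ ≤ M
  θ≤M = ≤-trans (≤-reflexive (sym (*-identityˡ θ))) (*-monoˡ-≤ θ (*-mono-≤ {1} {16} (s≤s z≤n) ρ≥1))
  2Q≤h : 2 * Q ≤ h
  2Q≤h = ≤-trans (≤-trans (*-monoˡ-≤ Q (≤-trans (s≤s (s≤s z≤n)) (*-monoʳ-≤ 8 θ′≥1))) θ≤M) M≤h
  12θ′g≤h : 12 * θ′ * g ≤ h
  12θ′g≤h = ≤-trans (≤-trans (≤-trans (m≤m+n _ (θ′ * (4 * g + 32))) (≤-reflexive (eq θ′ g)))
    (*-monoˡ-≤ θ (≤-trans (s≤s (s≤s z≤n)) (*-monoʳ-≤ 16 ρ≥1)))) M≤h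
    where
    eq : ∀ t g → 12 * t * g + t * (4 * g + 32) ≡ 2 * (8 * t * (2 + g))
    eq = solve-∀
  K : Blowup J (Scale.good h h≥1) Q T
  K = subst (Blowup J (Scale.good h h≥1) Q) (suc-pred′ T T≥1) (Scale.core h h≥1 (pred T) 2Q≤h ≤-sum₁ ≤-sum₂)
  open Partition M h T M≥1 h≥1 refl refl K ≤-sum₁ ≤-sum₃ using (module Types)
  open Types θ θ′ θ≥1 θ′≥1 refl refl ≤-refl 12θ′g≤h ≤-sum₄ ≤-sum₅ ≤-sum₆ using (type; type-robust)

-- The upper bound

∈-allSubsets : ∀ {n} (s : Subset n) → s ∈ allSubsets n
∈-allSubsets [] = here refl
∈-allSubsets {suc n} (true ∷ s)  = ∈ₚ.∈-++⁺ˡ (∈ₚ.∈-map⁺ (true ∷_) (∈-allSubsets s))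
∈-allSubsets {suc n} (false ∷ s) = ∈ₚ.∈-++⁺ʳ (map (true ∷_) (allSubsets n)) (∈ₚ.∈-map⁺ (false ∷_) (∈-allSubsets s))

∈-triples : ∀ {n} (s : Subset n) → ∣ s ∣ ≡ 3 → s ∈ triples n
∈-triples s e = ∈ₚ.∈-filter⁺ (λ s → ∣ s ∣ ≟ℕ 3) (∈-allSubsets s) e

unique-map-on : ∀ {A B : Set} (f : A → B) {xs} → (∀ {x y} → x ∈ xs → y ∈ xs → f x ≡ f y → x ≡ y) → Unique xs → Unique (map f xs)
unique-map-on f inj [] = []
unique-map-on f {x ∷ xs} inj (a ∷ u) = Allₚ.map⁺ (All.tabulate (λ y∈ e → All.lookup a y∈ (inj (here refl) (there y∈) e))) ∷
  unique-map-on f (λ p q → inj (there p) (there q)) u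

-- Treat the tails first, then compose with the transposition of `σ a` and `b`; it fixes the images
-- of the tail, which avoid both.
extend-injection : ∀ {q} (as bs : List (Fin q)) → Unique as → Unique bs → length as ≡ length bs →
  Σ (Fin q → Fin q) λ σ → Injective _≡_ _≡_ σ × map σ as ≡ bs
extend-injection [] [] _ _ _ = id , id , refl
extend-injection (a ∷ as) (b ∷ bs) (a∉ ∷ ua) (b∉ ∷ ub) e =
  let σ , inj , eq = extend-injection as bs ua ub (suc-injective e)
  in PC.transpose (σ a) b ∘ σ , (λ e → inj (transpose-injective (σ a) b e)) ,
     cong₂ _∷_ (transpose-at (σ a) b) (trans (rec σ inj as a∉ (subst (All (b ≢_)) (sym eq) b∉)) eq)
  where
  rec : ∀ σ → Injective _≡_ _≡_ σ → ∀ xs → All (a ≢_) xs → All (b ≢_) (map σ xs) → map (PC.transpose (σ a) b ∘ σ) xs ≡ map σ xs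
  rec σ inj [] _ _ = refl
  rec σ inj (x ∷ xs) (p ∷ ps) (r ∷ rs) = cong₂ _∷_ (transpose-fixes (σ a) b (λ e → p (inj (sym e))) (r ∘ sym)) (rec σ inj xs ps rs)

lookup-∩ : ∀ {n} (s t : Subset n) x → lookup (s ∩ t) x ≡ true → lookup s x ≡ true × lookup t x ≡ true
lookup-∩ s t x e = ∧-true (trans (sym (Vecₚ.lookup-zipWith _∧_ x s t)) e)

lookup-partOf : ∀ {n q} (τ : Fin n → Fin q) t x → lookup (partOf τ t) x ≡ true → τ x ≡ t
lookup-partOf τ t x e = ≐⇒≡ {x = τ x} {t} (trans (sym (Vecₚ.lookup∘tabulate (λ x → τ x ≐ t) x)) e)

crowded-part : ∀ {n q} (τ : Fin n → Fin q) s t → ∣ s ∣ ≡ 3 → 1 < ∣ s ∩ partOf τ t ∣ →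
  ∃ λ x → ∃ λ y → ∃ λ z → s ≡ tri x y z × τ x ≡ t × τ y ≡ t
crowded-part τ s t e two with member (s ∩ partOf τ t) {pred ∣ s ∩ partOf τ t ∣} (sym (suc-pred _ {{>-nonZero (<⇒≤ two)}}))
... | x , px with lookup-∩ s (partOf τ t) x px
...   | xs , xt with pair-from s x xs e
...     | a , b , refl = choose (τ a ≟ t) (τ b ≟ t)
  where
  τx : τ x ≡ t
  τx = lookup-partOf τ t x xt
  choose : Dec (τ a ≡ t) → Dec (τ b ≡ t) → ∃ λ x′ → ∃ λ y → ∃ λ z → tri x a b ≡ tri x′ y z × τ x′ ≡ t × τ y ≡ t
  choose (yes p) _ = x , a , b , refl , τx , p
  choose (no _) (yes p) = x , b , a , tri-swap′ x a b , τx , p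
  choose (no na) (no nb) = ⊥-elim (<⇒≱ two (≤-trans (Subₚ.p⊆q⇒∣p∣≤∣q∣ only) (≤-reflexive (Subₚ.∣⁅x⁆∣≡1 x))))
    where
    only : ∀ {w} → w ∈ˢ (tri x a b ∩ partOf τ t) → w ∈ˢ ⁅ x ⁆
    only {w} p with Subₚ.x∈p∩q⁻ (tri x a b) (partOf τ t) p
    ... | p₁ , p₂ with ∈-tri x a b w p₁
    ...   | inj₁ refl = Subₚ.x∈⁅x⁆ w
    ...   | inj₂ (inj₁ refl) = ⊥-elim (na (lookup-partOf τ t w (Vecₚ.[]=⇒lookup p₂)))
    ...   | inj₂ (inj₂ refl) = ⊥-elim (nb (lookup-partOf τ t w (Vecₚ.[]=⇒lookup p₂)))

not-crossing : ∀ {n q} (τ : Fin n → Fin q) s → ¬ Crossing τ s → ∃ λ t → 1 < ∣ s ∩ partOf τ t ∣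
not-crossing τ s nc = let t , p = Finₚ.¬∀⟶∃¬ _ _ (λ t → ∣ s ∩ partOf τ t ∣ ≤? 1) nc in t , ≰⇒> p

module ClassFacts (F : Graph) {q : ℕ} (π : Fin (Graph.m F) → Fin q) where
  open Graph F

  monoIn? : ∀ t i → Dec (π (u F i) ≡ t × π (v F i) ≡ t)
  monoIn? t i = (π (u F i) ≟ t) ×-dec (π (v F i) ≟ t)

  eIn≥1 : ∀ i {t} → π (u F i) ≡ t → π (v F i) ≡ t → 1 ≤ eIn F π t
  eIn≥1 i {t} p r = unique-⊆⇒length≤ {xs = i ∷ []} ([] ∷ []) λ { (here refl) → ∈ₚ.∈-filter⁺ (monoIn? t) (∈ₚ.∈-allFin i) (p , r) }

  eIn≥2 : ∀ i j {t} → i ≢ j → π (u F i) ≡ t → π (v F i) ≡ t → π (u F j) ≡ t → π (v F j) ≡ t → 2 ≤ eIn F π t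
  eIn≥2 i j {t} ne p r p′ r′ = unique-⊆⇒length≤ {xs = i ∷ j ∷ []} ((ne ∷ []) ∷ [] ∷ []) λ
    { (here refl) → ∈ₚ.∈-filter⁺ (monoIn? t) (∈ₚ.∈-allFin i) (p , r)
    ; (there (here refl)) → ∈ₚ.∈-filter⁺ (monoIn? t) (∈ₚ.∈-allFin j) (p′ , r′) }

  eIn-pos : ∀ t → 1 ≤ eIn F π t → ∃ λ i → π (u F i) ≡ t × π (v F i) ≡ t
  eIn-pos t le with filter (monoIn? t) (allFin k) in eq
  ... | i ∷ _ = i , proj₂ (∈ₚ.∈-filter⁻ (monoIn? t) {xs = allFin k} (subst (i ∈_) (sym eq) (here refl)))

  eIn-two : ∀ t → 2 ≤ eIn F π t → ∃ λ i → ∃ λ j → i ≢ j × (π (u F i) ≡ t × π (v F i) ≡ t) × (π (u F j) ≡ t × π (v F j) ≡ t)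
  eIn-two t le with filter (monoIn? t) (allFin k) in eq
  ... | i ∷ j ∷ _ with subst Unique eq (Uniqueₚ.filter⁺ (monoIn? t) (Uniqueₚ.allFin⁺ k))
  ...   | (ne ∷ _) ∷ _ = i , j , ne , proj₂ (∈ₚ.∈-filter⁻ (monoIn? t) {xs = allFin k} (subst (i ∈_) (sym eq) (here refl))) ,
                         proj₂ (∈ₚ.∈-filter⁻ (monoIn? t) {xs = allFin k} (subst (j ∈_) (sym eq) (there (here refl))))
  eIn-two t (s≤s ()) | _ ∷ []

  singles : List (Fin q)
  singles = filter (λ t → eIn F π t ≟ℕ 1) (allFin q)

  singles-unique : Unique singles
  singles-unique = Uniqueₚ.filter⁺ (λ t → eIn F π t ≟ℕ 1) (Uniqueₚ.allFin⁺ q)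

  ∈-singles : ∀ {t} → eIn F π t ≡ 1 → t ∈ singles
  ∈-singles {t} e = ∈ₚ.∈-filter⁺ (λ t → eIn F π t ≟ℕ 1) (∈ₚ.∈-allFin t) e

  singles⁻ : ∀ {t} → t ∈ singles → eIn F π t ≡ 1
  singles⁻ p = proj₂ (∈ₚ.∈-filter⁻ (λ t → eIn F π t ≟ℕ 1) {xs = allFin q} p)

  norm1-singles : (∀ t → eIn F π t ≤ 1) → norm1 F π ≡ length singles
  norm1-singles le = count (allFin q)
    where
    count : ∀ ts → ListAction.sum (map (eIn F π) ts) ≡ length (filter (λ t → eIn F π t ≟ℕ 1) ts)
    count [] = refl
    count (t ∷ ts) with eIn F π t in eq | le t
    ... | zero  | _ = count ts
    ... | suc zero | _ = cong suc (count ts)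
    ... | suc (suc _) | le₂ = ⊥-elim (<⇒≱ (s≤s (s≤s z≤n)) le₂)

no-many-representatives : ∀ (F : Graph) {g} → 1 ≤ g → (crit : Critical F (2 + g)) → ∀ {ℓ} → ℓ ≤ 3 + g → InClass F (3 + g) ℓ → ∀ {n}
  {κ : Subset n → ℕ} {R} (reps : Representatives κ R) → ¬ HasRainbowCopy κ (expansion3 F) →
  (type : Fin n → Fin (2 + g)) → Embedding.Typed.Robust F κ (Fat.J F reps) (just ∘ type) (Graph.m F + (Graph.k F + 12)) →
  ¬ (tp3 (3 + g) n + ℓ ≤ length R)
no-many-representatives F {g} g≥1 crit {ℓ} ℓ≤ class {n} {κ} {R} reps noRainbow type rob many = finish class
  where
  open Graph F using (m; k)
  open Structure F crit reps noRainbow using (J; J-sym; J-extensible; same-colour)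
  open Embedding.Typed F κ J (just ∘ type) using (Inner; embed-classes)
  Q = 2 + g
  τ : Fin n → Maybe (Fin Q)
  τ = just ∘ type

  typical : ∀ t → ∃ λ x → ∃ λ y → ∃ λ z → Inner t x y z
  typical t =
    let x , px , _ = rob t [] z≤n
        y , py , y∉ , _ = rob t (x ∷ []) (≤-trans (s≤s z≤n) (≤-trans (m≤n+m 12 k) (m≤n+m _ m)))
        z , _ , z∉ , _ = rob t (x ∷ y ∷ []) (≤-trans (s≤s (s≤s z≤n)) (≤-trans (m≤n+m 12 k) (m≤n+m _ m)))
    in x , y , z , px , py , (λ e → y∉ (here (sym e))) , (λ e → z∉ (here (sym e))) , λ e → z∉ (there (here (sym e)))

  -- By `colour` this is the colour of all triples with two vertices in type `t`; `R` need not
  -- contain any of them.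
  c : Fin Q → ℕ
  c t = let x , y , z , _ = typical t in κ (tri x y z)

  colour : ∀ t {x y z} → Inner t x y z → κ (tri x y z) ≡ c t
  colour t I = let _ , _ , _ , I′ = typical t in same-colour τ rob t I I′

  I : List (Subset n)
  I = filter (¬? ∘ crossing? type) R

  ℓ≤I : ℓ ≤ length I
  ℓ≤I = +-cancelˡ-≤ (tp3 (3 + g) n) _ _ (≤-trans many (≤-trans (≤-reflexive (length-filter-split (crossing? type) R))
    (+-monoˡ-≤ (length I) (≤-trans (unique-⊆⇒length≤ (Uniqueₚ.filter⁺ (crossing? type) (Uniqueₚ.map⁻ (Representatives.rainbow reps))) inside)
      (Residues.crossing-max (1 + g) n type)))))
    where
    inside : ∀ {s} → s ∈ filter (crossing? type) R → s ∈ filter (crossing? type) (triples n)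
    inside p = let s∈ , cr = ∈ₚ.∈-filter⁻ (crossing? type) {xs = R} p in
      ∈ₚ.∈-filter⁺ (crossing? type) (∈-triples _ (All.lookup (Representatives.sizes reps) s∈)) cr

  coloured : All (λ s → ∃ λ t → κ s ≡ c t) I
  coloured = All.map (λ { {s} (nc , e) → one s nc e }) (All.zip (Allₚ.all-filter (¬? ∘ crossing? type) R , Allₚ.filter⁺ (¬? ∘ crossing? type) (Representatives.sizes reps)))
    where
    one : ∀ s → ¬ Crossing type s → ∣ s ∣ ≡ 3 → ∃ λ t → κ s ≡ c t
    one s nc e = from (crowded-part type s (proj₁ crowd) e (proj₂ crowd))
      where
      crowd : ∃ λ t → 1 < ∣ s ∩ partOf type t ∣
      crowd = not-crossing type s nc
      from : ∀ {t} → (∃ λ x → ∃ λ y → ∃ λ z → s ≡ tri x y z × type x ≡ t × type y ≡ t) → ∃ λ t → κ s ≡ c t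
      from {t} (x , y , z , eq , τx , τy) =
        t , trans (cong κ eq) (colour t {x} {y} {z} (cong just τx , cong just τy , tri-distinct x y z (trans (cong ∣_∣ (sym eq)) e)))

  types : ∀ S → All (λ s → ∃ λ t → κ s ≡ c t) S → ∃ λ Ts → map c Ts ≡ map κ S
  types [] [] = [] , refl
  types (s ∷ S) ((t , e) ∷ al) = let Ts , eq = types S al in t ∷ Ts , cong₂ _∷_ (sym e) eq

  all-types : ∃ λ Ts → map c Ts ≡ map κ I
  all-types = types I coloured

  -- Exactly `ℓ` types, because `extend-injection` needs as many as there are parts of `π`
  -- containing an edge.
  Ts : List (Fin Q)
  Ts = List.take ℓ (proj₁ all-types)

  c-unique : Unique (map c Ts)
  c-unique = subst Unique (Listₚ.take-map {f = c} ℓ (proj₁ all-types)) (Uniqueₚ.take⁺ ℓ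
    (subst Unique (sym (proj₂ all-types)) (unique-filter-map κ (¬? ∘ crossing? type) R (Representatives.rainbow reps))))

  Ts-length : length Ts ≡ ℓ
  Ts-length = trans (Listₚ.length-take ℓ _) (m≤n⇒m⊓n≡m (≤-trans ℓ≤I (≤-reflexive (trans (sym (Listₚ.length-map κ I))
    (trans (cong length (sym (proj₂ all-types))) (Listₚ.length-map c (proj₁ all-types)))))))

  finish : InClass F (3 + g) ℓ → ⊥
  -- Here `ℓ` is larger than the number of types.
  finish (inj₂ (refl , _)) = <⇒≱ ≤-refl (≤-trans (≤-reflexive (sym Ts-length))
    (≤-trans (unique-⊆⇒length≤ (Uniqueₚ.map⁻ c-unique) (λ {t} _ → ∈ₚ.∈-allFin t)) (≤-reflexive (Listₚ.length-tabulate {n = Q} id))))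
  finish (inj₁ (_ , _ , (π , (le , _) , norm) , _)) = noRainbow (embed-classes J-sym J-extensible rob (σ ∘ π) c uniform separated)
    where
    open ClassFacts F π
    extension : Σ (Fin Q → Fin Q) λ σ → Injective _≡_ _≡_ σ × map σ singles ≡ Ts
    extension = extend-injection singles Ts singles-unique (Uniqueₚ.map⁻ c-unique)
      (trans (sym (norm1-singles le)) (trans norm (sym Ts-length)))
    σ : Fin Q → Fin Q
    σ = proj₁ extension
    σ-inj : Injective _≡_ _≡_ σ
    σ-inj = proj₁ (proj₂ extension)
    in-Ts : ∀ i → σ (π (u F i)) ≡ σ (π (v F i)) → σ (π (u F i)) ∈ Ts
    in-Ts i mono = subst (σ (π (u F i)) ∈_) (proj₂ (proj₂ extension)) (∈ₚ.∈-map⁺ σ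
      (∈-singles (≤-antisym (le _) (eIn≥1 i refl (sym (σ-inj mono))))))
    uniform : ∀ i → σ (π (u F i)) ≡ σ (π (v F i)) → ∀ {x y z} → Inner (σ (π (u F i))) x y z → κ (tri x y z) ≡ c (σ (π (u F i)))
    uniform i _ = colour _
    separated : ∀ i j → i ≢ j → σ (π (u F i)) ≡ σ (π (v F i)) → σ (π (u F j)) ≡ σ (π (v F j)) → c (σ (π (u F i))) ≢ c (σ (π (u F j)))
    separated i j ne mi mj e = <⇒≱ (eIn≥2 i j ne refl (sym (σ-inj mi)) (sym same) (trans (sym (σ-inj mj)) (sym same))) (le _)
      where
      same : π (u F i) ≡ π (u F j)
      same = σ-inj (unique-map-injective c c-unique (in-Ts i mi) (in-Ts j mj) e)

consᶠ : ∀ {a n} → Fin n → (Fin a → Fin n) → Fin (suc a) → Fin n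
consᶠ x f zero    = x
consᶠ x f (suc i) = f i

-- Exhaustive search over the values. `P` must respect pointwise equality, because a function
-- rebuilt from its values agrees with the original only pointwise.
any-function? : ∀ a {n} (P : (Fin a → Fin n) → Set) → (∀ f f′ → (∀ i → f i ≡ f′ i) → P f → P f′) → (∀ f → Dec (P f)) → Dec (∃ P)
any-function? zero {n} P ext P? = map′ (empty ,_) (λ { (f , p) → ext f empty (λ ()) p }) (P? empty)
  where
  empty : Fin 0 → Fin n
  empty ()
any-function? (suc a) {n} P ext P? = map′ (λ { (x , f , p) → consᶠ x f , p })
  (λ { (f , p) → f zero , f ∘ suc , ext f (consᶠ (f zero) (f ∘ suc)) (λ { zero → refl ; (suc i) → refl }) p })
  (Finₚ.any? λ x → any-function? a (P ∘ consᶠ x) (λ f f′ e → ext (consᶠ x f) (consᶠ x f′) (λ { zero → refl ; (suc i) → e i })) (P? ∘ consᶠ x))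

-- Decidability is what allows `forces` to obtain a copy by refuting its absence.
hasRainbowCopy? : ∀ {n} (κ : Subset n → ℕ) H → Dec (HasRainbowCopy κ H)
hasRainbowCopy? {n} κ H = any-function? nv _ ext (λ φ → injective? φ ×-dec Finₚ.all? λ i → Finₚ.all? λ j → distinct? φ i j)
  where
  open Graph3 H
  injective? : ∀ φ → Dec (Injective _≡_ _≡_ φ)
  injective? φ = map′ (λ h {x} {y} → h x y) (λ h x y → h) (Finₚ.all? λ x → Finₚ.all? λ y → implies? (φ x ≟ φ y) (x ≟ y))
    where
    implies? : ∀ {P Q : Set} → Dec P → Dec Q → Dec (P → Q)
    implies? _ (yes q) = yes (λ _ → q)
    implies? (yes p) (no ¬q) = no (λ f → ¬q (f p))
    implies? (no ¬p) _ = yes (λ p → ⊥-elim (¬p p))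
  distinct? : ∀ φ i j → Dec (i ≢ j → κ (img3 φ (edge i)) ≢ κ (img3 φ (edge j)))
  distinct? φ i j with i ≟ j | κ (img3 φ (edge i)) ≟ℕ κ (img3 φ (edge j))
  ... | yes e | _ = yes (λ ne → ⊥-elim (ne e))
  ... | no _  | no ne = yes (λ _ → ne)
  ... | no ne | yes e = no (λ h → h ne e)
  img-cong : ∀ {φ ψ : Fin nv → Fin n} → (∀ x → φ x ≡ ψ x) → ∀ t → img3 φ t ≡ img3 ψ t
  img-cong e (x , y , z) = cong₂ _∪_ (cong ⁅_⁆ (e x)) (cong₂ _∪_ (cong ⁅_⁆ (e y)) (cong ⁅_⁆ (e z)))
  ext : ∀ φ ψ → (∀ x → φ x ≡ ψ x) →
    Injective _≡_ _≡_ φ × (∀ i j → i ≢ j → κ (img3 φ (edge i)) ≢ κ (img3 φ (edge j))) →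
    Injective _≡_ _≡_ ψ × (∀ i j → i ≢ j → κ (img3 ψ (edge i)) ≢ κ (img3 ψ (edge j)))
  ext φ ψ e (inj , dist) = (λ {x} {y} p → inj (trans (e x) (trans p (sym (e y))))) ,
    λ i j ne p → dist i j ne (trans (cong κ (img-cong e (edge i))) (trans p (sym (cong κ (img-cong e (edge j))))))

record Excess (F : Graph) (p n e : ℕ) : Set where
  field
    κ         : Subset n → ℕ
    R         : List (Subset n)
    reps      : Representatives κ R
    noRainbow : ¬ HasRainbowCopy κ (expansion3 F)
    many      : tp3 p n + e ≤ length R

-- A vertex of small degree can be deleted at the price of increasing the excess, and the minimum degree
-- cannot be large by the structure theorem.
module Descent (F : Graph) {g : ℕ} (g≥1 : 1 ≤ g) (crit : Critical F (2 + g)) {ℓ : ℕ} (ℓ≤ : ℓ ≤ 3 + g) (class : InClass F (3 + g) ℓ) where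

  Q c N : ℕ
  Q = 2 + g
  -- The linear error term that rounding `n / Q` causes in `link-large`.
  c = 2 * ((1 + g) * g * (Q * Q))
  N = Constants.size₀ F g c

  module _ {n e : ℕ} (B : Excess F (3 + g) (suc n) e) where
    open Excess B

    remaining : Fin (suc n) → List (Subset (suc n))
    remaining w = filter (¬? ∘ contains? w) R

    delete : ∀ w → tp3 (3 + g) n + suc e ≤ length (remaining w) → Excess F (3 + g) n (suc e)
    delete w le = record
      { κ = restrict w κ ; R = map (λ s → Vec.removeAt s w) (remaining w) ; reps = restrict-reps w reps
      ; noRainbow = noRainbow ∘ restrict-rainbow w κ (expansion3 F)
      ; many = ≤-trans le (≤-reflexive (sym (Listₚ.length-map _ (remaining w)))) }

    -- If no deletion raises the excess, each vertex lies in at least as many triples of `R` as the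
    -- Turán number grows by from `n` to `suc n`, and `tp3-growth` estimates this growth.
    link-large : (∀ w → ¬ (tp3 (3 + g) n + suc e ≤ length (remaining w))) → ∀ w →
      (1 + g) * g * (suc n * suc n) ≤ Q * Q * Family.link reps w + c * suc n
    link-large none w = begin
      (1 + g) * g * (suc n * suc n)                               ≤⟨ *-monoʳ-≤ ((1 + g) * g) (*-mono-≤ n≤ n≤) ⟩
      (1 + g) * g * (Q * suc f * (Q * suc f))                     ≡⟨ eq₁ g Q f ⟩
      Q * Q * ((1 + g) * g * (f * f)) + (1 + g) * g * (Q * Q) * (2 * f + 1)
                                                                  ≤⟨ +-mono-≤ (*-monoʳ-≤ (Q * Q) growth) (*-monoʳ-≤ ((1 + g) * g * (Q * Q)) (+-mono-≤ (*-monoʳ-≤ 2 f≤n) (s≤s z≤n))) ⟩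
      Q * Q * Family.link reps w + (1 + g) * g * (Q * Q) * (2 * n + 2) ≡⟨ eq₂ (Q * Q * Family.link reps w) ((1 + g) * g * (Q * Q)) n ⟩
      Q * Q * Family.link reps w + c * suc n                      ∎
      where
      open ≤-Reasoning
      f = n / Q
      f≤n : f ≤ n
      f≤n = ≤-trans (m≤m*n f Q) (m/n*n≤m n Q)
      n≤ : suc n ≤ Q * suc f
      n≤ = ≤-trans (s≤s (≤-reflexive (m≡m%n+[m/n]*n n Q))) (≤-trans (+-monoˡ-≤ (f * Q) (m%n<n n Q)) (≤-reflexive (*-comm (suc f) Q)))
      deg = length (filter (contains? w) R)
      step : tp3 (3 + g) (suc n) ≤ tp3 (3 + g) n + deg
      step = +-cancelʳ-≤ e _ _ (begin
        tp3 (3 + g) (suc n) + e         ≤⟨ many ⟩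
        length R                        ≡⟨ length-filter-split (contains? w) R ⟩
        deg + length (remaining w)      ≤⟨ +-monoʳ-≤ deg (s≤s⁻¹ (≤-trans (≰⇒> (none w)) (≤-reflexive (+-suc (tp3 (3 + g) n) e)))) ⟩
        deg + (tp3 (3 + g) n + e)       ≡⟨ eq deg (tp3 (3 + g) n) e ⟩
        tp3 (3 + g) n + deg + e         ∎)
        where
        eq : ∀ d t e → d + (t + e) ≡ t + d + e
        eq = solve-∀
      growth : (1 + g) * g * (f * f) ≤ Family.link reps w
      growth = +-cancelˡ-≤ (2 * tp3 (3 + g) n) _ _ (begin
        2 * tp3 (3 + g) n + (1 + g) * g * (f * f)   ≤⟨ tp3-growth g n ⟩
        2 * tp3 (3 + g) (suc n)                     ≤⟨ *-monoʳ-≤ 2 step ⟩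
        2 * (tp3 (3 + g) n + deg)                   ≡⟨ *-distribˡ-+ 2 (tp3 (3 + g) n) deg ⟩
        2 * tp3 (3 + g) n + 2 * deg                 ≤⟨ +-monoʳ-≤ (2 * tp3 (3 + g) n) (Family.link≥ reps w) ⟩
        2 * tp3 (3 + g) n + Family.link reps w      ∎)
      eq₁ : ∀ g Q f → (1 + g) * g * (Q * suc f * (Q * suc f)) ≡ Q * Q * ((1 + g) * g * (f * f)) + (1 + g) * g * (Q * Q) * (2 * f + 1)
      eq₁ = solve-∀
      eq₂ : ∀ x y n → x + y * (2 * n + 2) ≡ x + 2 * y * suc n
      eq₂ = solve-∀

    descend : N ≤ suc n → ℓ ≤ e → Excess F (3 + g) n (suc e)
    descend N≤ ℓ≤e = from (any¿ (λ w → tp3 (3 + g) n + suc e ≤¿ length (remaining w)))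
      where
      from : Dec (∃ λ w → tp3 (3 + g) n + suc e ≤ length (remaining w)) → Excess F (3 + g) n (suc e)
      from (yes (w , le)) = delete w le
      from (no none) = ⊥-elim (no-many-representatives F g≥1 crit ℓ≤ class reps noRainbow (proj₁ structure) (proj₂ structure)
          (≤-trans (+-monoʳ-≤ (tp3 (3 + g) (suc n)) ℓ≤e) many))
        where
        structure : _
        structure = structured F g≥1 crit c N≤ reps noRainbow (link-large λ w le → none (w , le))

  descend-many : ∀ d {e} → ℓ ≤ e → Excess F (3 + g) (d + N) e → Excess F (3 + g) N (d + e)
  descend-many zero ℓ≤e B = B
  descend-many (suc d) {e} ℓ≤e B = subst (Excess F (3 + g) N) (+-suc d e)
    (descend-many d (≤-trans ℓ≤e (n≤1+n e)) (descend B (≤-trans (m≤n+m N d) (n≤1+n _)) ℓ≤e))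

  -- After `suc d` deletions the excess would be larger than the number of all subsets of the `N`
  -- remaining vertices.
  no-excess : ∀ d → length (allSubsets N) ≤ d → ¬ Excess F (3 + g) (suc d + N) ℓ
  no-excess d large B = <⇒≱ (s≤s large) (begin
      suc d                               ≤⟨ m≤m+n (suc d) ℓ ⟩
      suc d + ℓ                           ≤⟨ m≤n+m (suc d + ℓ) (tp3 (3 + g) N) ⟩
      tp3 (3 + g) N + (suc d + ℓ)         ≤⟨ Excess.many B′ ⟩
      length (Excess.R B′)                ≤⟨ unique-⊆⇒length≤ (Uniqueₚ.map⁻ (Representatives.rainbow (Excess.reps B′))) (λ {s} _ → ∈-allSubsets s) ⟩
      length (allSubsets N)               ∎)
    where
    open ≤-Reasoning
    B′ : Excess F (3 + g) N (suc d + ℓ)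
    B′ = descend-many (suc d) ≤-refl B

  n₀ : ℕ
  n₀ = suc (length (allSubsets N)) + N

  representatives-exist : ∀ {n} (κ : Colouring n) → ∃ λ R → Representatives κ R × length R ≡ numColours κ
  representatives-exist {n} κ = R , representatives (proj₁ (proj₂ chosen)) (subst Unique (sym eq) (deduplicate-! (map κ (triples n)))) ,
      trans (sym (Listₚ.length-map κ R)) (cong length eq)
    where
    choose : ∀ cs → (∀ {x} → x ∈ cs → x ∈ map κ (triples n)) → ∃ λ R → All (λ s → ∣ s ∣ ≡ 3) R × map κ R ≡ cs
    choose [] _ = [] , [] , refl
    choose (x ∷ cs) sub =
      let s , s∈ , e = ∈ₚ.∈-map⁻ κ (sub (here refl))
          R , al , eq = choose cs (sub ∘ there)
      in s ∷ R , proj₂ (∈ₚ.∈-filter⁻ (λ s → ∣ s ∣ ≟ℕ 3) {xs = allSubsets n} s∈) ∷ al , cong₂ _∷_ (sym e) eq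
    chosen : ∃ λ R → All (λ s → ∣ s ∣ ≡ 3) R × map κ R ≡ deduplicate _≟ℕ_ (map κ (triples n))
    chosen = choose _ (∈ₚ.∈-deduplicate⁻ _≟ℕ_ (map κ (triples n)))
    R = proj₁ chosen
    eq : map κ R ≡ deduplicate _≟ℕ_ (map κ (triples n))
    eq = proj₂ (proj₂ chosen)

  forces : ∀ n → n₀ ≤ n → ForcesRainbow n (expansion3 F) (tp3 (3 + g) n + ℓ)
  forces n n₀≤n κ le = decidable-stable (hasRainbowCopy? κ (expansion3 F)) λ noRainbow →
      no-excess d (+-cancelʳ-≤ N _ _ (s≤s⁻¹ (subst (n₀ ≤_) (sym n≡) n₀≤n))) (subst (λ n → Excess F (3 + g) n ℓ) (sym n≡) (excess noRainbow))
    where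
    d = n ∸ suc N
    n≡ : suc d + N ≡ n
    n≡ = trans (sym (+-suc d N)) (m∸n+n≡m (≤-trans (s≤s (m≤n+m N (length (allSubsets N)))) n₀≤n))
    excess : ¬ HasRainbowCopy κ (expansion3 F) → Excess F (3 + g) n ℓ
    excess noRainbow = let R , reps , len = representatives-exist κ in record
      { κ = κ ; R = R ; reps = reps ; noRainbow = noRainbow ; many = ≤-trans le (≤-reflexive (sym len)) }

-- The lower bound

-- The binary value of a set; it gives crossing triples their private colours.
code : ∀ {n} → Subset n → ℕ
code []      = 0
code (b ∷ s) = 𝟙 b + 2 * code s

code-injective : ∀ {n} (s t : Subset n) → code s ≡ code t → s ≡ t
code-injective [] [] _ = refl
code-injective (a ∷ s) (b ∷ t) e = bits a b e
  where
  bits : ∀ a b → 𝟙 a + 2 * code s ≡ 𝟙 b + 2 * code t → a ∷ s ≡ b ∷ t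
  bits true  true  e = cong (true ∷_) (code-injective s t (*-cancelˡ-≡ _ _ 2 (suc-injective e)))
  bits false false e = cong (false ∷_) (code-injective s t (*-cancelˡ-≡ _ _ 2 e))
  bits true  false e = ⊥-elim (even≢odd (code t) (code s) (sym e))
  bits false true  e = ⊥-elim (even≢odd (code s) (code t) e)

two-members : ∀ {n} (s : Subset n) x y → x ≢ y → lookup s x ≡ true → lookup s y ≡ true → 1 < ∣ s ∣
two-members s x y x≢y px py with extract s x px
... | s′ , refl , c with Subₚ.x∈p∪q⁻ ⁅ x ⁆ s′ (Vecₚ.lookup⇒[]= y s py)
...   | inj₁ y∈ = ⊥-elim (x≢y (sym (Subₚ.x∈⁅y⁆⇒x≡y x y∈)))
...   | inj₂ y∈ with extract s′ y (Vecₚ.[]=⇒lookup y∈)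
...     | _ , _ , c′ = subst (1 <_) (sym (trans c (cong suc c′))) (s≤s (s≤s z≤n))

lookup-tri : ∀ {n} (x y z : Fin n) → lookup (tri x y z) x ≡ true × lookup (tri x y z) y ≡ true
lookup-tri x y z = Vecₚ.[]=⇒lookup (Subₚ.x∈p∪q⁺ (inj₁ (Subₚ.x∈⁅x⁆ x))) ,
  Vecₚ.[]=⇒lookup (Subₚ.x∈p∪q⁺ {p = ⁅ x ⁆} (inj₂ (Subₚ.x∈p∪q⁺ (inj₁ (Subₚ.x∈⁅x⁆ y)))))

∣point∪∣ : ∀ {n} (x : Fin n) s → lookup s x ≡ false → ∣ ⁅ x ⁆ ∪ s ∣ ≡ suc ∣ s ∣
∣point∪∣ zero (false ∷ s) _ = cong (suc ∘ ∣_∣) (Subₚ.∪-identityˡ s)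
∣point∪∣ (suc x) (b ∷ s) e = trans (∣∷∣ b (⁅ x ⁆ ∪ s)) (trans (cong (𝟙 b +_) (∣point∪∣ x s e)) (trans (+-suc (𝟙 b) ∣ s ∣) (cong suc (sym (∣∷∣ b s)))))

∣tri∣ : ∀ {n} (x y z : Fin n) → x ≢ y → x ≢ z → y ≢ z → ∣ tri x y z ∣ ≡ 3
∣tri∣ x y z xy xz yz = trans (∣point∪∣ x (⁅ y ⁆ ∪ ⁅ z ⁆) (≢true λ p → outside (Subₚ.x∈p∪q⁻ ⁅ y ⁆ ⁅ z ⁆ (Vecₚ.lookup⇒[]= x _ p))))
  (cong suc (trans (∣point∪∣ y ⁅ z ⁆ (≢true λ p → yz (Subₚ.x∈⁅y⁆⇒x≡y z (Vecₚ.lookup⇒[]= y _ p)))) (cong suc (Subₚ.∣⁅x⁆∣≡1 z))))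
  where
  outside : x ∈ˢ ⁅ y ⁆ ⊎ x ∈ˢ ⁅ z ⁆ → ⊥
  outside (inj₁ p) = xy (Subₚ.x∈⁅y⁆⇒x≡y y p)
  outside (inj₂ p) = xz (Subₚ.x∈⁅y⁆⇒x≡y z p)

module Extremal {q : ℕ} (n : ℕ) (τ : Fin n → Fin q) (l : ℕ) where

  Crowded : Subset n → Fin q → Set
  Crowded s t = 1 < ∣ s ∩ partOf τ t ∣

  crowded? : ∀ s → Dec (∃ (Crowded s))
  crowded? s = any¿ (λ t → 2 ≤¿ ∣ s ∩ partOf τ t ∣)

  -- `l` stands for ℓ - 2, so triples with two vertices in a part use the ℓ - 1 colours up to `l`;
  -- the shift by `suc l` keeps the private colours apart from these.
  colourBy : ∀ s → Dec (∃ (Crowded s)) → ℕ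
  colourBy s (yes (t , _)) = toℕ t ⊓ l
  colourBy s (no _)        = suc l + code s

  κ : Colouring n
  κ s = colourBy s (crowded? s)

  κ-crossing : ∀ s → Crossing τ s → κ s ≡ suc l + code s
  κ-crossing s cr with crowded? s
  ... | yes (t , p) = ⊥-elim (<⇒≱ p (cr t))
  ... | no _ = refl

  -- Any two pairs in a triple meet, so a triple has only one crowded part and it does not matter
  -- which one the search returns.
  κ-crowded : ∀ {x y z} t → ∣ tri x y z ∣ ≡ 3 → τ x ≡ t → τ y ≡ t → κ (tri x y z) ≡ toℕ t ⊓ l
  κ-crowded {x} {y} {z} t e τx τy = from (crowded? (tri x y z))
    where
    in-part : ∀ w → τ w ≡ t → lookup (tri x y z) w ≡ true → lookup (tri x y z ∩ partOf τ t) w ≡ true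
    in-part w τw p = trans (Vecₚ.lookup-zipWith _∧_ w (tri x y z) (partOf τ t))
      (∧-true⁺ p (trans (Vecₚ.lookup∘tabulate (λ x → τ x ≐ t) w) (dec-true (τ w ≟ t) τw)))
    from : (d : Dec (∃ (Crowded (tri x y z)))) → colourBy (tri x y z) d ≡ toℕ t ⊓ l
    from (no none) = ⊥-elim (none (t , two-members (tri x y z ∩ partOf τ t) x y (proj₁ (tri-distinct x y z e))
      (in-part x τx (proj₁ (lookup-tri x y z))) (in-part y τy (proj₂ (lookup-tri x y z)))))
    from (yes (t′ , p)) = cong (λ t → toℕ t ⊓ l) (same (crowded-part τ (tri x y z) t′ e p))
      where
      same : (∃ λ x′ → ∃ λ y′ → ∃ λ z′ → tri x y z ≡ tri x′ y′ z′ × τ x′ ≡ t′ × τ y′ ≡ t′) → t′ ≡ t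
      same (x′ , y′ , z′ , eq , τx′ , τy′) = coincide
        (∈-tri x y z x′ (Vecₚ.lookup⇒[]= x′ _ (trans (cong (λ s → lookup s x′) eq) (proj₁ (lookup-tri x′ y′ z′)))))
        (∈-tri x y z y′ (Vecₚ.lookup⇒[]= y′ _ (trans (cong (λ s → lookup s y′) eq) (proj₂ (lookup-tri x′ y′ z′)))))
        where
        coincide : x′ ≡ x ⊎ x′ ≡ y ⊎ x′ ≡ z → y′ ≡ x ⊎ y′ ≡ y ⊎ y′ ≡ z → t′ ≡ t
        coincide (inj₁ refl) _ = trans (sym τx′) τx
        coincide (inj₂ (inj₁ refl)) _ = trans (sym τx′) τy
        coincide _ (inj₁ refl) = trans (sym τy′) τx
        coincide _ (inj₂ (inj₁ refl)) = trans (sym τy′) τy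
        coincide (inj₂ (inj₂ refl)) (inj₂ (inj₂ refl)) = ⊥-elim (proj₁ (tri-distinct x′ y′ z′ (trans (cong ∣_∣ (sym eq)) e)) refl)

  many-colours : (∀ x → x ≤ l → ∃ λ s → s ∈ triples n × κ s ≡ x) → suc l + length (filter (crossing? τ) (triples n)) ≤ numColours κ
  many-colours inner = ≤-trans (≤-reflexive (sym (trans (Listₚ.length-++ (List.upTo (suc l)))
      (cong₂ _+_ (Listₚ.length-upTo (suc l)) (Listₚ.length-map κ C)))))
    (unique-⊆⇒length≤ (Uniqueₚ.++⁺ (Uniqueₚ.upTo⁺ (suc l)) (unique-map-on κ injective C-unique) disjoint) (λ p → ∈ₚ.∈-deduplicate⁺ _≟ℕ_ (sub (∈ₚ.∈-++⁻ (List.upTo (suc l)) p))))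
    where
    C = filter (crossing? τ) (triples n)
    triples-unique : Unique (triples n)
    triples-unique = Uniqueₚ.filter⁺ (λ s → ∣ s ∣ ≟ℕ 3) (all-unique n)
      where
      all-unique : ∀ n → Unique (allSubsets n)
      all-unique zero = [] ∷ []
      all-unique (suc n) = Uniqueₚ.++⁺ (Uniqueₚ.map⁺ Vecₚ.∷-injectiveʳ (all-unique n)) (Uniqueₚ.map⁺ Vecₚ.∷-injectiveʳ (all-unique n)) heads
        where
        heads : ∀ {s} → ¬ (s ∈ map (true ∷_) (allSubsets n) × s ∈ map (false ∷_) (allSubsets n))
        heads (p , r) = let _ , _ , e = ∈ₚ.∈-map⁻ (true ∷_) p ; _ , _ , e′ = ∈ₚ.∈-map⁻ (false ∷_) r in
          case trans (sym e) e′ of λ ()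
    C-unique : Unique C
    C-unique = Uniqueₚ.filter⁺ (crossing? τ) triples-unique
    C⁻ : ∀ {s} → s ∈ C → s ∈ triples n × Crossing τ s
    C⁻ = ∈ₚ.∈-filter⁻ (crossing? τ) {xs = triples n}
    injective : ∀ {s t} → s ∈ C → t ∈ C → κ s ≡ κ t → s ≡ t
    injective {s} {t} p r e = code-injective s t (+-cancelˡ-≡ (suc l) _ _
      (trans (sym (κ-crossing s (proj₂ (C⁻ p)))) (trans e (κ-crossing t (proj₂ (C⁻ r))))))
    disjoint : ∀ {x} → ¬ (x ∈ List.upTo (suc l) × x ∈ map κ C)
    disjoint (p , r) = let s , s∈ , e = ∈ₚ.∈-map⁻ κ r in
      <⇒≱ (∈ₚ.∈-upTo⁻ p) (≤-trans (m≤m+n (suc l) (code s)) (≤-reflexive (sym (trans e (κ-crossing s (proj₂ (C⁻ s∈)))))))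
    sub : ∀ {x} → x ∈ List.upTo (suc l) ⊎ x ∈ map κ C → x ∈ map κ (triples n)
    sub (inj₁ p) = let s , s∈ , e = inner _ (s≤s⁻¹ (∈ₚ.∈-upTo⁻ p)) in subst (_∈ map κ (triples n)) e (∈ₚ.∈-map⁺ κ s∈)
    sub (inj₂ r) = let s , s∈ , e = ∈ₚ.∈-map⁻ κ r in subst (_∈ map κ (triples n)) (sym e) (∈ₚ.∈-map⁺ κ (proj₁ (C⁻ s∈)))

module LowerBound (F : Graph) {g l : ℕ} (l≤ : l ≤ 1 + g) (critical : DoublyEdgeCritical F (3 + g)) (class : InClass F (3 + g) (2 + l))
                  {n : ℕ} (n≥ : 3 * (2 + g) ≤ n) where
  open Graph F

  Q : ℕ
  Q = 2 + g

  τ : Fin n → Fin Q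
  τ = residue (1 + g) n

  open Extremal n τ l public

  -- The vertices x, x + Q and x + 2 Q lie in one residue class; this is why `n` must be at least 3
  -- Q.
  inner : ∀ x → x ≤ l → ∃ λ s → s ∈ triples n × κ s ≡ x
  inner x x≤l = tri (pt 0 (s≤s z≤n)) (pt 1 (s≤s (s≤s z≤n))) (pt 2 ≤-refl) ,
      ∈-triples _ sz , trans (κ-crowded j sz (pt-type 0 (s≤s z≤n)) (pt-type 1 (s≤s (s≤s z≤n)))) (trans (cong (_⊓ l) (Finₚ.toℕ-fromℕ< _)) (m≤n⇒m⊓n≡m x≤l))
    where
    x<Q : x < Q
    x<Q = s≤s (≤-trans x≤l l≤)
    j : Fin Q
    j = fromℕ< x<Q
    bound : ∀ a → a < 3 → x + a * Q < n
    bound a a<3 = ≤-trans (+-monoˡ-≤ (a * Q) x<Q) (≤-trans (*-monoˡ-≤ Q a<3) n≥)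
    pt : ∀ a → a < 3 → Fin n
    pt a a<3 = fromℕ< (bound a a<3)
    pt-type : ∀ a a<3 → τ (pt a a<3) ≡ j
    pt-type a a<3 = Finₚ.toℕ-injective (trans (Finₚ.toℕ-fromℕ< _) (trans (cong (_% Q) (Finₚ.toℕ-fromℕ< (bound a a<3)))
      (trans ([m+kn]%n≡m%n x a Q) (trans (m<n⇒m%n≡m x<Q) (sym (Finₚ.toℕ-fromℕ< x<Q))))))
    pt-≢ : ∀ a b {p r} → a ≢ b → pt a p ≢ pt b r
    pt-≢ a b {p} {r} ne e = ne (*-cancelʳ-≡ a b Q (+-cancelˡ-≡ x _ _ (trans (sym (Finₚ.toℕ-fromℕ< (bound a p))) (trans (cong toℕ e) (Finₚ.toℕ-fromℕ< (bound b r))))))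
    sz : ∣ tri (pt 0 (s≤s z≤n)) (pt 1 (s≤s (s≤s z≤n))) (pt 2 ≤-refl) ∣ ≡ 3
    sz = ∣tri∣ _ _ _ (pt-≢ 0 1 {s≤s z≤n} {s≤s (s≤s z≤n)} λ ()) (pt-≢ 0 2 {s≤s z≤n} {≤-refl} λ ()) (pt-≢ 1 2 {s≤s (s≤s z≤n)} {≤-refl} λ ())

  enough-colours : tp3 (3 + g) n + suc l ≤ numColours κ
  enough-colours = ≤-trans (≤-reflexive (trans (+-comm _ (suc l)) (cong (suc l +_) (trans (tp3-esym (1 + g) n) (sym (length-crossing n τ))))))
    (many-colours inner)

  no-rainbow : ¬ HasRainbowCopy κ (expansion3 F)
  no-rainbow (φ , φ-inj , dist) = by-class class
    where
    π : Fin m → Fin Q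
    π a = τ (φ (a ↑ˡ k))
    open ClassFacts F π
    left≢right : ∀ (a : Fin m) (i : Fin k) → a ↑ˡ k ≢ m ↑ʳ i
    left≢right a i e = case trans (sym (Finₚ.splitAt-↑ˡ m a k)) (trans (cong (splitAt m) e) (Finₚ.splitAt-↑ʳ m k i)) of λ ()
    colour : ∀ i {t} → π (u F i) ≡ t → π (v F i) ≡ t → κ (img3 φ (Graph3.edge (expansion3 F) i)) ≡ toℕ t ⊓ l
    colour i {t} p r = κ-crowded t (∣tri∣ _ _ _
      (λ e → <-irrefl (cong toℕ (Finₚ.↑ˡ-injective k _ _ (φ-inj e))) (ordered i))
      (left≢right (u F i) i ∘ φ-inj) (left≢right (v F i) i ∘ φ-inj)) p r
    at-most-one : ∀ t → eIn F π t ≤ 1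
    at-most-one t = ≮⇒≥ λ two → let i , j , ne , (p , r) , (p′ , r′) = eIn-two t two in
      dist i j ne (trans (colour i p r) (sym (colour j p′ r′)))
    -- `InPF` asks for an edge inside some part. One exists, as otherwise `π` would colour `F` minus
    -- an edge with fewer than p colours.
    mono : ∃ λ i → π (u F i) ≡ π (v F i)
    mono = decidable-stable (Finₚ.any? λ i → π (u F i) ≟ π (v F i)) λ none →
      <⇒≱ ≤-refl (proj₁ critical (proj₁ (proj₂ critical)) Q (π , λ i _ e → none (i , e)))
    inPF : InPF F π
    inPF = at-most-one , π (u F (proj₁ mono)) , ≤-antisym (at-most-one _) (eIn≥1 (proj₁ mono) refl (sym (proj₂ mono)))
    by-class : InClass F (3 + g) (2 + l) → ⊥
    by-class (inj₂ (_ , none)) = none π inPF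
    by-class (inj₁ (_ , _ , _ , minimal)) = <⇒≱ ≤-refl (begin
      2 + l                                       ≤⟨ minimal π inPF ⟩
      norm1 F π                                   ≡⟨ norm1-singles at-most-one ⟩
      length singles                              ≡⟨ sym (Listₚ.length-map f singles) ⟩
      length (map f singles)                      ≤⟨ unique-⊆⇒length≤ (unique-map-on f injective singles-unique) small ⟩
      length (List.upTo (suc l))                  ≡⟨ Listₚ.length-upTo (suc l) ⟩
      suc l                                       ∎)
      where
      open ≤-Reasoning
      f : Fin Q → ℕ
      f t = toℕ t ⊓ l
      small : ∀ {x} → x ∈ map f singles → x ∈ List.upTo (suc l)
      small p = let t , _ , e = ∈ₚ.∈-map⁻ f p in subst (_∈ List.upTo (suc l)) (sym e) (∈ₚ.∈-upTo⁺ (s≤s (m⊓n≤n (toℕ t) l)))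
      -- Two parts that contain an edge must have different colours, so there are at most `suc l` of
      -- them, one less than the class requires.
      injective : ∀ {s t} → s ∈ singles → t ∈ singles → f s ≡ f t → s ≡ t
      injective {s} {t} p r e = decidable-stable (s ≟ t) λ ne →
        let i , is , is′ = eIn-pos s (≤-reflexive (sym (singles⁻ p)))
            j , jt , jt′ = eIn-pos t (≤-reflexive (sym (singles⁻ r)))
        in dist i j (λ i≡j → ne (trans (sym is) (trans (cong (π ∘ u F) i≡j) jt))) (trans (colour i is is′) (trans e (sym (colour j jt jt′))))

  lower-bound : ∀ N → ForcesRainbow n (expansion3 F) N → tp3 (3 + g) n + (2 + l) ≤ N
  lower-bound N forces = ≮⇒≥ λ N< → no-rainbow (forces κ (≤-trans (s≤s⁻¹ (≤-trans N< (≤-reflexive (+-suc _ (suc l))))) enough-colours))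

-- If one of the two edges joined different colours of `π₀`, or if the two coincided, then `F` minus
-- a single edge would be colourable with p - 1 colours.
critical-edges : ∀ (F : Graph) g → DoublyEdgeCritical F (3 + g) → Critical F (2 + g)
critical-edges F g (χ≥ , e₁ , e₂ , (π₀ , proper) , _) = record
  { e₁ = e₁ ; e₂ = e₂ ; π₀ = π₀
  ; e₁≢e₂ = λ e → <⇒≱ ≤-refl (χ≥ e₁ (2 + g) (π₀ , λ i ne → proper i (ne , λ e′ → ne (trans e′ (sym e)))))
  ; proper = λ i n₁ n₂ → proper i (n₁ , n₂)
  ; mono₁ = decidable-stable (_ ≟ _) λ ne → <⇒≱ ≤-refl (χ≥ e₂ (2 + g) (π₀ , λ i n₂ → case i ≟ e₁ of λ { (yes refl) → ne ; (no n₁) → proper i (n₁ , n₂) }))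
  ; mono₂ = decidable-stable (_ ≟ _) λ ne → <⇒≱ ≤-refl (χ≥ e₁ (2 + g) (π₀ , λ i n₁ → case i ≟ e₂ of λ { (yes refl) → ne ; (no n₂) → proper i (n₁ , n₂) })) }

theorem1p2 : ∀ (p ℓ : ℕ) → 3 < p → 2 ≤ ℓ → ℓ ≤ p →
    (F : Graph) → DoublyEdgeCritical F p → InClass F p ℓ →
    ∃[ n₀ ] (∀ n → n₀ ≤ n → IsAntiRamsey3 n (expansion3 F) (tp3 p n + ℓ))
theorem1p2 (suc (suc (suc g))) (suc (suc l)) (s≤s (s≤s (s≤s g≥1))) _ ℓ≤p F critical class =
  -- The first summand serves the upper bound, the second guarantees three vertices in every residue
  -- class for the lower bound.
  n₀ + 3 * (2 + g) , λ n large →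
    forces n (≤-trans (m≤m+n n₀ _) large) ,
    LowerBound.lower-bound F (s≤s⁻¹ (s≤s⁻¹ ℓ≤p)) critical class (≤-trans (m≤n+m _ n₀) large)
  where
  open Descent F g≥1 (critical-edges F g critical) ℓ≤p class using (n₀; forces)
theorem1p2 (suc zero) _ (s≤s ()) _ _
theorem1p2 (suc (suc zero)) _ (s≤s (s≤s ())) _ _
theorem1p2 _ zero _ () _
theorem1p2 _ (suc zero) _ (s≤s ()) _
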